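{- Let $k \geq 3$ and let $F$ be a $k$-edge graph with $\gamma(F)=1$. A connected $m$-edge graph $G$ satisfies $\iota(G,F) = \frac{m+1}{k+2}$ if and only if $G$ is a pure $(m,F)$-special graph or $G$ is isomorphic to $F+e$ for some $e \in E(\overline{F})$.
   Context: All graphs are finite and simple. A copy of a graph $F$ in $G$ (an $F$-copy) is a subgraph of $G$ isomorphic to $F$ (not necessarily induced). $N[v]$ is the closed neighbourhood of $v$ and $N[D]=\bigcup_{v\in D}N[v]$. A set $D\subseteq V(G)$ is an $F$-isolating set of $G$ if $G-N[D]$ contains no $F$-copy (equivalently, $N[D]$ meets the vertex set of every $F$-copy in $G$); $\iota(G,F)$ is the minimum size of an $F$-isolating set of $G$. $\gamma(F)=1$ means $F$ has a vertex adjacent to all other vertices of $F$. $\overline{F}$ is the complement of $F$, and for $e\in E(\overline{F})$, $F+e$ is the graph $(V(F),E(F)\cup\{e\})$. ($m,F$)-special graphs: Let $m,k\ge 0$ be integers and $F$ a connected $k$-edge graph. Write $m+1=q(k+2)+r$ with integers $q\ge 0$, $0\le r\le k+1$. If $q=0$, an $(m,F)$-special graph is any connected $m$-edge graph. If $q\ge 1$, take distinct vertices $v_1,\dots,v_q$, copies $F_1,\dots,F_q$ of $F$ whose vertex sets are pairwise disjoint and disjoint from $\{v_1,\dots,v_q\}$, vertices $w_i\in V(F_i)$, and let $G_i$ be the graph with vertex set $\{v_i\}\cup V(F_i)$ and edge set $E(F_i)\cup\{v_iw_i\}$ (the $F$-constituents, with $F$-connection $v_i$). Let $T$ be a tree with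 vertex set $\{v_1,\dots,v_q\}$ (the quotient graph) and $T'$ a connected $r$-edge graph with $V(T')\cap\bigcup_i V(G_i)=\{v_q\}$ (the remainder graph). The graph with vertex set $V(T')\cup\bigcup_i V(G_i)$ and edge set $E(T)\cup E(T')\cup\bigcup_i E(G_i)$ is an $(m,F)$-special graph; it is a connected $m$-edge graph. It is pure if its remainder graph has no edges (so $m+1=q(k+2)$ with $q\ge1$). -}

module Defs where

open import Data.Nat using (ℕ; zero; suc; _+_; _*_; _≤_)
open import Data.Bool using (Bool; true; false; _∧_; _∨_; if_then_else_)
open import Data.Bool.Properties using (∨-comm; ∧-comm)
open import Data.Fin using (Fin; zero; suc; toℕ; inject₁; fromℕ; _≟_; _<?_)
open import Data.Fin.Subset using (Subset; _∈_; ∣_∣)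
open import Data.List using (List; allFin; map)
open import Data.Nat.ListAction using (sum)
open import Data.Product using (Σ; ∃; ∃-syntax; _×_; _,_; proj₁)
open import Data.Sum using (_⊎_; inj₁; inj₂)
open import Relation.Nullary using (¬_)
open import Relation.Nullary.Decidable using (⌊_⌋)
open import Relation.Binary.PropositionalEquality using (_≡_; _≢_; refl; cong₂; trans)
open import Function.Definitions using (Injective; Bijective)

record Graph (n : ℕ) : Set where
  field
    adj    : Fin n → Fin n → Bool
    sym    : ∀ i j → adj i j ≡ adj j i
    irrefl : ∀ i → adj i i ≡ false
open Graph public

numEdges : ∀ {n} → Graph n → ℕ
numEdges {n} G =
  sum (map (λ i → sum (map (λ j →
        if ⌊ i <? j ⌋ ∧ adj G i j then 1 else 0) (allFin n))) (allFin n))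

data Reach {n} (G : Graph n) : Fin n → Fin n → Set where
  here : ∀ {i} → Reach G i i
  step : ∀ {i j l} → adj G i j ≡ true → Reach G j l → Reach G i l

Connected : ∀ {n} → Graph n → Set
Connected {n} G = ∀ (i j : Fin n) → Reach G i j

IsCycle : ∀ {n} (G : Graph n) (l : ℕ) → (Fin (3 + l) → Fin n) → Set
IsCycle G l c =
  Injective _≡_ _≡_ c
  × (∀ (i : Fin (2 + l)) → adj G (c (inject₁ i)) (c (suc i)) ≡ true)
  × adj G (c (fromℕ (2 + l))) (c zero) ≡ true

Acyclic : ∀ {n} → Graph n → Set
Acyclic {n} G = ∀ (l : ℕ) (c : Fin (3 + l) → Fin n) → ¬ IsCycle G l c

IsTree : ∀ {n} → Graph n → Set
IsTree G = Connected G × Acyclic G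

DominationOne : ∀ {p} → Graph p → Set
DominationOne {p} F = ∃[ c ] (∀ (x : Fin p) → x ≢ c → adj F c x ≡ true)

Copy : ∀ {p n} → Graph p → Graph n → Set
Copy {p} {n} F G =
  Σ (Fin p → Fin n) λ φ →
    Injective _≡_ _≡_ φ × (∀ a b → adj F a b ≡ true → adj G (φ a) (φ b) ≡ true)

InClosedNbhd : ∀ {n} → Graph n → Subset n → Fin n → Set
InClosedNbhd G D x = ∃[ u ] (u ∈ D × (u ≡ x ⊎ adj G u x ≡ true))

Isolating : ∀ {p n} → Graph n → Graph p → Subset n → Set
Isolating G F D = ∀ (c : Copy F G) → ∃[ a ] InClosedNbhd G D (proj₁ c a)

IotaIs : ∀ {p n} → Graph n → Graph p → ℕ → Set
IotaIs G F d =
  (∃[ D ] (Isolating G F D × ∣ D ∣ ≡ d))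
  × (∀ D → Isolating G F D → d ≤ ∣ D ∣)

_≅_ : ∀ {n n'} → Graph n → Graph n' → Set
_≅_ {n} {n'} G H =
  Σ (Fin n → Fin n') λ f →
    Bijective _≡_ _≡_ f × (∀ i j → adj H (f i) (f j) ≡ adj G i j)

private
  isPair : ∀ {p} → Fin p → Fin p → Fin p → Fin p → Bool
  isPair a b i j = (⌊ i ≟ a ⌋ ∧ ⌊ j ≟ b ⌋) ∨ (⌊ i ≟ b ⌋ ∧ ⌊ j ≟ a ⌋)

  isPair-sym : ∀ {p} (a b i j : Fin p) → isPair a b i j ≡ isPair a b j i
  isPair-sym a b i j =
    trans (∨-comm (⌊ i ≟ a ⌋ ∧ ⌊ j ≟ b ⌋) (⌊ i ≟ b ⌋ ∧ ⌊ j ≟ a ⌋))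
          (cong₂ _∨_ (∧-comm ⌊ i ≟ b ⌋ ⌊ j ≟ a ⌋) (∧-comm ⌊ i ≟ a ⌋ ⌊ j ≟ b ⌋))

  isPair-irr : ∀ {p} (a b : Fin p) → a ≢ b → ∀ i → isPair a b i i ≡ false
  isPair-irr a b a≢b i with i ≟ a | i ≟ b
  ... | Relation.Nullary.yes refl | Relation.Nullary.yes refl = Data.Empty.⊥-elim (a≢b refl)
    where import Data.Empty
  ... | Relation.Nullary.yes _ | Relation.Nullary.no _ = refl
  ... | Relation.Nullary.no _ | Relation.Nullary.yes _ = refl
  ... | Relation.Nullary.no _ | Relation.Nullary.no _ = refl

-- F + ab  (intended for a non-edge ab of F, a ≠ b)
addEdge : ∀ {p} → Graph p → (a b : Fin p) → a ≢ b → Graph p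
addEdge F a b a≢b = record
  { adj    = λ i j → adj F i j ∨ isPair a b i j
  ; sym    = λ i j → cong₂ _∨_ (sym F i j) (isPair-sym a b i j)
  ; irrefl = λ i → cong₂ _∨_ (irrefl F i) (isPair-irr a b a≢b i)
  }

-- Pure (m,F)-special graphs
--
-- Vertices of the model: inj₁ i  = F-connection v_i  (i : Fin q),
--                        inj₂ (i , a) = vertex a of the copy F_i.
-- Edges: tree edges v_i v_j (T), edges of each F_i, and v_i w_i.

specialAdj : ∀ {q p} → Graph q → Graph p → (Fin q → Fin p)
           → Fin q ⊎ (Fin q × Fin p) → Fin q ⊎ (Fin q × Fin p) → Bool
specialAdj T F w (inj₁ i)       (inj₁ j)       = adj T i j
specialAdj T F w (inj₁ i)       (inj₂ (j , b)) = ⌊ i ≟ j ⌋ ∧ ⌊ b ≟ w i ⌋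
specialAdj T F w (inj₂ (i , a)) (inj₁ j)       = ⌊ i ≟ j ⌋ ∧ ⌊ a ≟ w j ⌋
specialAdj T F w (inj₂ (i , a)) (inj₂ (j , b)) = ⌊ i ≟ j ⌋ ∧ adj F a b

PureSpecial : ∀ {p n} → ℕ → Graph p → Graph n → Set
PureSpecial {p} {n} m F G =
  ∃[ q ] (1 ≤ q × m + 1 ≡ q * (numEdges F + 2) ×
    Σ (Graph q) λ T → IsTree T ×
    Σ (Fin q → Fin p) λ w →
    Σ (Fin q ⊎ (Fin q × Fin p) → Fin n) λ place →
      Bijective _≡_ _≡_ place ×
      (∀ x y → adj G (place x) (place y) ≡ specialAdj T F w x y))

{-# OPTIONS --safe #-}

-- Call a connected graph S loose if (k + 2) |D| ≤ |E(S)| for some F-isolating set D, and tight if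
-- it is pure special or F + e.  By induction on |V(S)|, every connected S is isomorphic to F,
-- tight, or loose.
--
-- If deleting a vertex x leaves a component isomorphic to F, put x into D: the other components
-- are paid for by their edges to x, and nothing is gained only when S is pure special.  If
-- deleting x leaves a tight component, either x takes over the role of one vertex of its
-- isolating set, so S is loose, or x is joined to F-connections only, and such a connection is a
-- vertex of the first kind.  Otherwise take the centre v of a copy of F.  Either N[v] and the
-- components of S - N[v] show S to be loose or tight, or S splits into connected parts R and
-- H ≅ F; adding the centre of H to an isolating set of R is cheap enough unless H is joined to R
-- by two or three edges and R is F or tight.  In these last cases one or two vertices isolate S:
-- a copy of F surviving an unlucky choice forces a vertex of degree one, and trying the other
-- ends of the joining edges then forces the same vertex to have degree at least p - 2.

module Submission where

open import Defs
open import Data.Nat using (ℕ; zero; suc; _+_; _*_; _≤_; _<_; z≤n; s≤s; _≤?_)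
open import Data.Nat.Properties hiding (_≟_; _<?_; <-cmp; suc-injective)
open import Data.Nat.Tactic.RingSolver using (solve-∀)
import Data.Nat.ListAction as ListAction
import Algebra.Properties.CommutativeMonoid.Sum +-0-commutativeMonoid as Sum
open import Data.Bool using (Bool; true; false; _∧_; _∨_; not; if_then_else_)
import Data.Bool.Properties as Bool
open import Data.Fin using (Fin; zero; suc; toℕ; fromℕ; fromℕ<; inject₁; _≟_; _<?_)
open import Data.Fin.Properties
  using (any?; all?; <-cmp; suc-injective; injective⇒≤; toℕ-inject₁)
open import Data.Fin.Relation.Unary.Top using (view; ‵fromℕ; ‵inject₁)
import Data.Fin.Subset as Subset
open import Data.List using (List; []; _∷_; _++_; length; map; allFin; tabulate; lookup)
open import Data.List.Properties
  using (length-map; length-++; map-++; map-tabulate; length-tabulate)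
import Data.List.Relation.Unary.All as All
import Data.List.Relation.Unary.Any as Any
open Any using (here; there)
open import Data.List.Relation.Unary.Any.Properties using (lookup-index)
open import Data.List.Relation.Unary.AllPairs using (AllPairs; []; _∷_)
import Data.List.Relation.Unary.AllPairs.Properties as AllPairs
open import Data.List.Membership.Propositional using (find; lose) renaming (_∈_ to _∈ˡ_)
open import Data.List.Membership.Propositional.Properties
  using (∈-map⁺; ∈-++⁺ˡ; ∈-++⁺ʳ; ∈-++⁻; ∈-tabulate⁺; ∈-lookup)
import Data.Vec as Vec
open import Data.Vec.Properties using (lookup∘tabulate; lookup⇒[]=; []=⇒lookup)
open import Data.Product using (Σ; ∃; ∃-syntax; _×_; _,_; proj₁; proj₂; map₁)
open import Data.Sum using (_⊎_; inj₁; inj₂; [_,_]′)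
open import Data.Empty using (⊥)
open import Function using (_∘_; case_of_)
open import Function.Bundles using (_⇔_; mk⇔)
open import Function.Definitions using (Injective)
open import Relation.Nullary using (¬_; Dec; yes; no; contradiction)
open import Relation.Nullary.Decidable using (⌊_⌋; map′; _×-dec_; ¬?)
open import Relation.Binary.Definitions using (tri<; tri≈; tri>)
open import Relation.Binary.PropositionalEquality
  using (_≡_; _≢_; refl; cong; cong₂; subst; trans; module ≡-Reasoning)
  renaming (sym to ≡-sym)

-- The bookkeeping is in units of `k + 2`, the price of one isolating vertex. A loose graph pays for
-- its isolating set with its own edges, a tight graph is one edge short, and `F` is two edges
-- short: it needs one vertex and owns only `k` edges. Hence `F` is an outcome of its own and must
-- be absorbed wherever it occurs as a piece. The thresholds follow: the centre of H is affordable
-- with two joining edges if R is loose, three if R is tight and four if R is `F`, while a single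
-- joining edge makes H a component once its end in R is deleted. A dominating vertex in `F`
-- confines every copy to the closed neighbourhood of its centre. Surviving copies are therefore
-- classified by the position of the centre and refuted by counting vertices or edges: a copy that
-- loses two vertices of a set of size `p` and gains one does not fit. All graphs of the induction
-- are vertex subsets of one fixed graph, so isomorphisms appear only at the end. The quotient tree
-- is not carried along either; it is recovered from the edge count.

halve-≤ : ∀ {a b} → a + a ≤ b + b → a ≤ b
halve-≤ {a} {b} h with a ≤? b
... | yes a≤b = a≤b
... | no  a≰b = contradiction h (<⇒≱ (+-mono-< (≰⇒> a≰b) (≰⇒> a≰b)))

halve-≡ : ∀ {a b} → a + a ≡ b + b → a ≡ b
halve-≡ h = ≤-antisym (halve-≤ (≤-reflexive h)) (halve-≤ (≤-reflexive (≡-sym h)))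

-- Finite sums and indicator values.

⟦_⟧ : Bool → ℕ
⟦ b ⟧ = if b then 1 else 0

-- Abstract so that sum f determines f during unification.
abstract
  sum : ∀ {n} → (Fin n → ℕ) → ℕ
  sum = Sum.sum

  sum-cong : ∀ {n} {f g : Fin n → ℕ} → (∀ i → f i ≡ g i) → sum f ≡ sum g
  sum-cong = Sum.sum-cong-≗

  sum-+ : ∀ {n} (f g : Fin n → ℕ) → sum (λ i → f i + g i) ≡ sum f + sum g
  sum-+ = Sum.∑-distrib-+

  sum-swap : ∀ {m n} (f : Fin m → Fin n → ℕ) →
    sum (λ i → sum (f i)) ≡ sum (λ j → sum λ i → f i j)
  sum-swap = Sum.∑-comm

  sum-head : ∀ {n} (f : Fin (suc n) → ℕ) → sum f ≡ f zero + sum (f ∘ suc)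
  sum-head f = refl

  sum-empty : (f : Fin 0 → ℕ) → sum f ≡ 0
  sum-empty f = refl

  sum-mono : ∀ {n} {f g : Fin n → ℕ} → (∀ i → f i ≤ g i) → sum f ≤ sum g
  sum-mono {zero}  h = z≤n
  sum-mono {suc n} h = +-mono-≤ (h zero) (sum-mono (h ∘ suc))

  sum-zero : ∀ {n} {f : Fin n → ℕ} → (∀ i → f i ≡ 0) → sum f ≡ 0
  sum-zero {zero}  h = refl
  sum-zero {suc n} h = cong₂ _+_ (h zero) (sum-zero (h ∘ suc))

  sum-single : ∀ {n} (f : Fin n → ℕ) u → (∀ i → i ≢ u → f i ≡ 0) → sum f ≡ f u
  sum-single f zero h =
    trans (cong (f zero +_) (sum-zero λ i → h (suc i) λ ())) (+-identityʳ _)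
  sum-single f (suc u) h =
    trans (cong (_+ sum (f ∘ suc)) (h zero λ ()))
          (sum-single (f ∘ suc) u λ i i≢u → h (suc i) (i≢u ∘ suc-injective))

  term≤sum : ∀ {n} (f : Fin n → ℕ) i → f i ≤ sum f
  term≤sum f zero    = m≤m+n _ _
  term≤sum f (suc i) = ≤-trans (term≤sum (f ∘ suc) i) (m≤n+m _ _)

  sum-positive : ∀ {n} (f : Fin n → ℕ) → 1 ≤ sum f → ∃ λ i → 1 ≤ f i
  sum-positive {suc n} f h with f zero in eq
  ... | suc _ = zero , subst (1 ≤_) (≡-sym eq) (s≤s z≤n)
  ... | zero with sum-positive (f ∘ suc) h
  ...   | i , p = suc i , p

  sum-≡⇒≗ : ∀ {n} {f g : Fin n → ℕ} → (∀ i → f i ≤ g i) → sum g ≤ sum f → ∀ i → f i ≡ g i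
  sum-≡⇒≗ {suc n} {f} {g} f≤g h zero = ≤-antisym (f≤g zero)
    (+-cancelʳ-≤ (sum (g ∘ suc)) _ _ (≤-trans h (+-monoʳ-≤ (f zero) (sum-mono (f≤g ∘ suc)))))
  sum-≡⇒≗ {suc n} {f} {g} f≤g h (suc i) = sum-≡⇒≗ (f≤g ∘ suc)
    (+-cancelˡ-≤ (g zero) _ _ (≤-trans h (+-monoˡ-≤ (sum (f ∘ suc)) (f≤g zero)))) i

if-yes : ∀ {a} {A : Set a} (d : Dec A) → A → ⌊ d ⌋ ≡ true
if-yes (yes _) a = refl
if-yes (no ¬a) a = contradiction a ¬a

if-no : ∀ {a} {A : Set a} (d : Dec A) → ¬ A → ⌊ d ⌋ ≡ false
if-no (yes a) ¬a = contradiction a ¬a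
if-no (no _)  ¬a = refl

yes⇒ : ∀ {a} {A : Set a} (d : Dec A) → ⌊ d ⌋ ≡ true → A
yes⇒ (yes a) _ = a

sum-split : ∀ {n} (h : Fin n → ℕ) u →
  sum h ≡ h u + sum (λ x → if ⌊ x ≟ u ⌋ then 0 else h x)
sum-split h u = begin
  sum h                                ≡⟨ sum-cong pointwise ⟩
  sum (λ x → at x + off x)             ≡⟨ sum-+ at off ⟩
  sum at + sum off                     ≡⟨ cong (_+ sum off) (trans (sum-single at u away) here′) ⟩
  h u + sum off                        ∎
  where
  open ≡-Reasoning
  at off : Fin _ → ℕ
  at x  = if ⌊ x ≟ u ⌋ then h x else 0
  off x = if ⌊ x ≟ u ⌋ then 0 else h x
  pointwise : ∀ x → h x ≡ at x + off x
  pointwise x with ⌊ x ≟ u ⌋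
  ... | true  = ≡-sym (+-identityʳ _)
  ... | false = refl
  away : ∀ i → i ≢ u → at i ≡ 0
  away i i≢u rewrite if-no (i ≟ u) i≢u = refl
  here′ : at u ≡ h u
  here′ rewrite if-yes (u ≟ u) refl = refl

-- Induction on the domain: the term at `φ zero` is split off and `h` is set to zero there, a change
-- that injectivity hides from all other terms.
sum-injective : ∀ {m n} (φ : Fin m → Fin n) → Injective _≡_ _≡_ φ → (h : Fin n → ℕ) →
  sum (h ∘ φ) ≤ sum h
sum-injective {zero}  φ inj h = ≤-trans (≤-reflexive (sum-empty _)) z≤n
sum-injective {suc m} φ inj h = begin
  sum (h ∘ φ)                       ≡⟨ sum-head _ ⟩
  h (φ zero) + sum (h ∘ φ ∘ suc)    ≡⟨ cong (h (φ zero) +_) (sum-cong same) ⟩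
  h (φ zero) + sum (off ∘ φ ∘ suc)  ≤⟨ +-monoʳ-≤ (h (φ zero))
                                         (sum-injective (φ ∘ suc) (suc-injective ∘ inj) off) ⟩
  h (φ zero) + sum off              ≡⟨ sum-split h (φ zero) ⟨
  sum h                             ∎
  where
  open ≤-Reasoning
  off : Fin _ → ℕ
  off x = if ⌊ x ≟ φ zero ⌋ then 0 else h x
  same : ∀ a → h (φ (suc a)) ≡ off (φ (suc a))
  same a rewrite if-no (φ (suc a) ≟ φ zero) (λ eq → case inj eq of λ ()) = refl

sum-map-allFin : ∀ {n} (f : Fin n → ℕ) → ListAction.sum (map f (allFin n)) ≡ sum f
sum-map-allFin f = trans (cong ListAction.sum (map-tabulate (λ i → i) f)) (go f)
  where
  go : ∀ {n} (f : Fin n → ℕ) → ListAction.sum (tabulate f) ≡ sum f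
  go {zero}  f = ≡-sym (sum-empty f)
  go {suc n} f = trans (cong (f zero +_) (go (f ∘ suc))) (≡-sym (sum-head f))

numEdges-sum : ∀ {n} (G : Graph n) →
  numEdges G ≡ sum λ i → sum λ j → ⟦ ⌊ i <? j ⌋ ∧ adj G i j ⟧
numEdges-sum G = trans (sum-map-allFin _) (sum-cong λ i → sum-map-allFin _)

-- Subsets of Fin n

Sub : ℕ → Set
Sub n = Fin n → Bool

infix 4 _∈_ _∉_ _⊆_
infixl 6 _∪_ _∩_ _∖_

-- A record rather than the bare equation, so that S can be inferred from x ∈ S.
record _∈_ {n} (x : Fin n) (S : Sub n) : Set where
  constructor mem
  field holds : S x ≡ true
open _∈_ public

_∉_ : ∀ {n} → Fin n → Sub n → Set
x ∉ S = ¬ x ∈ S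

_⊆_ : ∀ {n} → Sub n → Sub n → Set
A ⊆ B = ∀ {x} → x ∈ A → x ∈ B

_∈?_ : ∀ {n} (x : Fin n) (S : Sub n) → Dec (x ∈ S)
x ∈? S = map′ mem holds (S x Bool.≟ true)

_∪_ _∩_ _∖_ : ∀ {n} → Sub n → Sub n → Sub n
(A ∪ B) x = A x ∨ B x
(A ∩ B) x = A x ∧ B x
(A ∖ B) x = A x ∧ not (B x)

⁅_⁆ : ∀ {n} → Fin n → Sub n
⁅ u ⁆ x = ⌊ u ≟ x ⌋

full : ∀ {n} → Sub n
full x = true

module _ {n} {A B : Sub n} {x : Fin n} where

  ∪⁺ˡ : x ∈ A → x ∈ A ∪ B
  ∪⁺ˡ (mem p) = mem (cong (_∨ B x) p)

  ∪⁺ʳ : x ∈ B → x ∈ A ∪ B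
  ∪⁺ʳ (mem p) = mem (trans (cong (A x ∨_) p) (Bool.∨-zeroʳ (A x)))

  ∪⁻ : x ∈ A ∪ B → x ∈ A ⊎ x ∈ B
  ∪⁻ (mem p) with A x in a
  ... | true  = inj₁ (mem a)
  ... | false = inj₂ (mem p)

  ∩⁺ : x ∈ A → x ∈ B → x ∈ A ∩ B
  ∩⁺ (mem p) (mem q) = mem (cong₂ _∧_ p q)

  ∩⁻ˡ : x ∈ A ∩ B → x ∈ A
  ∩⁻ˡ (mem p) with A x in a
  ... | true = mem a

  ∩⁻ʳ : x ∈ A ∩ B → x ∈ B
  ∩⁻ʳ (mem p) with A x
  ... | true = mem p

  ∖⁺ : x ∈ A → x ∉ B → x ∈ A ∖ B
  ∖⁺ (mem p) q with B x in b
  ... | true  = contradiction (mem b) q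
  ... | false = mem (cong₂ _∧_ p (cong not b))

  ∖⁻ˡ : x ∈ A ∖ B → x ∈ A
  ∖⁻ˡ (mem p) with A x in a
  ... | true = mem a

  ∖⁻ʳ : x ∈ A ∖ B → x ∉ B
  ∖⁻ʳ (mem p) (mem q) with A x
  ... | true rewrite q = case p of λ ()

∈⁅⁆ : ∀ {n} {x : Fin n} → x ∈ ⁅ x ⁆
∈⁅⁆ {x = x} = mem (if-yes (x ≟ x) refl)

∈⁅⁆⁻ : ∀ {n} {u x : Fin n} → x ∈ ⁅ u ⁆ → u ≡ x
∈⁅⁆⁻ {u = u} {x} (mem p) = yes⇒ (u ≟ x) p

⁅⁆⊆ : ∀ {n} {S : Sub n} {x} → x ∈ S → ⁅ x ⁆ ⊆ S
⁅⁆⊆ {S = S} x∈S y∈ = subst (_∈ S) (∈⁅⁆⁻ y∈) x∈S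

⁅⁆-pull : ∀ {n} {S : Sub n} {x y} → y ∈ ⁅ x ⁆ → y ∈ S → x ∈ S
⁅⁆-pull {S = S} y∈ y∈S = subst (_∈ S) (≡-sym (∈⁅⁆⁻ y∈)) y∈S

split-∖ : ∀ {n} {S : Sub n} (A : Sub n) {x} → x ∈ S → x ∈ A ⊎ x ∈ S ∖ A
split-∖ A {x} x∈S with x ∈? A
... | yes x∈A = inj₁ x∈A
... | no x∉A  = inj₂ (∖⁺ x∈S x∉A)

∉-≢ : ∀ {n} {S : Sub n} {x y : Fin n} → x ∈ S → y ∉ S → x ≢ y
∉-≢ x∈S y∉S refl = y∉S x∈S

⟦⟧-mono : ∀ {a b} → (a ≡ true → b ≡ true) → ⟦ a ⟧ ≤ ⟦ b ⟧
⟦⟧-mono {false}         h = z≤n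
⟦⟧-mono {true}  {b}     h rewrite h refl = ≤-refl

size : ∀ {n} → Sub n → ℕ
size S = sum λ x → ⟦ S x ⟧

size-mono : ∀ {n} {A B : Sub n} → A ⊆ B → size A ≤ size B
size-mono A⊆B = sum-mono λ x → ⟦⟧-mono λ p → holds (A⊆B (mem p))

-- An equation between indicator values, so that sizes and edge counts split by additivity of sums
-- alone.
record Part {n} (S A B : Sub n) : Set where
  constructor part
  field count : ∀ x → ⟦ S x ⟧ ≡ ⟦ A x ⟧ + ⟦ B x ⟧
open Part public

part-intro : ∀ {n} {S A B : Sub n} → (∀ {x} → x ∈ S → x ∈ A ⊎ x ∈ B) →
  A ⊆ S → B ⊆ S → (∀ {x} → x ∈ A → x ∉ B) → Part S A B
part-intro {S = S} {A} {B} cover A⊆S B⊆S disj = part go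
  where
  go : ∀ x → ⟦ S x ⟧ ≡ ⟦ A x ⟧ + ⟦ B x ⟧
  go x with S x in s | A x in a | B x in b
  ... | true  | true  | false = refl
  ... | true  | false | true  = refl
  ... | false | false | false = refl
  ... | _     | true  | true  = contradiction (mem b) (disj (mem a))
  ... | false | true  | _     = case trans (≡-sym s) (holds (A⊆S (mem a))) of λ ()
  ... | false | _     | true  = case trans (≡-sym s) (holds (B⊆S (mem b))) of λ ()
  ... | true  | false | false with cover (mem s)
  ...   | inj₁ (mem p) = case trans (≡-sym a) p of λ ()
  ...   | inj₂ (mem p) = case trans (≡-sym b) p of λ ()

part-∖ : ∀ {n} {S A : Sub n} → A ⊆ S → Part S A (S ∖ A)
part-∖ {A = A} A⊆S = part-intro (split-∖ A) A⊆S ∖⁻ˡ (λ a b → ∖⁻ʳ b a)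

part-⁅⁆ : ∀ {n} {S : Sub n} {x} → x ∈ S → Part S ⁅ x ⁆ (S ∖ ⁅ x ⁆)
part-⁅⁆ {S = S} x∈S = part-∖ (⁅⁆⊆ x∈S)

part-∪ : ∀ {n} {A B : Sub n} → (∀ {x} → x ∈ A → x ∉ B) → Part (A ∪ B) A B
part-∪ disj = part-intro ∪⁻ ∪⁺ˡ ∪⁺ʳ disj

size-part : ∀ {n} {S A B : Sub n} → Part S A B → size S ≡ size A + size B
size-part π = trans (sum-cong (count π)) (sum-+ _ _)

size-⁅⁆ : ∀ {n} (x : Fin n) → size ⁅ x ⁆ ≡ 1
size-⁅⁆ x = trans (sum-single _ x λ i i≢x → cong ⟦_⟧ (if-no (x ≟ i) (i≢x ∘ ≡-sym)))
                  (cong ⟦_⟧ (if-yes (x ≟ x) refl))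

size-remove : ∀ {n} {S : Sub n} {x} → x ∈ S → size S ≡ suc (size (S ∖ ⁅ x ⁆))
size-remove {S = S} {x} x∈S =
  trans (size-part (part-⁅⁆ x∈S)) (cong (_+ size (S ∖ ⁅ x ⁆)) (size-⁅⁆ x))

size-strict : ∀ {n} {A B : Sub n} {x} → A ⊆ B → x ∈ B → x ∉ A → size A < size B
size-strict {B = B} A⊆B x∈B x∉A = subst (_ <_) (≡-sym (size-remove x∈B))
  (s≤s (size-mono λ a → ∖⁺ (A⊆B a) λ y∈ → x∉A (subst (_∈ _) (≡-sym (∈⁅⁆⁻ y∈)) a)))

size-∪ : ∀ {n} (A B : Sub n) → size (A ∪ B) ≤ size A + size B
size-∪ A B = ≤-trans (sum-mono λ x → pointwise (A x) (B x)) (≤-reflexive (sum-+ _ _))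
  where
  pointwise : ∀ a b → ⟦ a ∨ b ⟧ ≤ ⟦ a ⟧ + ⟦ b ⟧
  pointwise true  b = m≤m+n 1 _
  pointwise false b = ≤-refl

size-∪⁅⁆ : ∀ {n} (A : Sub n) t → size (A ∪ ⁅ t ⁆) ≤ suc (size A)
size-∪⁅⁆ A t = ≤-trans (size-∪ A ⁅ t ⁆)
  (≤-reflexive (trans (cong (size A +_) (size-⁅⁆ t)) (+-comm (size A) 1)))

size-positive : ∀ {n} {S : Sub n} → 1 ≤ size S → ∃ λ x → x ∈ S
size-positive {S = S} h with sum-positive _ h
... | x , p with S x in s
...   | true = x , mem s

member⇒size : ∀ {n} {S : Sub n} {x} → x ∈ S → 1 ≤ size S
member⇒size {S = S} x∈S = subst (1 ≤_) (≡-sym (size-remove x∈S)) (s≤s z≤n)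

empty⇒size : ∀ {n} {S : Sub n} → (∀ {x} → x ∉ S) → size S ≡ 0
empty⇒size {S = S} h = sum-zero λ x → go x (S x) refl
  where
  go : ∀ x b → S x ≡ b → ⟦ b ⟧ ≡ 0
  go x true  s = contradiction (mem s) h
  go x false s = refl

size-full : ∀ {n} → size (full {n}) ≡ n
size-full {zero}  = sum-empty _
size-full {suc n} = trans (sum-head _) (cong suc size-full)

image : ∀ {m n} → (Fin m → Fin n) → Sub n
image φ x = ⌊ any? (λ a → φ a ≟ x) ⌋

∈-image : ∀ {m n} (φ : Fin m → Fin n) a → φ a ∈ image φ
∈-image φ a = mem (if-yes (any? _) (a , refl))

∈-image⁻ : ∀ {m n} (φ : Fin m → Fin n) {x} → x ∈ image φ → ∃ λ a → φ a ≡ x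
∈-image⁻ φ (mem p) = yes⇒ (any? _) p

size-image : ∀ {m n} (φ : Fin m → Fin n) → size (image φ) ≤ m
size-image {zero}  φ = ≤-reflexive (empty⇒size λ {x} x∈ → case ∈-image⁻ φ x∈ of λ ())
size-image {suc m} φ = begin
  size (image φ)                                ≤⟨ size-mono head-or-tail ⟩
  size (image (φ ∘ suc) ∪ ⁅ φ zero ⁆)           ≤⟨ size-∪⁅⁆ (image (φ ∘ suc)) (φ zero) ⟩
  suc (size (image (φ ∘ suc)))                  ≤⟨ s≤s (size-image (φ ∘ suc)) ⟩
  suc m                                         ∎
  where
  open ≤-Reasoning
  head-or-tail : image φ ⊆ image (φ ∘ suc) ∪ ⁅ φ zero ⁆
  head-or-tail {x} x∈ with ∈-image⁻ φ x∈
  ... | zero  , refl = ∪⁺ʳ ∈⁅⁆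
  ... | suc a , refl = ∪⁺ˡ (∈-image (φ ∘ suc) a)

-- Edges between vertex sets, connectivity

module Edges {n} (G : Graph n) where

  infix 4 _~_
  _~_ : Fin n → Fin n → Set
  x ~ y = adj G x y ≡ true

  _~?_ : ∀ x y → Dec (x ~ y)
  x ~? y = adj G x y Bool.≟ true

  ~-sym : ∀ {x y} → x ~ y → y ~ x
  ~-sym {x} {y} p = trans (sym G y x) p

  ~-≢ : ∀ {x y} → x ~ y → x ≢ y
  ~-≢ {x} p refl = case trans (≡-sym p) (irrefl G x) of λ ()

  nbr : Fin n → Sub n
  nbr = adj G

  NoEdge : Sub n → Sub n → Set
  NoEdge A B = ∀ {a b} → a ∈ A → b ∈ B → ¬ a ~ b

  loop-free : ∀ x → NoEdge ⁅ x ⁆ ⁅ x ⁆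
  loop-free x a b a~b = ~-≢ a~b (trans (≡-sym (∈⁅⁆⁻ a)) (∈⁅⁆⁻ b))

  -- Ordered pairs are counted: for disjoint sets this is the number of edges between them, whereas
  -- `E S S` is twice the number of edges inside `S`.
  E : Sub n → Sub n → ℕ
  E A B = sum λ i → sum λ j → ⟦ A i ∧ (B j ∧ adj G i j) ⟧

  E-sym : ∀ A B → E A B ≡ E B A
  E-sym A B = trans (sum-swap _) (sum-cong λ j → sum-cong λ i → cong ⟦_⟧ (pointwise i j))
    where
    pointwise : ∀ i j → A i ∧ (B j ∧ adj G i j) ≡ B j ∧ (A i ∧ adj G j i)
    pointwise i j rewrite sym G j i with A i | B j
    ... | true  | true  = refl
    ... | true  | false = refl
    ... | false | true  = refl
    ... | false | false = refl

  E-splitˡ : ∀ {S A B} T → Part S A B → E S T ≡ E A T + E B T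
  E-splitˡ {S} {A} {B} T π = trans
    (sum-cong λ i → trans (sum-cong λ j → pointwise i (T j ∧ adj G i j)) (sum-+ _ _))
    (sum-+ _ _)
    where
    pointwise : ∀ i x → ⟦ S i ∧ x ⟧ ≡ ⟦ A i ∧ x ⟧ + ⟦ B i ∧ x ⟧
    pointwise i true
      rewrite Bool.∧-identityʳ (S i) | Bool.∧-identityʳ (A i) | Bool.∧-identityʳ (B i) = count π i
    pointwise i false
      rewrite Bool.∧-zeroʳ (S i) | Bool.∧-zeroʳ (A i) | Bool.∧-zeroʳ (B i) = refl

  E-splitʳ : ∀ {S A B} T → Part S A B → E T S ≡ E T A + E T B
  E-splitʳ {S} {A} {B} T π = trans (E-sym T S)
    (trans (E-splitˡ T π) (cong₂ _+_ (E-sym A T) (E-sym B T)))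

  E-mono : ∀ {A A′ B B′} → A ⊆ A′ → B ⊆ B′ → E A B ≤ E A′ B′
  E-mono {A} {A′} {B} {B′} A⊆ B⊆ = sum-mono λ i → sum-mono λ j → ⟦⟧-mono (pointwise i j)
    where
    pointwise : ∀ i j → A i ∧ (B j ∧ adj G i j) ≡ true → A′ i ∧ (B′ j ∧ adj G i j) ≡ true
    pointwise i j p with A i in a | B j in b
    ... | true | true = cong₂ _∧_ (holds (A⊆ (mem a))) (cong₂ _∧_ (holds (B⊆ (mem b))) p)

  E-positive : ∀ {A B a b} → a ∈ A → b ∈ B → a ~ b → 1 ≤ E A B
  E-positive {A} {B} {a} {b} a∈A b∈B a~b = begin
    1  ≡⟨ cong ⟦_⟧ (cong₂ _∧_ (holds a∈A) (cong₂ _∧_ (holds b∈B) a~b)) ⟨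
    ⟦ A a ∧ (B b ∧ adj G a b) ⟧  ≤⟨ term≤sum (λ j → ⟦ A a ∧ (B j ∧ adj G a j) ⟧) b ⟩
    sum (λ j → ⟦ A a ∧ (B j ∧ adj G a j) ⟧)  ≤⟨ term≤sum (λ i → sum λ j → ⟦ A i ∧ (B j ∧ adj G i j) ⟧) a ⟩
    E A B  ∎
    where open ≤-Reasoning

  -- Injectivity is applied once in each coordinate, so distinct adjacent index pairs stay distinct.
  -- Edge counts are compared along embeddings in this way.
  pullback≤E : ∀ {m Y} (φ : Fin m → Fin n) → Injective _≡_ _≡_ φ → (∀ a → φ a ∈ Y) →
    sum (λ a → sum λ b → ⟦ adj G (φ a) (φ b) ⟧) ≤ E Y Y
  pullback≤E {Y = Y} φ inj inside = begin
    sum (λ a → sum λ b → ⟦ adj G (φ a) (φ b) ⟧)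
      ≡⟨ sum-cong (λ a → sum-cong λ b → cong ⟦_⟧ (cong₂ (λ x y → x ∧ (y ∧ adj G (φ a) (φ b)))
           (holds (inside a)) (holds (inside b)))) ⟨
    sum (λ a → sum λ b → ⟦ Y (φ a) ∧ (Y (φ b) ∧ adj G (φ a) (φ b)) ⟧)
      ≤⟨ sum-mono (λ a → sum-injective φ inj λ j → ⟦ Y (φ a) ∧ (Y j ∧ adj G (φ a) j) ⟧) ⟩
    sum (λ a → sum λ j → ⟦ Y (φ a) ∧ (Y j ∧ adj G (φ a) j) ⟧)
      ≤⟨ sum-injective φ inj (λ i → sum λ j → ⟦ Y i ∧ (Y j ∧ adj G i j) ⟧) ⟩
    E Y Y ∎
    where open ≤-Reasoning

  NoEdge⇒E : ∀ {A B} → NoEdge A B → E A B ≡ 0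
  NoEdge⇒E {A} {B} none = sum-zero λ i → sum-zero λ j → go i j
    where
    go : ∀ i j → ⟦ A i ∧ (B j ∧ adj G i j) ⟧ ≡ 0
    go i j with A i in a | B j in b | adj G i j in c
    ... | true  | true  | true  = contradiction c (none (mem a) (mem b))
    ... | true  | true  | false = refl
    ... | true  | false | _     = refl
    ... | false | _     | _     = refl

  E⇒NoEdge : ∀ {A B} → E A B ≡ 0 → NoEdge A B
  E⇒NoEdge E≡0 a∈A b∈B a~b = case subst (1 ≤_) E≡0 (E-positive a∈A b∈B a~b) of λ ()

  E-⁅⁆ : ∀ u B → E ⁅ u ⁆ B ≡ size (B ∩ nbr u)
  E-⁅⁆ u B = trans (sum-single _ u off)
    (sum-cong λ j → cong (λ b → ⟦ b ∧ (B j ∧ adj G u j) ⟧) (if-yes (u ≟ u) refl))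
    where
    off : ∀ i → i ≢ u → sum (λ j → ⟦ ⁅ u ⁆ i ∧ (B j ∧ adj G i j) ⟧) ≡ 0
    off i i≢u = sum-zero λ j →
      cong (λ b → ⟦ b ∧ (B j ∧ adj G i j) ⟧) (if-no (u ≟ i) (i≢u ∘ ≡-sym))

  E-⁅⁆≤ : ∀ u B → E ⁅ u ⁆ B ≤ size B
  E-⁅⁆≤ u B = ≤-trans (≤-reflexive (E-⁅⁆ u B)) (size-mono {A = B ∩ nbr u} ∩⁻ˡ)

  two-nbrs : ∀ {u B s t} → s ∈ B → t ∈ B → u ~ s → u ~ t → s ≢ t → 2 ≤ E ⁅ u ⁆ B
  two-nbrs {u} {B} {s} {t} s∈B t∈B u~s u~t s≢t = begin
    1 + 1  ≤⟨ +-mono-≤ (E-positive (∈⁅⁆ {x = u}) (∈⁅⁆ {x = s}) u~s)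
                                                  (E-positive ∈⁅⁆ (∖⁺ t∈B (s≢t ∘ ∈⁅⁆⁻)) u~t) ⟩
    E ⁅ u ⁆ ⁅ s ⁆ + E ⁅ u ⁆ (B ∖ ⁅ s ⁆)  ≡⟨ E-splitʳ ⁅ u ⁆ (part-⁅⁆ s∈B) ⟨
    E ⁅ u ⁆ B  ∎
    where open ≤-Reasoning

  private
    trues : ∀ {m} → (Fin m → Bool) → List (Fin m)
    trues {zero}  g = []
    trues {suc m} g = (if g zero then zero ∷_ else λ l → l) (map suc (trues (g ∘ suc)))

    trues-complete : ∀ {m} (g : Fin m → Bool) {i} → g i ≡ true → i ∈ˡ trues g
    trues-complete g {zero}  p rewrite p = here refl
    trues-complete g {suc i} p with g zero
    ... | true  = there (∈-map⁺ suc (trues-complete (g ∘ suc) p))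
    ... | false = ∈-map⁺ suc (trues-complete (g ∘ suc) p)

    length-trues : ∀ {m} (g : Fin m → Bool) → length (trues g) ≡ sum (λ i → ⟦ g i ⟧)
    length-trues {zero}  g = ≡-sym (sum-empty _)
    length-trues {suc m} g = trans (head-case (g zero))
      (trans (cong (⟦ g zero ⟧ +_) (length-trues (g ∘ suc))) (≡-sym (sum-head _)))
      where
      head-case : ∀ b → length ((if b then zero ∷_ else λ l → l) (map suc (trues (g ∘ suc))))
                        ≡ ⟦ b ⟧ + length (trues (g ∘ suc))
      head-case true  = cong suc (length-map suc (trues (g ∘ suc)))
      head-case false = length-map suc (trues (g ∘ suc))

    pairs : ∀ {m} → (Fin m → Fin n → Bool) → List (Fin m × Fin n)
    pairs {zero}  g = []
    pairs {suc m} g = map (zero ,_) (trues (g zero)) ++ map (map₁ suc) (pairs (g ∘ suc))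

    pairs-complete : ∀ {m} (g : Fin m → Fin n → Bool) {i j} → g i j ≡ true → (i , j) ∈ˡ pairs g
    pairs-complete g {zero}  p = ∈-++⁺ˡ (∈-map⁺ (zero ,_) (trues-complete (g zero) p))
    pairs-complete g {suc i} p = ∈-++⁺ʳ _ (∈-map⁺ (map₁ suc) (pairs-complete (g ∘ suc) p))

    length-pairs : ∀ {m} (g : Fin m → Fin n → Bool) →
      length (pairs g) ≡ sum (λ i → sum λ j → ⟦ g i j ⟧)
    length-pairs {zero}  g = ≡-sym (sum-empty _)
    length-pairs {suc m} g = begin
      length (map (zero ,_) (trues (g zero)) ++ map (map₁ suc) (pairs (g ∘ suc)))
        ≡⟨ length-++ (map (zero ,_) (trues (g zero))) ⟩
      length (map (zero {m} ,_) (trues (g zero))) + length (map (map₁ suc) (pairs (g ∘ suc)))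
        ≡⟨ cong₂ _+_ (trans (length-map _ (trues (g zero))) (length-trues (g zero)))
                     (trans (length-map _ (pairs (g ∘ suc))) (length-pairs (g ∘ suc))) ⟩
      sum (λ j → ⟦ g zero j ⟧) + sum (λ i → sum λ j → ⟦ g (suc i) j ⟧)
        ≡⟨ sum-head _ ⟨
      sum (λ i → sum λ j → ⟦ g i j ⟧) ∎
      where open ≡-Reasoning

  -- Only length and completeness are promised. That is enough to enumerate all edges once their
  -- number is known to be one or two.
  edge-list : ∀ A B → Σ (List (Fin n × Fin n)) λ l →
    length l ≡ E A B × (∀ {a b} → a ∈ A → b ∈ B → a ~ b → (a , b) ∈ˡ l)
  edge-list A B = pairs between , length-pairs between , λ a∈A b∈B a~b →
    pairs-complete between (cong₂ _∧_ (holds a∈A) (cong₂ _∧_ (holds b∈B) a~b))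
    where
    between : Fin n → Fin n → Bool
    between i j = A i ∧ (B j ∧ adj G i j)

  find-edge : ∀ {A B} → 1 ≤ E A B → ∃ λ a → ∃ λ b → a ∈ A × b ∈ B × a ~ b
  find-edge {A} {B} 1≤E with sum-positive _ 1≤E
  ... | a , p with sum-positive _ p
  ...   | b , q with A a in eqa | B b in eqb | adj G a b in eqc
  ...     | true | true | true = a , b , mem eqa , mem eqb , eqc

  unique-edge : ∀ {A B} → E A B ≡ 1 → ∃ λ a → ∃ λ b → a ∈ A × b ∈ B × a ~ b ×
    (∀ {a′ b′} → a′ ∈ A → b′ ∈ B → a′ ~ b′ → a′ ≡ a × b′ ≡ b)
  unique-edge {A} {B} E≡1 with find-edge {A} {B} (≤-reflexive (≡-sym E≡1)) | edge-list A B
  ... | a , b , a∈ , b∈ , a~b | l , len , complete = a , b , a∈ , b∈ , a~b , only l (trans len E≡1) complete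
    where
    only : ∀ l → length l ≡ 1 → (∀ {a b} → a ∈ A → b ∈ B → a ~ b → (a , b) ∈ˡ l) →
      ∀ {a′ b′} → a′ ∈ A → b′ ∈ B → a′ ~ b′ → a′ ≡ a × b′ ≡ b
    only (_ ∷ []) refl complete p q r with complete p q r | complete a∈ b∈ a~b
    ... | here refl | here refl = refl , refl

  -- The two edges are not claimed to be distinct; whether their ends differ is decided where it
  -- matters.
  TwoEdges : Sub n → Sub n → Set
  TwoEdges A B = ∃ λ a₁ → ∃ λ b₁ → ∃ λ a₂ → ∃ λ b₂ →
    (a₁ ∈ A × b₁ ∈ B × a₁ ~ b₁) × (a₂ ∈ A × b₂ ∈ B × a₂ ~ b₂) ×
    (∀ {a b} → a ∈ A → b ∈ B → a ~ b → (a ≡ a₁ × b ≡ b₁) ⊎ (a ≡ a₂ × b ≡ b₂))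

  two-edges : ∀ {A B} → E A B ≡ 2 → TwoEdges A B
  two-edges {A} {B} E≡2
    with find-edge {A} {B} (≤-trans (s≤s z≤n) (≤-reflexive (≡-sym E≡2))) | edge-list A B
  ... | a₁ , b₁ , f₁@(a₁∈ , b₁∈ , e₁) | l , len , complete = go l (trans len E≡2) complete
    where
    -- If one of the two listed pairs is not an edge, the other is the only edge.
    other : ∀ a b → (∀ {a′ b′} → a′ ∈ A → b′ ∈ B → a′ ~ b′ → (a′ ≡ a₁ × b′ ≡ b₁) ⊎ (a′ ≡ a × b′ ≡ b)) → TwoEdges A B
    other a b cover with a ∈? A | b ∈? B | a ~? b
    ... | yes p | yes q | yes r = a₁ , b₁ , a , b , f₁ , (p , q , r) , cover
    ... | no ¬p | _ | _ = a₁ , b₁ , a₁ , b₁ , f₁ , f₁ , λ p q r →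
      case cover p q r of λ { (inj₁ x) → inj₁ x ; (inj₂ (refl , _)) → contradiction p ¬p }
    ... | _ | no ¬q | _ = a₁ , b₁ , a₁ , b₁ , f₁ , f₁ , λ p q r →
      case cover p q r of λ { (inj₁ x) → inj₁ x ; (inj₂ (_ , refl)) → contradiction q ¬q }
    ... | _ | _ | no ¬r = a₁ , b₁ , a₁ , b₁ , f₁ , f₁ , λ p q r →
      case cover p q r of λ { (inj₁ x) → inj₁ x ; (inj₂ (refl , refl)) → contradiction r ¬r }
    go : ∀ l → length l ≡ 2 → (∀ {a b} → a ∈ A → b ∈ B → a ~ b → (a , b) ∈ˡ l) → TwoEdges A B
    go ((a , b) ∷ (a′ , b′) ∷ []) refl complete with complete a₁∈ b₁∈ e₁
    ... | here refl = other a′ b′ λ p q r → case complete p q r of λ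
      { (here refl) → inj₁ (refl , refl) ; (there (here refl)) → inj₂ (refl , refl) }
    ... | there (here refl) = other a b λ p q r → case complete p q r of λ
      { (here refl) → inj₂ (refl , refl) ; (there (here refl)) → inj₁ (refl , refl) }

  e : Sub n → ℕ
  e S = sum λ i → sum λ j → ⟦ ⌊ i <? j ⌋ ∧ (S i ∧ (S j ∧ adj G i j)) ⟧

  e-double : ∀ S → e S + e S ≡ E S S
  e-double S = begin
    e S + e S
      ≡⟨ cong (e S +_) (sum-swap _) ⟩
    e S + sum (λ i → sum λ j → ⟦ ⌊ j <? i ⌋ ∧ (S j ∧ (S i ∧ adj G j i)) ⟧)
      ≡⟨ sum-+ _ _ ⟨
    sum (λ i → sum (λ j → ⟦ ⌊ i <? j ⌋ ∧ (S i ∧ (S j ∧ adj G i j)) ⟧)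
             + sum (λ j → ⟦ ⌊ j <? i ⌋ ∧ (S j ∧ (S i ∧ adj G j i)) ⟧))
      ≡⟨ sum-cong (λ i → trans (≡-sym (sum-+ _ _)) (sum-cong (pointwise i))) ⟩
    E S S ∎
    where
    open ≡-Reasoning
    swap-args : ∀ i j → S j ∧ (S i ∧ adj G j i) ≡ S i ∧ (S j ∧ adj G i j)
    swap-args i j rewrite sym G j i with S i | S j
    ... | true  | true  = refl
    ... | true  | false = refl
    ... | false | true  = refl
    ... | false | false = refl
    pointwise : ∀ i j → ⟦ ⌊ i <? j ⌋ ∧ (S i ∧ (S j ∧ adj G i j)) ⟧ + ⟦ ⌊ j <? i ⌋ ∧ (S j ∧ (S i ∧ adj G j i)) ⟧
                        ≡ ⟦ S i ∧ (S j ∧ adj G i j) ⟧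
    pointwise i j rewrite swap-args i j with <-cmp i j
    ... | tri< i<j _ j≮i rewrite if-yes (i <? j) i<j | if-no (j <? i) j≮i = +-identityʳ _
    ... | tri> i≮j _ j<i rewrite if-no (i <? j) i≮j | if-yes (j <? i) j<i = refl
    ... | tri≈ i≮i refl _ rewrite if-no (i <? i) i≮i | irrefl G i with S i
    ...   | true  = refl
    ...   | false = refl

  -- Proved for the doubled quantities, since the symmetric count `E` splits in both arguments
  -- without any comparison of indices.
  e-part : ∀ {S A B} → Part S A B → e S ≡ e A + e B + E A B
  e-part {S} {A} {B} π = halve-≡ (begin
    e S + e S  ≡⟨ e-double S ⟩
    E S S  ≡⟨ E-splitˡ S π ⟩
    E A S + E B S  ≡⟨ cong₂ _+_ (E-splitʳ A π) (E-splitʳ B π) ⟩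
    E A A + E A B + (E B A + E B B)  ≡⟨ cong₂ (λ x y → x + E A B + (y + E B B)) (e-double A) (E-sym A B) ⟨
    e A + e A + E A B + (E A B + E B B)  ≡⟨ cong (λ x → e A + e A + E A B + (E A B + x)) (e-double B) ⟨
    e A + e A + E A B + (E A B + (e B + e B))  ≡⟨ rearrange (e A) (e B) (E A B) ⟩
    e A + e B + E A B + (e A + e B + E A B)  ∎)
    where
    open ≡-Reasoning
    rearrange : ∀ a b c → a + a + c + (c + (b + b)) ≡ a + b + c + (a + b + c)
    rearrange = solve-∀

  e-mono : ∀ {A B} → A ⊆ B → e A ≤ e B
  e-mono {A} {B} A⊆B = halve-≤ (begin
    e A + e A  ≡⟨ e-double A ⟩
    E A A  ≤⟨ E-mono A⊆B A⊆B ⟩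
    E B B  ≡⟨ e-double B ⟨
    e B + e B  ∎)
    where open ≤-Reasoning

  NoEdge⇒e : ∀ {A} → NoEdge A A → e A ≡ 0
  NoEdge⇒e {A} none = halve-≡ (trans (e-double A) (NoEdge⇒E none))

  e-remove : ∀ {S x} → x ∈ S → e S ≡ e (S ∖ ⁅ x ⁆) + E ⁅ x ⁆ (S ∖ ⁅ x ⁆)
  e-remove {S} {x} x∈S = trans (e-part (part-⁅⁆ x∈S))
    (cong (λ y → y + e (S ∖ ⁅ x ⁆) + E ⁅ x ⁆ (S ∖ ⁅ x ⁆))
      (NoEdge⇒e (loop-free x)))

  e-full : e full ≡ numEdges G
  e-full = ≡-sym (numEdges-sum G)

  -- Connectivity in cut form. The crossing edges are what the counting consumes, and sets can be
  -- enlarged or reduced without rebuilding paths.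
  record Conn (S : Sub n) : Set where
    field
      nonempty : ∃ λ s → s ∈ S
      cut : ∀ X {a b} → a ∈ S → a ∈ X → b ∈ S → b ∉ X →
            ∃ λ s → ∃ λ t → (s ∈ S × s ∈ X) × (t ∈ S × t ∉ X) × s ~ t
  open Conn public

  conn-⁅⁆ : ∀ x → Conn ⁅ x ⁆
  conn-⁅⁆ x = record
    { nonempty = x , ∈⁅⁆
    ; cut = λ X a a∈X b b∉X → contradiction (subst (_∈ X) (trans (≡-sym (∈⁅⁆⁻ a)) (∈⁅⁆⁻ b)) a∈X) b∉X }

  conn-add : ∀ {S x y} → Conn S → x ∈ S → x ~ y → Conn (S ∪ ⁅ y ⁆)
  conn-add {S} {x} {y} conn x∈S x~y = record { nonempty = x , ∪⁺ˡ x∈S ; cut = cut′ }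
    where
    S′ = S ∪ ⁅ y ⁆
    Crossing : Sub n → Set
    Crossing X = ∃ λ s → ∃ λ t → (s ∈ S′ × s ∈ X) × (t ∈ S′ × t ∉ X) × s ~ t
    inside : ∀ X {a b} → a ∈ S → a ∈ X → b ∈ S → b ∉ X → Crossing X
    inside X a∈S a∈X b∈S b∉X with cut conn X a∈S a∈X b∈S b∉X
    ... | s , t , (s∈S , s∈X) , (t∈S , t∉X) , s~t = s , t , (∪⁺ˡ s∈S , s∈X) , (∪⁺ˡ t∈S , t∉X) , s~t
    cut′ : ∀ X {a b} → a ∈ S′ → a ∈ X → b ∈ S′ → b ∉ X → Crossing X
    cut′ X {a} {b} a∈ a∈X b∈ b∉X with x ∈? X | ∪⁻ {A = S} a∈ | ∪⁻ {A = S} b∈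
    ... | yes x∈X | _ | inj₁ b∈S = inside X x∈S x∈X b∈S b∉X
    ... | yes x∈X | _ | inj₂ b∈y with ∈⁅⁆⁻ b∈y
    ...   | refl = x , b , (∪⁺ˡ x∈S , x∈X) , (b∈ , b∉X) , x~y
    cut′ X {a} {b} a∈ a∈X b∈ b∉X | no x∉X | inj₁ a∈S | _ = inside X a∈S a∈X x∈S x∉X
    cut′ X {a} {b} a∈ a∈X b∈ b∉X | no x∉X | inj₂ a∈y | _ with ∈⁅⁆⁻ a∈y
    ... | refl = a , x , (a∈ , a∈X) , (∪⁺ˡ x∈S , x∉X) , ~-sym x~y

  conn-star : ∀ {S u} → u ∈ S → (∀ {s} → s ∈ S → s ≡ u ⊎ u ~ s) → Conn S
  conn-star {S} {u} u∈S star = record { nonempty = u , u∈S ; cut = cut′ }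
    where
    cut′ : ∀ X {a b} → a ∈ S → a ∈ X → b ∈ S → b ∉ X →
           ∃ λ s → ∃ λ t → (s ∈ S × s ∈ X) × (t ∈ S × t ∉ X) × s ~ t
    cut′ X {a} {b} a∈S a∈X b∈S b∉X with u ∈? X | star a∈S | star b∈S
    ... | yes u∈X | _ | inj₁ refl = contradiction u∈X b∉X
    ... | yes u∈X | _ | inj₂ u~b  = u , b , (u∈S , u∈X) , (b∈S , b∉X) , u~b
    ... | no u∉X  | inj₁ refl | _ = contradiction a∈X u∉X
    ... | no u∉X  | inj₂ u~a  | _ = a , u , (a∈S , a∈X) , (u∈S , u∉X) , ~-sym u~a

  conn-nbr : ∀ {S x} → Conn S → x ∈ S → 2 ≤ size S → ∃ λ y → y ∈ S × x ~ y
  conn-nbr {S} {x} conn x∈S 2≤ with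
    size-positive {S = S ∖ ⁅ x ⁆} (+-cancelˡ-≤ 1 _ _ (≤-trans 2≤ (≤-reflexive (size-remove x∈S))))
  ... | b , b∈ with cut conn ⁅ x ⁆ x∈S ∈⁅⁆ (∖⁻ˡ b∈) (∖⁻ʳ b∈)
  ...   | s , t , (_ , s∈x) , (t∈S , _) , s~t with ∈⁅⁆⁻ s∈x
  ...     | refl = t , t∈S , s~t

  -- The rest stays connected: a cut edge into H can be rerouted through v.
  conn-remove : ∀ {S H v} → Conn S → H ⊆ S → v ∈ S → v ∉ H →
    (∀ {h t} → h ∈ H → t ∈ S → t ∉ H → h ~ t → t ≡ v ⊎ v ~ t) → Conn (S ∖ H)
  conn-remove {S} {H} {v} conn H⊆S v∈S v∉H near =
    record { nonempty = v , v∈R ; cut = cut′ }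
    where
    R = S ∖ H
    v∈R : v ∈ R
    v∈R = ∖⁺ v∈S v∉H
    cut′ : ∀ X {a b} → a ∈ R → a ∈ X → b ∈ R → b ∉ X →
           ∃ λ s → ∃ λ t → (s ∈ R × s ∈ X) × (t ∈ R × t ∉ X) × s ~ t
    cut′ X {a} {b} a∈R a∈X b∈R b∉X with v ∈? X
    ... | no v∉X with cut conn (X ∖ H) (∖⁻ˡ a∈R) (∖⁺ a∈X (∖⁻ʳ a∈R)) (∖⁻ˡ b∈R) (b∉X ∘ ∖⁻ˡ)
    ...   | s , t , (s∈S , s∈X∖H) , (t∈S , t∉) , s~t with t ∈? H
    ...     | no t∉H = s , t , (∖⁺ s∈S (∖⁻ʳ s∈X∖H) , ∖⁻ˡ s∈X∖H) , (∖⁺ t∈S t∉H , λ p → t∉ (∖⁺ p t∉H)) , s~t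
    ...     | yes t∈H with near t∈H s∈S (∖⁻ʳ s∈X∖H) (~-sym s~t)
    ...       | inj₁ refl = contradiction (∖⁻ˡ s∈X∖H) v∉X
    ...       | inj₂ v~s  = s , v , (∖⁺ s∈S (∖⁻ʳ s∈X∖H) , ∖⁻ˡ s∈X∖H) , (v∈R , v∉X) , ~-sym v~s
    cut′ X {a} {b} a∈R a∈X b∈R b∉X | yes v∈X
      with cut conn (X ∪ H) (∖⁻ˡ a∈R) (∪⁺ˡ a∈X) (∖⁻ˡ b∈R) ([ b∉X , ∖⁻ʳ b∈R ]′ ∘ ∪⁻)
    ... | s , t , (s∈S , s∈XH) , (t∈S , t∉XH) , s~t with s ∈? H | ∪⁻ s∈XH
    ...   | no s∉H | inj₂ s∈H = contradiction s∈H s∉H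
    ...   | no s∉H | inj₁ s∈X = s , t , (∖⁺ s∈S s∉H , s∈X) , (∖⁺ t∈S (t∉XH ∘ ∪⁺ʳ) , t∉XH ∘ ∪⁺ˡ) , s~t
    ...   | yes s∈H | _ with near s∈H t∈S (t∉XH ∘ ∪⁺ʳ) s~t
    ...     | inj₁ refl = contradiction (∪⁺ˡ v∈X) t∉XH
    ...     | inj₂ v~t  = v , t , (v∈R , v∈X) , (∖⁺ t∈S (t∉XH ∘ ∪⁺ʳ) , t∉XH ∘ ∪⁺ˡ) , v~t

  -- Neighbours inside `B` are added one at a time until no edge leaves. With `Conn` as invariant
  -- the result is a component; with a density invariant it shows that a dense set spreads over a
  -- connected graph.
  grow : ∀ (B : Sub n) (P : Sub n → Set) →
    (∀ {X s t} → P X → s ∈ X → t ∈ B → t ∉ X → s ~ t → P (X ∪ ⁅ t ⁆)) →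
    ∀ {X} → X ⊆ B → P X → ∃ λ C → C ⊆ B × X ⊆ C × P C × NoEdge C (B ∖ C)
  grow B P extend {X₀} X₀⊆B PX₀ = go (size B) X₀ X₀⊆B PX₀ (λ x → x) (m≤n+m _ (size X₀))
    where
    go : ∀ fuel X → X ⊆ B → P X → X₀ ⊆ X → size B ≤ size X + fuel →
         ∃ λ C → C ⊆ B × X₀ ⊆ C × P C × NoEdge C (B ∖ C)
    go fuel X X⊆B PX X₀⊆X enough
      with any? (λ s → any? λ t → (s ∈? X) ×-dec ((t ∈? (B ∖ X)) ×-dec (s ~? t)))
    ... | no none = X , X⊆B , X₀⊆X , PX , λ a b a~b → none (_ , _ , a , b , a~b)
    go zero X X⊆B PX X₀⊆X enough | yes (s , t , s∈X , t∈ , s~t) =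
      contradiction (size-strict X⊆B (∖⁻ˡ t∈) (∖⁻ʳ t∈))
        (≤⇒≯ (subst (size B ≤_) (+-identityʳ (size X)) enough))
    go (suc fuel) X X⊆B PX X₀⊆X enough | yes (s , t , s∈X , t∈ , s~t) =
      go fuel (X ∪ ⁅ t ⁆)
        ([ X⊆B , (λ y → subst (_∈ B) (∈⁅⁆⁻ y) (∖⁻ˡ t∈)) ]′ ∘ ∪⁻)
        (extend PX s∈X (∖⁻ˡ t∈) (∖⁻ʳ t∈) s~t)
        (∪⁺ˡ ∘ X₀⊆X)
        (≤-trans enough (≤-trans (≤-reflexive (+-suc (size X) fuel))
          (+-monoˡ-≤ fuel (size-strict ∪⁺ˡ (∪⁺ʳ (∈⁅⁆ {x = t})) (∖⁻ʳ t∈)))))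

  data Components (B : Sub n) : Set where
    no-component : (∀ {x} → x ∉ B) → Components B
    more : ∀ C → Conn C → C ⊆ B → NoEdge C (B ∖ C) → Components (B ∖ C) → Components B

  components : ∀ B → Components B
  components B = go (size B) B ≤-refl
    where
    go : ∀ fuel B → size B ≤ fuel → Components B
    go fuel B bound with any? (_∈? B)
    ... | no ∄ = no-component λ x∈B → ∄ (_ , x∈B)
    go zero B bound | yes (x , x∈B) = contradiction (≤-trans (member⇒size x∈B) bound) λ ()
    go (suc fuel) B bound | yes (x , x∈B)
      with grow B Conn (λ conn s∈X _ _ → conn-add conn s∈X) {⁅ x ⁆}
             (⁅⁆⊆ x∈B) (conn-⁅⁆ x)
    ... | C , C⊆B , x⊆C , conn , isolated = more C conn C⊆B isolated
      (go fuel (B ∖ C) (+-cancelˡ-≤ 1 _ _ (≤-trans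
        (size-strict {x = x} ∖⁻ˡ x∈B (λ x∈ → ∖⁻ʳ x∈ (x⊆C ∈⁅⁆))) bound)))

-- Equality from counting; vertex lists as sets.

bool-≡ : ∀ {a b} → (a ≡ true → b ≡ true) → (b ≡ true → a ≡ true) → a ≡ b
bool-≡ {true}          f g = ≡-sym (f refl)
bool-≡ {false} {true}  f g = g refl
bool-≡ {false} {false} f g = refl

⟦⟧-injective : ∀ {a b} → ⟦ a ⟧ ≡ ⟦ b ⟧ → a ≡ b
⟦⟧-injective {true}  {true}  _ = refl
⟦⟧-injective {false} {false} _ = refl

⌊≟⌋-sym : ∀ {n} (i j : Fin n) → ⌊ i ≟ j ⌋ ≡ ⌊ j ≟ i ⌋
⌊≟⌋-sym i j = bool-≡ (λ p → if-yes (j ≟ i) (≡-sym (yes⇒ (i ≟ j) p)))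
                     (λ p → if-yes (i ≟ j) (≡-sym (yes⇒ (j ≟ i) p)))

-- An entrywise inequality without slack in the total has no slack in any row, hence none in any
-- entry.
matrix-≡ : ∀ {m} (f g : Fin m → Fin m → Bool) → (∀ a b → f a b ≡ true → g a b ≡ true) →
  sum (λ a → sum λ b → ⟦ g a b ⟧) ≤ sum (λ a → sum λ b → ⟦ f a b ⟧) → ∀ a b → f a b ≡ g a b
matrix-≡ f g f≤g g≤f a b = ⟦⟧-injective (sum-≡⇒≗ (λ b → ⟦⟧-mono (f≤g a b))
  (≤-reflexive (≡-sym (sum-≡⇒≗ (λ a → sum-mono λ b → ⟦⟧-mono (f≤g a b)) g≤f a))) b)

card : ∀ {n} (p : Subset.Subset n) → Subset.∣ p ∣ ≡ size (Vec.lookup p)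
card Vec.[] = ≡-sym (sum-empty _)
card (true Vec.∷ p)  = trans (cong suc (card p)) (≡-sym (sum-head _))
card (false Vec.∷ p) = trans (card p) (≡-sym (sum-head _))

elements : ∀ {n} → List (Fin n) → Sub n
elements []      = λ _ → false
elements (u ∷ D) = elements D ∪ ⁅ u ⁆

∈-elements : ∀ {n} {D : List (Fin n)} {u} → u ∈ˡ D → u ∈ elements D
∈-elements {D = u ∷ D} (here refl) = ∪⁺ʳ {A = elements D} ∈⁅⁆
∈-elements (there u∈D) = ∪⁺ˡ (∈-elements u∈D)

size-elements : ∀ {n} (D : List (Fin n)) → size (elements D) ≤ length D
size-elements []      = ≤-reflexive (sum-zero λ _ → refl)
size-elements (u ∷ D) = ≤-trans (size-∪⁅⁆ (elements D) u) (s≤s (size-elements D))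

-- Acyclicity from an edge count.

module Cycles {q} (T : Graph q) where

  open Edges T

  -- The degree sum is at least twice the size and equals twice the number of edges.
  min-degree : ∀ {X} → (∀ {x} → x ∈ X → 2 ≤ E ⁅ x ⁆ X) → size X ≤ e X
  min-degree {X} deg = halve-≤ (begin
    size X + size X  ≡⟨ sum-+ _ _ ⟨
    sum (λ i → ⟦ X i ⟧ + ⟦ X i ⟧)  ≤⟨ sum-mono (λ i → row i) ⟩
    E X X  ≡⟨ e-double X ⟨
    e X + e X  ∎)
    where
    open ≤-Reasoning
    row : ∀ i → ⟦ X i ⟧ + ⟦ X i ⟧ ≤ sum (λ j → ⟦ X i ∧ (X j ∧ adj T i j) ⟧)
    row i with X i in eq
    ... | false = z≤n
    ... | true  = ≤-trans (deg (mem eq)) (≤-reflexive (E-⁅⁆ i X))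

  cycle-degree : ∀ l c → IsCycle T l c → ∀ a → 2 ≤ E ⁅ c a ⁆ (image c)
  cycle-degree l c (inj , next , close) zero =
    two-nbrs (∈-image c (suc zero)) (∈-image c (fromℕ (2 + l))) (next zero) (~-sym close)
      λ eq → case inj eq of λ ()
  cycle-degree l c (inj , next , close) (suc i) with view i
  ... | ‵fromℕ = two-nbrs (∈-image c (inject₁ (fromℕ (1 + l)))) (∈-image c zero)
      (~-sym (next (fromℕ (1 + l)))) close λ eq → case inj eq of λ ()
  -- Predecessor and successor have indices `j` and `j + 2`, so they are different vertices.
  ... | ‵inject₁ j = two-nbrs (∈-image c (inject₁ (inject₁ j))) (∈-image c (suc (suc j)))
      (~-sym (next (inject₁ j))) (next (suc j)) λ eq → m≢1+n+m (toℕ j) {1}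
        (trans (≡-sym (trans (toℕ-inject₁ (inject₁ j)) (toℕ-inject₁ j))) (cong toℕ (inj eq)))

  -- Growing from a vertex set X with at least |X| edges keeps edges ≥ vertices.
  dense : ∀ {X} → Conn full → (∃ λ x → x ∈ X) → size X ≤ e X → q ≤ e full
  dense {X} conn (x , x∈X) X-dense with grow full (λ Y → size Y ≤ e Y) extend {X} (λ _ → mem refl) X-dense
    where
    extend : ∀ {Y s t} → size Y ≤ e Y → s ∈ Y → t ∈ full → t ∉ Y → s ~ t → size (Y ∪ ⁅ t ⁆) ≤ e (Y ∪ ⁅ t ⁆)
    extend {Y} {s} {t} Y-dense s∈Y _ t∉Y s~t = begin
      size (Y ∪ ⁅ t ⁆)  ≤⟨ size-∪⁅⁆ Y t ⟩
      1 + size Y  ≡⟨ +-comm 1 (size Y) ⟩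
      size Y + 1  ≤⟨ +-mono-≤ (≤-trans Y-dense (m≤m+n (e Y) (e ⁅ t ⁆))) (E-positive s∈Y ∈⁅⁆ s~t) ⟩
      e Y + e ⁅ t ⁆ + E Y ⁅ t ⁆  ≡⟨ e-part (part-∪ λ y∈Y y∈t → t∉Y (⁅⁆-pull y∈t y∈Y)) ⟨
      e (Y ∪ ⁅ t ⁆)  ∎
      where open ≤-Reasoning
  ... | C , _ , X⊆C , C-dense , closed = begin
    q  ≡⟨ size-full ⟨
    size full  ≤⟨ size-mono {A = full} {C} all ⟩
    size C  ≤⟨ C-dense ⟩
    e C  ≤⟨ e-mono {C} {full} (λ _ → mem refl) ⟩
    e full  ∎
    where
    open ≤-Reasoning
    all : full ⊆ C
    all {y} _ with y ∈? C
    ... | yes y∈C = y∈C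
    ... | no y∉C with cut conn C {x} {y} (mem refl) (X⊆C x∈X) (mem refl) y∉C
    ...   | s , t , (_ , s∈C) , (_ , t∉C) , s~t = contradiction s~t (closed s∈C (∖⁺ (mem refl) t∉C))

  -- The vertices of a cycle have degree at least two among themselves, hence span at least as many
  -- edges as vertices. In a connected graph this excess persists while the set grows to all `q`
  -- vertices.
  acyclic : Conn full → e full < q → Acyclic T
  acyclic conn few l c cyc = <⇒≱ few (dense conn (c zero , ∈-image c zero)
    (min-degree λ x∈ → let (a , eq) = ∈-image⁻ c x∈ in
      subst (λ x → 2 ≤ E ⁅ x ⁆ (image c)) eq (cycle-degree l c cyc a)))

-- Connectedness and edge numbers of whole graphs.

connected⇒Conn : ∀ {n} (G : Graph n) → Connected G → Fin n → Edges.Conn G full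
connected⇒Conn {n} G conn x = record
  { nonempty = x , mem refl ; cut = λ X {a} {b} _ a∈X _ b∉X → crossing X (conn a b) a∈X b∉X }
  where
  open Edges G
  crossing : ∀ X {a b} → Reach G a b → a ∈ X → b ∉ X →
    ∃ λ s → ∃ λ t → (s ∈ full × s ∈ X) × (t ∈ full × t ∉ X) × s ~ t
  crossing X here a∈X a∉X = contradiction a∈X a∉X
  crossing X {a} (step {j = j} a~j r) a∈X b∉X with j ∈? X
  ... | yes j∈X = crossing X r j∈X b∉X
  ... | no j∉X = a , j , (mem refl , a∈X) , (mem refl , j∉X) , a~j

numEdges-double : ∀ {n} (G : Graph n) → sum (λ i → sum λ j → ⟦ adj G i j ⟧) ≡ numEdges G + numEdges G
numEdges-double G = trans (≡-sym (Edges.e-double G full)) (cong₂ _+_ (Edges.e-full G) (Edges.e-full G))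

≅-numEdges : ∀ {m n} {G : Graph m} {H : Graph n} → G ≅ H → numEdges G ≡ numEdges H
≅-numEdges {m} {n} {G} {H} (f , (f-inj , f-surj) , f-adj) = halve-≡ (≤-antisym
  (begin
    numEdges G + numEdges G  ≡⟨ numEdges-double G ⟨
    sum (λ i → sum λ j → ⟦ adj G i j ⟧)  ≡⟨ sum-cong (λ i → sum-cong λ j → cong ⟦_⟧ (f-adj i j)) ⟨
    sum (λ i → sum λ j → ⟦ adj H (f i) (f j) ⟧)  ≤⟨ Edges.pullback≤E H {Y = full} f f-inj (λ _ → mem refl) ⟩
    Edges.E H full full  ≡⟨ numEdges-double H ⟩
    numEdges H + numEdges H  ∎)
  (begin
    numEdges H + numEdges H  ≡⟨ numEdges-double H ⟨
    sum (λ i → sum λ j → ⟦ adj H i j ⟧)  ≡⟨ sum-cong (λ i → sum-cong λ j → cong ⟦_⟧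
      (trans (cong₂ (adj H) (≡-sym (fg i)) (≡-sym (fg j))) (f-adj (g i) (g j)))) ⟩
    sum (λ i → sum λ j → ⟦ adj G (g i) (g j) ⟧)  ≤⟨ Edges.pullback≤E G {Y = full} g g-inj (λ _ → mem refl) ⟩
    Edges.E G full full  ≡⟨ numEdges-double G ⟩
    numEdges G + numEdges G  ∎))
  where
  open ≤-Reasoning
  g : Fin n → Fin m
  g y = proj₁ (f-surj y)
  fg : ∀ y → f (g y) ≡ y
  fg y = proj₂ (f-surj y) refl
  g-inj : Injective _≡_ _≡_ g
  g-inj {x} {y} eq = trans (≡-sym (fg x)) (trans (cong f eq) (fg y))

numEdges-addEdge : ∀ {p} (F : Graph p) a b (a≢b : a ≢ b) → adj F a b ≡ false →
  numEdges (addEdge F a b a≢b) ≡ suc (numEdges F)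
numEdges-addEdge {p} F a b a≢b ab∉F = halve-≡ (begin
  numEdges F′ + numEdges F′
    ≡⟨ numEdges-double F′ ⟨
  total (λ i j → ⟦ adj F′ i j ⟧)
    ≡⟨ sum-cong (λ i → sum-cong (pointwise i)) ⟩
  total (λ i j → ⟦ adj F i j ⟧ + (⟦ at a b i j ⟧ + ⟦ at b a i j ⟧))
    ≡⟨ trans (total-+ _ _) (cong (total (λ i j → ⟦ adj F i j ⟧) +_) (total-+ _ _)) ⟩
  total (λ i j → ⟦ adj F i j ⟧) + (total (λ i j → ⟦ at a b i j ⟧) + total (λ i j → ⟦ at b a i j ⟧))
    ≡⟨ cong₂ _+_ (numEdges-double F) (cong₂ _+_ (single a b) (single b a)) ⟩
  numEdges F + numEdges F + 2
    ≡⟨ arith (numEdges F) ⟩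
  suc (numEdges F) + suc (numEdges F) ∎)
  where
  open ≡-Reasoning
  F′ = addEdge F a b a≢b
  arith : ∀ x → x + x + 2 ≡ suc x + suc x
  arith = solve-∀
  total : (Fin p → Fin p → ℕ) → ℕ
  total f = sum λ i → sum (f i)
  total-+ : ∀ f g → total (λ i j → f i j + g i j) ≡ total f + total g
  total-+ f g = trans (sum-cong λ i → sum-+ (f i) (g i)) (sum-+ _ _)
  at : Fin p → Fin p → Fin p → Fin p → Bool
  at a b i j = ⌊ i ≟ a ⌋ ∧ ⌊ j ≟ b ⌋
  single : ∀ a b → total (λ i j → ⟦ at a b i j ⟧) ≡ 1
  single a b = trans
    (sum-single _ a λ i i≢a → sum-zero λ j → cong (λ x → ⟦ x ∧ ⌊ j ≟ b ⌋ ⟧) (if-no (i ≟ a) i≢a))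
    (trans (sum-single _ b λ j j≢b → trans
        (cong (λ x → ⟦ x ∧ ⌊ j ≟ b ⌋ ⟧) (if-yes (a ≟ a) refl)) (cong ⟦_⟧ (if-no (j ≟ b) j≢b)))
      (cong₂ (λ x y → ⟦ x ∧ y ⟧) (if-yes (a ≟ a) refl) (if-yes (b ≟ b) refl)))
  pointwise : ∀ i j → ⟦ adj F′ i j ⟧ ≡ ⟦ adj F i j ⟧ + (⟦ at a b i j ⟧ + ⟦ at b a i j ⟧)
  pointwise i j with i ≟ a | j ≟ b | i ≟ b | j ≟ a
  ... | yes refl | yes refl | yes a≡b | _ = contradiction a≡b a≢b
  ... | yes refl | yes refl | no _ | _ rewrite ab∉F = refl
  ... | yes refl | no _ | yes a≡b | _ = contradiction a≡b a≢b
  ... | yes refl | no _ | no _ | _ rewrite Bool.∨-identityʳ (adj F i j) = ≡-sym (+-identityʳ _)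
  ... | no _ | _ | yes refl | yes refl rewrite sym F b a | ab∉F = refl
  ... | no _ | _ | yes refl | no _ rewrite Bool.∨-identityʳ (adj F i j) = ≡-sym (+-identityʳ _)
  ... | no _ | _ | no _ | _ rewrite Bool.∨-identityʳ (adj F i j) = ≡-sym (+-identityʳ _)

-- Copies of F

-- Exhaustive search over the value at `zero`, then over the rest. The search rebuilds a function
-- only up to pointwise equality, so `resp` stands in for extensionality.
∃-function? : ∀ {m n} (P : (Fin m → Fin n) → Set) → (∀ f → Dec (P f)) →
  (∀ {f g} → (∀ i → f i ≡ g i) → P f → P g) → Dec (∃ P)
∃-function? {zero}  P P? resp = map′ (empty ,_) (λ (f , p) → resp (λ ()) p) (P? empty)
  where
  empty : Fin 0 → Fin _
  empty ()
∃-function? {suc m} P P? resp = map′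
  (λ (x , f , p) → cons x f , p)
  (λ (f , p) → f zero , f ∘ suc , resp (λ { zero → refl ; (suc i) → refl }) p)
  (any? λ x → ∃-function? (P ∘ cons x) (P? ∘ cons x)
    λ f≗g → resp λ { zero → refl ; (suc i) → f≗g i })
  where
  cons : Fin _ → (Fin m → Fin _) → Fin (suc m) → Fin _
  cons x f zero    = x
  cons x f (suc i) = f i

module Isolation {p} (F : Graph p) (centre-F : DominationOne F)
              (k : ℕ) (edges-F : numEdges F ≡ k) (3≤k : 3 ≤ k)
              {n} (G : Graph n) where

  open Edges G

  record HasCopy (Y : Sub n) : Set where
    constructor copy
    field
      emb    : Fin p → Fin n
      inj    : Injective _≡_ _≡_ emb
      edges  : ∀ a b → adj F a b ≡ true → emb a ~ emb b
      inside : ∀ a → emb a ∈ Y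
  open HasCopy public

  Free : Sub n → Set
  Free Y = ¬ HasCopy Y

  copy-mono : ∀ {X Y} → X ⊆ Y → HasCopy X → HasCopy Y
  copy-mono X⊆Y c = copy (emb c) (inj c) (edges c) (X⊆Y ∘ inside c)

  HasCopy? : ∀ Y → Dec (HasCopy Y)
  HasCopy? Y = map′ (λ (φ , i , h , y) → copy φ (i _ _) h y)
                    (λ c → emb c , (λ _ _ → inj c) , edges c , inside c)
    (∃-function? Good
      (λ φ → (all? λ a → all? λ b → implies (φ a ≟ φ b) (a ≟ b))
        ×-dec ((all? λ a → all? λ b → implies (adj F a b Bool.≟ true) (φ a ~? φ b))
        ×-dec (all? λ a → φ a ∈? Y)))
      λ f≗g (i , h , y) →
        (λ a b eq → i a b (trans (f≗g a) (trans eq (≡-sym (f≗g b)))))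
        , (λ a b ab → subst (λ x → x ~ _) (f≗g a) (subst (λ x → _ ~ x) (f≗g b) (h a b ab)))
        , λ a → subst (_∈ Y) (f≗g a) (y a))
    where
    implies : ∀ {A B : Set} → Dec A → Dec B → Dec (A → B)
    implies (no ¬a) _       = yes λ a → contradiction a ¬a
    implies (yes a) (yes b) = yes λ _ → b
    implies (yes a) (no ¬b) = no λ f → ¬b (f a)
    Good : (Fin p → Fin n) → Set
    Good φ = (∀ a b → φ a ≡ φ b → a ≡ b)
           × (∀ a b → adj F a b ≡ true → φ a ~ φ b) × (∀ a → φ a ∈ Y)

  copy-size : ∀ {Y} → HasCopy Y → p ≤ size Y
  copy-size {Y} c = begin
    p  ≡⟨ size-full ⟨
    size full  ≡⟨ sum-cong (λ a → cong ⟦_⟧ (holds (inside c a))) ⟨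
    sum (λ a → ⟦ Y (emb c a) ⟧)  ≤⟨ sum-injective (emb c) (inj c) (λ x → ⟦ Y x ⟧) ⟩
    size Y  ∎
    where open ≤-Reasoning

  double-edges-F : sum (λ a → sum λ b → ⟦ adj F a b ⟧) ≡ k + k
  double-edges-F = trans (≡-sym (Edges.e-double F full))
    (cong₂ _+_ (trans (Edges.e-full F) edges-F) (trans (Edges.e-full F) edges-F))

  copy-edges : ∀ {Y} → HasCopy Y → k ≤ e Y
  copy-edges {Y} c = halve-≤ (begin
    k + k  ≡⟨ double-edges-F ⟨
    sum (λ a → sum λ b → ⟦ adj F a b ⟧)  ≤⟨ sum-mono (λ a → sum-mono λ b → ⟦⟧-mono (edges c a b)) ⟩
    sum (λ a → sum λ b → ⟦ adj G (emb c a) (emb c b) ⟧)  ≤⟨ pullback≤E (emb c) (inj c) (inside c) ⟩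
    E Y Y  ≡⟨ e-double Y ⟨
    e Y + e Y  ∎)
    where open ≤-Reasoning

  N[_] : Fin n → Sub n
  N[ u ] = ⁅ u ⁆ ∪ nbr u

  ∈N⁻ : ∀ {u x} → x ∈ N[ u ] → x ≡ u ⊎ u ~ x
  ∈N⁻ x∈ with ∪⁻ x∈
  ... | inj₁ y = inj₁ (≡-sym (∈⁅⁆⁻ y))
  ... | inj₂ (mem y) = inj₂ y

  u∈N : ∀ {u} → u ∈ N[ u ]
  u∈N = ∪⁺ˡ ∈⁅⁆

  ~⇒∈N : ∀ {u x} → u ~ x → x ∈ N[ u ]
  ~⇒∈N {u} u~x = ∪⁺ʳ {A = ⁅ u ⁆} (mem u~x)

  copy-centre : ∀ {Y} → HasCopy Y → ∃ λ u → u ∈ Y × HasCopy (Y ∩ N[ u ])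
  copy-centre {Y} c@(copy φ i h y) = φ x , y x , copy φ i h λ a → ∩⁺ (y a) (near a)
    where
    x = proj₁ centre-F
    near : ∀ a → φ a ∈ N[ φ x ]
    near a with a ≟ x
    ... | yes refl = u∈N
    ... | no a≢x = ~⇒∈N (h x a (proj₂ centre-F a a≢x))

  -- The form in which a surviving copy is attacked: the position of `u` limits the vertices that
  -- `X` can contain, and `hasX` is then refuted by counting.
  record Centred (Y : Sub n) : Set where
    field
      X      : Sub n
      u      : Fin n
      hasX   : HasCopy X
      u∈Y    : u ∈ Y
      X⊆Y    : X ⊆ Y
      around : ∀ {s} → s ∈ X → s ≡ u ⊎ u ~ s

  centred : ∀ {Y} → HasCopy Y → Centred Y
  centred {Y} c with copy-centre c
  ... | u , u∈Y , d = record
    { X = Y ∩ N[ u ] ; u = u ; hasX = d ; u∈Y = u∈Y ; X⊆Y = ∩⁻ˡ ; around = ∈N⁻ ∘ ∩⁻ʳ }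

  abstract
    dom : List (Fin n) → Sub n
    dom []      x = false
    dom (u ∷ D) x = N[ u ] x ∨ dom D x

    ∈dom : ∀ {D u x} → u ∈ˡ D → x ≡ u ⊎ u ~ x → x ∈ dom D
    ∈dom {u ∷ D} (here refl) (inj₁ refl) = ∪⁺ˡ {A = N[ u ]} {dom D} u∈N
    ∈dom {u ∷ D} (here refl) (inj₂ u~x)  = ∪⁺ˡ {A = N[ u ]} {dom D} (~⇒∈N u~x)
    ∈dom {v ∷ D} (there u∈D) near = ∪⁺ʳ {A = N[ v ]} {dom D} (∈dom u∈D near)

    ∈dom⁻ : ∀ D {x} → x ∈ dom D → ∃ λ u → u ∈ˡ D × (x ≡ u ⊎ u ~ x)
    ∈dom⁻ []      x∈ = case holds x∈ of λ ()
    ∈dom⁻ (u ∷ D) x∈ with ∪⁻ {A = N[ u ]} {dom D} x∈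
    ... | inj₁ near = u , here refl , ∈N⁻ near
    ... | inj₂ rest with ∈dom⁻ D rest
    ...   | w , w∈D , near = w , there w∈D , near

  -- `D` need not lie in `S`. One deleted vertex can thus help to clear several components that do
  -- not contain it.
  Clear : Sub n → List (Fin n) → Set
  Clear S D = Free (S ∖ dom D)

  dom-mono : ∀ {D D′} → (∀ {u} → u ∈ˡ D → u ∈ˡ D′) → dom D ⊆ dom D′
  dom-mono {D} D⊆D′ x∈ with ∈dom⁻ D x∈
  ... | u , u∈D , near = ∈dom (D⊆D′ u∈D) near

  clear-mono : ∀ {S D D′} → (∀ {u} → u ∈ˡ D → u ∈ˡ D′) → Clear S D → Clear S D′
  clear-mono D⊆D′ free c = free (copy-mono (λ x∈ → ∖⁺ (∖⁻ˡ x∈) (∖⁻ʳ x∈ ∘ dom-mono D⊆D′)) c)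

  -- A copy lies in the closed neighbourhood of its centre, so without edges between the two sets it
  -- stays on the side of the centre.
  free-union : ∀ {Y X₁ X₂} → (∀ {x} → x ∈ Y → x ∈ X₁ ⊎ x ∈ X₂) → NoEdge X₁ X₂ →
    Free X₁ → Free X₂ → Free Y
  free-union {Y} {X₁} {X₂} cover apart free₁ free₂ c = go (cover u∈Y)
    where
    open Centred (centred c)
    go : u ∈ X₁ ⊎ u ∈ X₂ → ⊥
    go (inj₁ u∈) = free₁ (copy-mono sub hasX)
      where
      sub : X ⊆ X₁
      sub s∈X with cover (X⊆Y s∈X) | around s∈X
      ... | inj₁ s∈ | _ = s∈
      ... | inj₂ s∈ | inj₁ refl = u∈
      ... | inj₂ s∈ | inj₂ u~s = contradiction u~s (apart u∈ s∈)
    go (inj₂ u∈) = free₂ (copy-mono sub hasX)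
      where
      sub : X ⊆ X₂
      sub s∈X with cover (X⊆Y s∈X) | around s∈X
      ... | inj₂ s∈ | _ = s∈
      ... | inj₁ s∈ | inj₁ refl = u∈
      ... | inj₁ s∈ | inj₂ u~s = contradiction (~-sym u~s) (apart s∈ u∈)

  record FType (S : Sub n) : Set where
    field
      sizeF : size S ≡ p
      edgeF : e S ≡ k
      copyF : HasCopy S
      connF : Conn S
  open FType public

  size≤p : ∀ {S} → FType S → size S ≤ p
  size≤p fS = ≤-reflexive (sizeF fS)

  free-small : ∀ {X} → size X < p → Free X
  free-small small c = <⇒≱ small (copy-size c)

  free-drop : ∀ {A X a} → size A ≤ p → a ∈ A → a ∉ X → X ⊆ A → Free X
  free-drop |A| a∈A a∉X X⊆A = free-small (≤-trans (size-strict X⊆A a∈A a∉X) |A|)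

  -- Two of at most `p` vertices are lost and only `t` can be gained, so fewer than `p` remain.
  free-drop-two : ∀ {A X a a′} t → size A ≤ p → a ∈ A → a′ ∈ A → a ≢ a′ → a ∉ X → a′ ∉ X →
    (∀ {s} → s ∈ X → s ∈ A ⊎ s ≡ t) → Free X
  free-drop-two {A} {X} {a} {a′} t |A| a∈A a′∈A a≢a′ a∉X a′∉X X⊆ = free-small (begin-strict
    size X  ≤⟨ size-mono sub ⟩
    size (A″ ∪ ⁅ t ⁆)  ≤⟨ size-∪⁅⁆ A″ t ⟩
    suc (size A″)  ≡⟨ size-remove a′∈A′ ⟨
    size (A ∖ ⁅ a ⁆)  <⟨ ≤-refl ⟩
    suc (size (A ∖ ⁅ a ⁆))  ≡⟨ size-remove a∈A ⟨
    size A  ≤⟨ |A| ⟩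
    p  ∎)
    where
    open ≤-Reasoning
    A″ = A ∖ ⁅ a ⁆ ∖ ⁅ a′ ⁆
    a′∈A′ : a′ ∈ A ∖ ⁅ a ⁆
    a′∈A′ = ∖⁺ a′∈A (a≢a′ ∘ ∈⁅⁆⁻)
    sub : X ⊆ A″ ∪ ⁅ t ⁆
    sub s∈X with X⊆ s∈X
    ... | inj₂ refl = ∪⁺ʳ ∈⁅⁆
    ... | inj₁ s∈A = ∪⁺ˡ (∖⁺ (∖⁺ s∈A λ s∈a → a∉X (⁅⁆-pull s∈a s∈X))
                             λ s∈a′ → a′∉X (⁅⁆-pull s∈a′ s∈X))

  -- Every edge in `X` joins `v` to `a` or `b`. That makes at most two edges, and here `3 ≤ k`
  -- excludes a copy.
  free-path : ∀ {X} v a b → (∀ {s} → s ∈ X → s ≡ v ⊎ (s ≡ a ⊎ s ≡ b)) →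
    (a ∈ X → b ∈ X → ¬ a ~ b) → Free X
  free-path {X} v a b X⊆ a≁b c = <⇒≱ 3≤k (begin
    k  ≤⟨ copy-edges c ⟩
    e X  ≤⟨ peel (v ∈? X) ⟩
    size (X ∖ ⁅ v ⁆)  ≤⟨ size-mono sub ⟩
    size (⁅ a ⁆ ∪ ⁅ b ⁆)  ≤⟨ size-∪ ⁅ a ⁆ ⁅ b ⁆ ⟩
    size ⁅ a ⁆ + size ⁅ b ⁆  ≡⟨ cong₂ _+_ (size-⁅⁆ a) (size-⁅⁆ b) ⟩
    2  ∎)
    where
    open ≤-Reasoning
    leaf : ∀ {s} → s ∈ X → s ≢ v → s ≡ a ⊎ s ≡ b
    leaf s∈X s≢v with X⊆ s∈X
    ... | inj₁ s≡v = contradiction s≡v s≢v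
    ... | inj₂ s≡ = s≡
    leaves-free : ∀ {s t} → s ∈ X → t ∈ X → s ≢ v → t ≢ v → ¬ s ~ t
    leaves-free s∈X t∈X s≢v t≢v s~t with leaf s∈X s≢v | leaf t∈X t≢v
    ... | inj₁ refl | inj₁ refl = ~-≢ s~t refl
    ... | inj₁ refl | inj₂ refl = a≁b s∈X t∈X s~t
    ... | inj₂ refl | inj₁ refl = a≁b t∈X s∈X (~-sym s~t)
    ... | inj₂ refl | inj₂ refl = ~-≢ s~t refl
    ≢v : ∀ {s} → s ∈ X ∖ ⁅ v ⁆ → s ≢ v
    ≢v s∈ refl = ∖⁻ʳ s∈ ∈⁅⁆
    sub : X ∖ ⁅ v ⁆ ⊆ ⁅ a ⁆ ∪ ⁅ b ⁆
    sub s∈ with leaf (∖⁻ˡ s∈) (≢v s∈)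
    ... | inj₁ refl = ∪⁺ˡ ∈⁅⁆
    ... | inj₂ refl = ∪⁺ʳ {A = ⁅ a ⁆} ∈⁅⁆
    peel : Dec (v ∈ X) → e X ≤ size (X ∖ ⁅ v ⁆)
    peel (yes v∈X) = begin
      e X  ≡⟨ e-remove v∈X ⟩
      e (X ∖ ⁅ v ⁆) + E ⁅ v ⁆ (X ∖ ⁅ v ⁆)  ≡⟨ cong (_+ E ⁅ v ⁆ (X ∖ ⁅ v ⁆)) (NoEdge⇒e {X ∖ ⁅ v ⁆}
                                                            λ s t → leaves-free (∖⁻ˡ s) (∖⁻ˡ t) (≢v s) (≢v t)) ⟩
      E ⁅ v ⁆ (X ∖ ⁅ v ⁆)  ≤⟨ E-⁅⁆≤ v (X ∖ ⁅ v ⁆) ⟩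
      size (X ∖ ⁅ v ⁆)  ∎
    peel (no v∉X) = ≤-trans (≤-reflexive (NoEdge⇒e {X} λ s t →
      leaves-free s t (∉-≢ s v∉X) (∉-≢ t v∉X))) z≤n

  -- Suppose y is dominated from outside B while u ∈ B has exactly one undominated neighbour
  -- outside B. A copy of F centred at u can survive only if Bad B y u.
  Bad : Sub n → Fin n → Fin n → Set
  Bad B y u = E ⁅ y ⁆ B ≤ 1 × p ≤ 2 + E ⁅ u ⁆ B

  -- The copy lives in `B` without `y`, plus `t`. Inside this set `t` has at most one edge, so for
  -- `k` edges to remain, deleting `y` may cost at most one. All vertices of the copy other than `u`
  -- and `t` are neighbours of `u` in `B`, which bounds `p`.
  survivor⇒bad : ∀ {B X y u} t → FType B → y ∈ B → t ∉ B → y ∉ X → HasCopy X →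
    (∀ {s} → s ∈ X → s ∈ B ⊎ s ≡ t) → (∀ {s} → s ∈ X → s ≡ u ⊎ u ~ s) →
    (∀ {s} → s ∈ B → s ≢ y → t ~ s → s ≡ u) → Bad B y u
  survivor⇒bad {B} {X} {y} {u} t fB y∈B t∉B y∉X c X⊆ around only = low , high
    where
    open ≤-Reasoning
    B′ = B ∖ ⁅ y ⁆
    disjoint : ∀ {x} → x ∈ ⁅ t ⁆ → x ∉ B′
    disjoint x∈t x∈B′ = t∉B (⁅⁆-pull x∈t (∖⁻ˡ x∈B′))
    sub : X ⊆ ⁅ t ⁆ ∪ B′
    sub s∈X with X⊆ s∈X
    ... | inj₂ refl = ∪⁺ˡ ∈⁅⁆
    ... | inj₁ s∈B = ∪⁺ʳ {A = ⁅ t ⁆} (∖⁺ s∈B λ y∈ → y∉X (⁅⁆-pull y∈ s∈X))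
    to-u : B′ ∩ nbr t ⊆ ⁅ u ⁆
    to-u s∈ with ∩⁻ˡ {A = B′} s∈
    ... | s∈B′ with only (∖⁻ˡ s∈B′) (λ { refl → ∖⁻ʳ s∈B′ ∈⁅⁆ }) (holds (∩⁻ʳ {A = B′} s∈))
    ...   | refl = ∈⁅⁆
    t-leaf : E ⁅ t ⁆ B′ ≤ 1
    t-leaf = begin
      E ⁅ t ⁆ B′  ≡⟨ E-⁅⁆ t B′ ⟩
      size (B′ ∩ nbr t)  ≤⟨ size-mono {B = ⁅ u ⁆} to-u ⟩
      size ⁅ u ⁆  ≡⟨ size-⁅⁆ u ⟩
      1  ∎
    y-self : E ⁅ y ⁆ B ≡ E ⁅ y ⁆ B′
    y-self = trans (E-splitʳ ⁅ y ⁆ (part-⁅⁆ y∈B))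
      (cong (_+ E ⁅ y ⁆ B′) (NoEdge⇒E (loop-free y)))
    low : E ⁅ y ⁆ B ≤ 1
    low = +-cancelˡ-≤ (e B′) _ _ (begin
      e B′ + E ⁅ y ⁆ B  ≡⟨ cong (e B′ +_) y-self ⟩
      e B′ + E ⁅ y ⁆ B′  ≡⟨ e-remove y∈B ⟨
      e B  ≡⟨ edgeF fB ⟩
      k  ≤⟨ copy-edges c ⟩
      e X  ≤⟨ e-mono sub ⟩
      e (⁅ t ⁆ ∪ B′)  ≡⟨ e-part (part-∪ disjoint) ⟩
      e ⁅ t ⁆ + e B′ + E ⁅ t ⁆ B′  ≡⟨ cong (λ x → x + e B′ + E ⁅ t ⁆ B′)
                                               (NoEdge⇒e (loop-free t)) ⟩
      e B′ + E ⁅ t ⁆ B′  ≤⟨ +-monoʳ-≤ (e B′) t-leaf ⟩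
      e B′ + 1  ∎)
    sub′ : X ⊆ (B ∩ nbr u ∪ ⁅ t ⁆) ∪ ⁅ u ⁆
    sub′ s∈X with X⊆ s∈X | around s∈X
    ... | _         | inj₁ refl = ∪⁺ʳ {A = B ∩ nbr u ∪ ⁅ t ⁆} ∈⁅⁆
    ... | inj₂ refl | _         = ∪⁺ˡ (∪⁺ʳ {A = B ∩ nbr u} ∈⁅⁆)
    ... | inj₁ s∈B  | inj₂ u~s  = ∪⁺ˡ (∪⁺ˡ (∩⁺ s∈B (mem u~s)))
    high : p ≤ 2 + E ⁅ u ⁆ B
    high = begin
      p  ≤⟨ copy-size c ⟩
      size X  ≤⟨ size-mono sub′ ⟩
      size ((B ∩ nbr u ∪ ⁅ t ⁆) ∪ ⁅ u ⁆)  ≤⟨ size-∪⁅⁆ (B ∩ nbr u ∪ ⁅ t ⁆) u ⟩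
      suc (size (B ∩ nbr u ∪ ⁅ t ⁆))  ≤⟨ s≤s (size-∪⁅⁆ (B ∩ nbr u) t) ⟩
      2 + size (B ∩ nbr u)  ≡⟨ cong (2 +_) (E-⁅⁆ u B) ⟨
      2 + E ⁅ u ⁆ B  ∎

  -- Otherwise p ≤ 3, and a graph on three vertices with three edges has no vertex of degree one.
  low-high-degree : ∀ {B y} → FType B → y ∈ B → E ⁅ y ⁆ B ≤ 1 → ¬ p ≤ 2 + E ⁅ y ⁆ B
  low-high-degree {B} {y} fB y∈B low high = <⇒≱ 3≤k (begin
    k  ≡⟨ edgeF fB ⟨
    e B  ≡⟨ e-remove y∈B ⟩
    e B′ + E ⁅ y ⁆ B′  ≤⟨ +-mono-≤ (e-two (any? (_∈? B′))) (≤-trans (E-mono {⁅ y ⁆} (λ z → z) ∖⁻ˡ) low) ⟩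
    2  ∎)
    where
    open ≤-Reasoning
    B′ = B ∖ ⁅ y ⁆
    |B′|≤2 : size B′ ≤ 2
    |B′|≤2 = +-cancelˡ-≤ 1 _ _ (begin
      suc (size B′)  ≡⟨ size-remove y∈B ⟨
      size B  ≡⟨ sizeF fB ⟩
      p  ≤⟨ high ⟩
      2 + E ⁅ y ⁆ B  ≤⟨ +-monoʳ-≤ 2 low ⟩
      3  ∎)
    e-two : Dec (∃ λ x → x ∈ B′) → e B′ ≤ 1
    e-two (no ∄) = ≤-trans (≤-reflexive (NoEdge⇒e {B′} λ a _ _ → ∄ (_ , a))) z≤n
    e-two (yes (x , x∈B′)) = begin
      e B′  ≡⟨ e-remove x∈B′ ⟩
      e B″ + E ⁅ x ⁆ B″  ≡⟨ cong (_+ E ⁅ x ⁆ B″) (NoEdge⇒e single) ⟩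
      E ⁅ x ⁆ B″  ≤⟨ E-⁅⁆≤ x B″ ⟩
      size B″  ≤⟨ |B″|≤1 ⟩
      1  ∎
      where
      B″ = B′ ∖ ⁅ x ⁆
      |B″|≤1 : size B″ ≤ 1
      |B″|≤1 = +-cancelˡ-≤ 1 _ _ (≤-trans (≤-reflexive (≡-sym (size-remove x∈B′))) |B′|≤2)
      single : NoEdge B″ B″
      single {a} {b} a∈ b∈ a~b = <⇒≱ (member⇒size (∖⁺ b∈ (~-≢ a~b ∘ ∈⁅⁆⁻)))
        (+-cancelˡ-≤ 1 _ _ (≤-trans (≤-reflexive (≡-sym (size-remove a∈))) |B″|≤1))

  -- The two hypotheses give `y` degree at most one and degree at least `p - 2` in `B`.
  bad-asym : ∀ {B y u} → FType B → y ∈ B → Bad B y u → ¬ Bad B u y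
  bad-asym fB y∈B (low , _) (_ , high) = low-high-degree fB y∈B low high

  -- Two copies of F joined by few edges

  not-dominator : ∀ {S D x s} → x ∈ˡ D → s ∈ S ∖ dom D → s ≢ x
  not-dominator {S} x∈D s∈ refl = ∖⁻ʳ {A = S} s∈ (∈dom x∈D (inj₁ refl))

  not-dominated : ∀ {S D x s} → x ∈ˡ D → s ∈ S ∖ dom D → ¬ x ~ s
  not-dominated {S} x∈D s∈ x~s = ∖⁻ʳ {A = S} s∈ (∈dom x∈D (inj₂ x~s))

  two≤p : ∀ {A} → FType A → 2 ≤ size A
  two≤p {A} fA with 2 ≤? size A
  ... | yes two = two
  ... | no ¬two with size-positive {S = A} (member⇒size (proj₂ (nonempty (connF fA))))
  ...   | a , a∈A = contradiction (subst (3 ≤_) (trans (≡-sym (edgeF fA)) (NoEdge⇒e {A} single)) 3≤k) λ ()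
    where
    single : NoEdge A A
    single {x} {y} x∈ y∈ x~y = ¬two (≤-trans (s≤s (member⇒size (∖⁺ y∈ (~-≢ x~y ∘ ∈⁅⁆⁻))))
      (≤-reflexive (≡-sym (size-remove x∈))))

  neighbour : ∀ {A x} → FType A → x ∈ A → ∃ λ y → y ∈ A × x ~ y
  neighbour fA x∈A = conn-nbr (connF fA) x∈A (two≤p fA)

  SingleClears : Sub n → Set
  SingleClears S = ∃ λ x → Clear S (x ∷ [])

  single-or-copy : ∀ S x → SingleClears S ⊎ HasCopy (S ∖ dom (x ∷ []))
  single-or-copy S x with HasCopy? (S ∖ dom (x ∷ []))
  ... | yes c = inj₂ c
  ... | no ¬c = inj₁ (x , ¬c)

  unique-nbr : ∀ B w → (∀ {s t} → s ∈ B → t ∈ B → w ~ s → w ~ t → s ≡ t) →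
    ∃ λ t → ∀ {s} → s ∈ B → w ~ s → s ≡ t
  unique-nbr B w unique with any? (λ t → (t ∈? B) ×-dec (w ~? t))
  ... | yes (t , t∈B , w~t) = t , λ s∈B w~s → unique s∈B t∈B w~s w~t
  -- Without any neighbour the witness is arbitrary; `w` is a default value.
  ... | no ∄ = w , λ s∈B w~s → contradiction (_ , s∈B , w~s) ∄

  -- Neither side is required to be of type F: size and connectivity are recorded instead, so that
  -- one side may be `F` with an added edge.
  record Joined (S A B : Sub n) : Set where
    field
      covers : ∀ {s} → s ∈ S → s ∈ A ⊎ s ∈ B
      disj   : ∀ {s} → s ∈ A → s ∉ B
      sizeA  : size A ≡ p
      sizeB  : size B ≡ p
      connA  : Conn A
      connB  : Conn B
      few    : E A B ≤ 3

  joined-swap : ∀ {S A B} → Joined S A B → Joined S B A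
  joined-swap {S} {A} {B} J = record
    { covers = [ inj₂ , inj₁ ]′ ∘ covers ; disj = λ b a → disj a b
    ; sizeA = sizeB ; sizeB = sizeA ; connA = connB ; connB = connA
    ; few = ≤-trans (≤-reflexive (E-sym B A)) few }
    where open Joined J

  TwoOut : Sub n → Sub n → Set
  TwoOut A B = ∃ λ u → ∃ λ t → ∃ λ t′ → (u ∈ A × t ∈ B × t′ ∈ B) × (u ~ t × u ~ t′ × t ≢ t′)

  TwoOut? : ∀ A B → Dec (TwoOut A B)
  TwoOut? A B = any? λ u → any? λ t → any? λ t′ →
    ((u ∈? A) ×-dec ((t ∈? B) ×-dec (t′ ∈? B))) ×-dec ((u ~? t) ×-dec ((u ~? t′) ×-dec ¬? (t ≟ t′)))

  not-two-out : ∀ {A B} → ¬ TwoOut A B → ∀ {u s t} → u ∈ A → s ∈ B → t ∈ B → u ~ s → u ~ t → s ≡ t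
  not-two-out none {u} {s} {t} u∈A s∈B t∈B u~s u~t with s ≟ t
  ... | yes s≡t = s≡t
  ... | no s≢t = contradiction (u , s , t , (u∈A , s∈B , t∈B) , (u~s , u~t , s≢t)) none

  -- The vertex `u` uses two of at most three joining edges, so at most one survives. A copy centred
  -- in `A` loses `u` and a neighbour of `u`, a copy centred in `B` loses `t` and `t′`, and either
  -- gains at most one vertex across.
  two-out-clears : ∀ {S A B} → 2 ≤ p → Joined S A B → TwoOut A B → SingleClears S
  two-out-clears {S} {A} {B} 2≤p J (u , t , t′ , (u∈A , t∈B , t′∈B) , (u~t , u~t′ , t≢t′)) = u , clear
    where
    open Joined J
    A′ = A ∖ ⁅ u ⁆
    few′ : E A′ B ≤ 1
    few′ = +-cancelˡ-≤ 2 _ _ (≤-trans (+-monoˡ-≤ (E A′ B) (two-nbrs t∈B t′∈B u~t u~t′ t≢t′))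
      (≤-trans (≤-reflexive (≡-sym (E-splitˡ B (part-⁅⁆ u∈A)))) few))
    clear : Clear S (u ∷ [])
    clear c = go (covers (∖⁻ˡ w∈Y))
      where
      open Centred (centred c) renaming (u to w; u∈Y to w∈Y)
      go : w ∈ A ⊎ w ∈ B → ⊥
      go (inj₁ w∈A) with conn-nbr connA u∈A (≤-trans 2≤p (≤-reflexive (≡-sym sizeA)))
        | unique-nbr B w (λ {s} {s′} s∈ s′∈ w~s w~s′ → case s ≟ s′ of λ
          { (yes s≡s′) → s≡s′
          ; (no s≢s′) → contradiction (two-nbrs s∈ s′∈ w~s w~s′ s≢s′)
              (<⇒≱ (s≤s (≤-trans (E-mono {⁅ w ⁆} {A′} {B} {B}
                (⁅⁆⊆ (∖⁺ w∈A (not-dominator (here refl) w∈Y ∘ ≡-sym ∘ ∈⁅⁆⁻))) (λ x → x)) few′))) })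
      ... | u′ , u′∈A , u~u′ | x , only = free-drop-two x (≤-reflexive sizeA) u∈A u′∈A (~-≢ u~u′)
        (λ u∈X → not-dominator (here refl) (X⊆Y u∈X) refl)
        (λ u′∈X → not-dominated (here refl) (X⊆Y u′∈X) u~u′) sub hasX
        where
        sub : ∀ {s} → s ∈ X → s ∈ A ⊎ s ≡ x
        sub s∈X with covers (∖⁻ˡ (X⊆Y s∈X)) | around s∈X
        ... | inj₁ s∈A | _ = inj₁ s∈A
        ... | inj₂ s∈B | inj₁ refl = inj₁ w∈A
        ... | inj₂ s∈B | inj₂ w~s = inj₂ (only s∈B w~s)
      go (inj₂ w∈B) with unique-nbr A′ w (λ {s} {s′} s∈ s′∈ w~s w~s′ → case s ≟ s′ of λ
          { (yes s≡s′) → s≡s′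
          ; (no s≢s′) → contradiction (two-nbrs s∈ s′∈ w~s w~s′ s≢s′)
              (<⇒≱ (s≤s (≤-trans (≤-reflexive (E-sym ⁅ w ⁆ A′)) (≤-trans (E-mono {A′} {A′} {⁅ w ⁆} {B} (λ x → x)
                (⁅⁆⊆ w∈B)) few′)))) })
      ... | x , only = free-drop-two x (≤-reflexive sizeB) t∈B t′∈B t≢t′
        (λ t∈X → not-dominated (here refl) (X⊆Y t∈X) u~t)
        (λ t′∈X → not-dominated (here refl) (X⊆Y t′∈X) u~t′) sub hasX
        where
        sub : ∀ {s} → s ∈ X → s ∈ B ⊎ s ≡ x
        sub s∈X with covers (∖⁻ˡ (X⊆Y s∈X)) | around s∈X
        ... | inj₂ s∈B | _ = inj₁ s∈B
        ... | inj₁ s∈A | inj₁ refl = inj₁ w∈B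
        ... | inj₁ s∈A | inj₂ w~s =
          inj₂ (only (∖⁺ s∈A λ u≡s → not-dominator (here refl) (X⊆Y s∈X) (≡-sym (∈⁅⁆⁻ u≡s))) w~s)

  -- Once no vertex has two neighbours across, the joining edges form a matching. If the end `z` of
  -- an edge `z ~ y` fails, the surviving copy is centred at the end `u` in `B` of another edge, and
  -- `u` has degree at least `p - 2`. If the end of that second edge in `A` fails too, `u` has
  -- degree at most one.
  joined-clears : ∀ {S A B} → FType B → Joined S A B → 1 ≤ E A B → SingleClears S
  joined-clears {S} {A} {B} fB J 1≤E with TwoOut? A B | TwoOut? B A
  ... | yes two | _ = two-out-clears (subst (2 ≤_) (sizeF fB) (two≤p fB)) J two
  ... | no _ | yes two = two-out-clears (subst (2 ≤_) (sizeF fB) (two≤p fB)) (joined-swap J) two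
  ... | no noA | no noB with find-edge {A} {B} 1≤E
  ...   | z₁ , y₁ , z₁∈A , y₁∈B , z₁~y₁ = first (attempt z₁∈A y₁∈B z₁~y₁)
    where
    open Joined J
    Failure : Fin n → Set
    Failure y = ∃ λ t → ∃ λ u → t ∈ A × u ∈ B × t ~ u × Bad B y u
    attempt : ∀ {z y} → z ∈ A → y ∈ B → z ~ y → SingleClears S ⊎ Failure y
    attempt {z} {y} z∈A y∈B z~y with single-or-copy S z
    ... | inj₁ done = inj₁ done
    ... | inj₂ c = inj₂ (go (covers (∖⁻ˡ u∈Y)))
      where
      open Centred (centred c)
      y∉X : y ∉ X
      y∉X y∈X = not-dominated (here refl) (X⊆Y y∈X) z~y
      go : u ∈ A ⊎ u ∈ B → Failure y
      go (inj₁ u∈A) with conn-nbr connA z∈A (≤-trans (two≤p fB) (≤-reflexive (trans sizeB (≡-sym sizeA))))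
        | unique-nbr B u (not-two-out noA u∈A)
      ... | z′ , z′∈A , z~z′ | x , only = contradiction hasX
        (free-drop-two x (≤-reflexive sizeA) z∈A z′∈A (~-≢ z~z′)
          (λ z∈X → not-dominator (here refl) (X⊆Y z∈X) refl)
          (λ z′∈X → not-dominated (here refl) (X⊆Y z′∈X) z~z′) sub)
        where
        sub : ∀ {s} → s ∈ X → s ∈ A ⊎ s ≡ x
        sub s∈X with covers (∖⁻ˡ (X⊆Y s∈X)) | around s∈X
        ... | inj₁ s∈A | _ = inj₁ s∈A
        ... | inj₂ s∈B | inj₁ refl = inj₁ u∈A
        ... | inj₂ s∈B | inj₂ u~s = inj₂ (only s∈B u~s)
      go (inj₂ u∈B) with any? (λ t → (t ∈? A) ×-dec (t ~? u))
      ... | no ∄ = contradiction hasX (free-drop (≤-reflexive sizeB) y∈B y∉X sub)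
        where
        sub : X ⊆ B
        sub s∈X with covers (∖⁻ˡ (X⊆Y s∈X)) | around s∈X
        ... | inj₂ s∈B | _ = s∈B
        ... | inj₁ s∈A | inj₁ refl = u∈B
        ... | inj₁ s∈A | inj₂ u~s = contradiction (_ , s∈A , ~-sym u~s) ∄
      ... | yes (t , t∈A , t~u) = t , u , t∈A , u∈B , t~u ,
        survivor⇒bad t fB y∈B (disj t∈A) y∉X hasX sub around
          (λ s∈B _ t~s → not-two-out noA t∈A s∈B u∈B t~s t~u)
        where
        sub : ∀ {s} → s ∈ X → s ∈ B ⊎ s ≡ t
        sub s∈X with covers (∖⁻ˡ (X⊆Y s∈X)) | around s∈X
        ... | inj₂ s∈B | _ = inj₁ s∈B
        ... | inj₁ s∈A | inj₁ refl = inj₁ u∈B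
        ... | inj₁ s∈A | inj₂ u~s = inj₂ (not-two-out noB u∈B s∈A t∈A u~s (~-sym t~u))
    first : SingleClears S ⊎ Failure y₁ → SingleClears S
    first (inj₁ done) = done
    first (inj₂ (t , u , t∈A , u∈B , t~u , _ , high)) with attempt t∈A u∈B t~u
    ... | inj₁ done = done
    ... | inj₂ (_ , _ , _ , _ , _ , low , _) = contradiction high (low-high-degree fB u∈B low)

  -- Copies of F joined through F-connections.

  -- Here `v` with `A` is a constituent, and the joining edges to `B` start one at `v` and one in
  -- `A`, which closes a ring.
  record Ring (S A B : Sub n) (v w y a b : Fin n) : Set where
    field
      covers : ∀ {s} → s ∈ S → s ≡ v ⊎ s ∈ A ⊎ s ∈ B
      fA     : FType A
      fB     : FType B
      disj   : ∀ {s} → s ∈ A → s ∉ B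
      v∉A    : v ∉ A
      v∉B    : v ∉ B
      w∈A    : w ∈ A
      y∈B    : y ∈ B
      a∈A    : a ∈ A
      b∈B    : b ∈ B
      v~w    : v ~ w
      v~y    : v ~ y
      a~b    : a ~ b
      onlyA  : ∀ {s} → s ∈ A → v ~ s → s ≡ w
      onlyB  : ∀ {s} → s ∈ B → v ~ s → s ≡ y
      onlyAB : ∀ {s t} → s ∈ A → t ∈ B → s ~ t → s ≡ a × t ≡ b

  ring-swap : ∀ {S A B v w y a b} → Ring S A B v w y a b → Ring S B A v y w b a
  ring-swap R = record
    { covers = λ s∈S → case covers s∈S of λ
      { (inj₁ s≡v) → inj₁ s≡v ; (inj₂ (inj₁ s∈A)) → inj₂ (inj₂ s∈A) ; (inj₂ (inj₂ s∈B)) → inj₂ (inj₁ s∈B) }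
    ; fA = fB ; fB = fA ; disj = λ s∈B s∈A → disj s∈A s∈B ; v∉A = v∉B ; v∉B = v∉A
    ; w∈A = y∈B ; y∈B = w∈A ; a∈A = b∈B ; b∈B = a∈A ; v~w = v~y ; v~y = v~w ; a~b = ~-sym a~b
    ; onlyA = onlyB ; onlyB = onlyA
    ; onlyAB = λ s∈B t∈A s~t → let (t≡a , s≡b) = onlyAB t∈A s∈B (~-sym s~t) in s≡b , t≡a }
    where open Ring R

  -- With `a` chosen, a copy centred at `v` has too few edges. One centred in `A` loses `a` and a
  -- neighbour and gains only `v`. One centred in `B` loses `b` and can gain only `v`, for which its
  -- centre must be `y`.
  ring-inner : ∀ {S A B v w y a b} → Ring S A B v w y a b → HasCopy (S ∖ dom (a ∷ [])) → Bad B b y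
  ring-inner {S} {A} {B} {v} {w} {y} {a} {b} R c = go (covers (∖⁻ˡ u∈Y))
    where
    open Ring R
    open Centred (centred c)
    a∉X : a ∉ X
    a∉X a∈X = not-dominator (here refl) (X⊆Y a∈X) refl
    b∉X : b ∉ X
    b∉X b∈X = not-dominated (here refl) (X⊆Y b∈X) a~b
    go : u ≡ v ⊎ u ∈ A ⊎ u ∈ B → Bad B b y
    go (inj₁ refl) = contradiction hasX (free-path v w y sub
      λ w∈X y∈X w~y → a∉X (subst (_∈ X) (proj₁ (onlyAB w∈A y∈B w~y)) w∈X))
      where
      sub : ∀ {s} → s ∈ X → s ≡ v ⊎ (s ≡ w ⊎ s ≡ y)
      sub s∈X with around s∈X | covers (∖⁻ˡ (X⊆Y s∈X))
      ... | inj₁ s≡v | _ = inj₁ s≡v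
      ... | inj₂ _   | inj₁ s≡v = inj₁ s≡v
      ... | inj₂ v~s | inj₂ (inj₁ s∈A) = inj₂ (inj₁ (onlyA s∈A v~s))
      ... | inj₂ v~s | inj₂ (inj₂ s∈B) = inj₂ (inj₂ (onlyB s∈B v~s))
    go (inj₂ (inj₁ u∈A)) with neighbour fA a∈A
    ... | a′ , a′∈A , a~a′ = contradiction hasX (free-drop-two v (size≤p fA) a∈A a′∈A (~-≢ a~a′) a∉X
      (λ a′∈X → not-dominated (here refl) (X⊆Y a′∈X) a~a′) sub)
      where
      sub : ∀ {s} → s ∈ X → s ∈ A ⊎ s ≡ v
      sub s∈X with covers (∖⁻ˡ (X⊆Y s∈X)) | around s∈X
      ... | inj₁ s≡v | _ = inj₂ s≡v
      ... | inj₂ (inj₁ s∈A) | _ = inj₁ s∈A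
      ... | inj₂ (inj₂ s∈B) | inj₁ refl = inj₁ u∈A
      ... | inj₂ (inj₂ s∈B) | inj₂ u~s =
        contradiction (subst (_∈ X) (proj₂ (onlyAB u∈A s∈B u~s)) s∈X) b∉X
    go (inj₂ (inj₂ u∈B)) with u ≟ y
    ... | yes refl = survivor⇒bad v fB b∈B v∉B b∉X hasX sub around λ s∈B _ v~s → onlyB s∈B v~s
      where
      sub : ∀ {s} → s ∈ X → s ∈ B ⊎ s ≡ v
      sub s∈X with covers (∖⁻ˡ (X⊆Y s∈X)) | around s∈X
      ... | inj₁ s≡v | _ = inj₂ s≡v
      ... | inj₂ (inj₂ s∈B) | _ = inj₁ s∈B
      ... | inj₂ (inj₁ s∈A) | inj₁ refl = inj₁ u∈B
      ... | inj₂ (inj₁ s∈A) | inj₂ u~s =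
        contradiction (subst (_∈ X) (proj₁ (onlyAB s∈A u∈B (~-sym u~s))) s∈X) a∉X
    ... | no u≢y = contradiction hasX (free-drop (size≤p fB) b∈B b∉X sub)
      where
      sub : X ⊆ B
      sub s∈X with covers (∖⁻ˡ (X⊆Y s∈X)) | around s∈X
      ... | _ | inj₁ refl = u∈B
      ... | inj₂ (inj₂ s∈B) | _ = s∈B
      ... | inj₁ refl | inj₂ u~v = contradiction (onlyB u∈B (~-sym u~v)) u≢y
      ... | inj₂ (inj₁ s∈A) | inj₂ u~s =
        contradiction (subst (_∈ X) (proj₁ (onlyAB s∈A u∈B (~-sym u~s))) s∈X) a∉X

  -- With `v` chosen, `w` is lost, and the edge `a b` is the only way for a copy centred in `A` to
  -- gain a vertex.
  ring-outer-half : ∀ {S A B v w y a b} → Ring S A B v w y a b →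
    (c : HasCopy (S ∖ dom (v ∷ []))) → Centred.u (centred c) ∈ A → Bad A w a
  ring-outer-half {S} {A} {B} {v} {w} {y} {a} {b} R c u∈A = go (u ≟ a)
    where
    open Ring R
    open Centred (centred c)
    w∉X : w ∉ X
    w∉X w∈X = not-dominated (here refl) (X⊆Y w∈X) v~w
    sub : ∀ {s} → s ∈ X → s ∈ A ⊎ (u ≡ a × s ≡ b)
    sub s∈X with covers (∖⁻ˡ (X⊆Y s∈X)) | around s∈X
    ... | _ | inj₁ refl = inj₁ u∈A
    ... | inj₁ refl | _ = contradiction refl (not-dominator (here refl) (X⊆Y s∈X))
    ... | inj₂ (inj₁ s∈A) | _ = inj₁ s∈A
    ... | inj₂ (inj₂ s∈B) | inj₂ u~s = inj₂ (onlyAB u∈A s∈B u~s)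
    go : Dec (u ≡ a) → Bad A w a
    go (yes refl) = survivor⇒bad b fA w∈A (λ b∈A → disj b∈A b∈B) w∉X hasX
      ([ inj₁ , inj₂ ∘ proj₂ ]′ ∘ sub) around (λ s∈A _ b~s → proj₁ (onlyAB s∈A b∈B (~-sym b~s)))
    go (no u≢a) = contradiction hasX (free-drop (size≤p fA) w∈A w∉X
      λ s∈X → [ (λ s∈A → s∈A) , (λ (u≡a , _) → contradiction u≡a u≢a) ]′ (sub s∈X))

  ring-outer : ∀ {S A B v w y a b} → Ring S A B v w y a b →
    HasCopy (S ∖ dom (v ∷ [])) → Bad A w a ⊎ Bad B y b
  ring-outer R c with Ring.covers R (∖⁻ˡ (Centred.u∈Y (centred c)))
  ... | inj₁ u≡v = contradiction u≡v (not-dominator (here refl) (Centred.u∈Y (centred c)))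
  ... | inj₂ (inj₁ u∈A) = inj₁ (ring-outer-half R c u∈A)
  ... | inj₂ (inj₂ u∈B) = inj₂ (ring-outer-half (ring-swap R) c u∈B)

  -- If `v` fails, one of the copies contains a vertex of low degree and one of high degree. If the
  -- end of `a b` in the other copy fails as well, the two vertices exchange roles.
  ring-clears : ∀ {S A B v w y a b} → Ring S A B v w y a b → SingleClears S
  ring-clears {S} {A} {B} {v} {w} {y} {a} {b} R
    with single-or-copy S a | single-or-copy S b | single-or-copy S v
  ... | inj₁ done | _ | _ = done
  ... | _ | inj₁ done | _ = done
  ... | _ | _ | inj₁ done = done
  ... | inj₂ ca | inj₂ cb | inj₂ cv with ring-outer R cv
  ...   | inj₁ bad = contradiction (ring-inner (ring-swap R) cb) (bad-asym {u = a} (Ring.fA R) (Ring.w∈A R) bad)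
  ...   | inj₂ bad = contradiction (ring-inner R ca) (bad-asym {u = b} (Ring.fB R) (Ring.y∈B R) bad)

  -- Both joining edges start in `A`, at different vertices; their ends in `B` may coincide.
  record Pendant (S A B : Sub n) (v w z₁ y₁ z₂ y₂ : Fin n) : Set where
    field
      covers : ∀ {s} → s ∈ S → s ≡ v ⊎ s ∈ A ⊎ s ∈ B
      fA     : FType A
      fB     : FType B
      disj   : ∀ {s} → s ∈ A → s ∉ B
      v∉A    : v ∉ A
      v∉B    : v ∉ B
      onlyA  : ∀ {s} → s ∈ A → v ~ s → s ≡ w
      noneB  : ∀ {s} → s ∈ B → ¬ v ~ s
      z₁∈A   : z₁ ∈ A
      z₂∈A   : z₂ ∈ A
      y₁∈B   : y₁ ∈ B
      y₂∈B   : y₂ ∈ B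
      z₁~y₁  : z₁ ~ y₁
      z₂~y₂  : z₂ ~ y₂
      z₁≢z₂  : z₁ ≢ z₂
      onlyAB : ∀ {s t} → s ∈ A → t ∈ B → s ~ t → (s ≡ z₁ × t ≡ y₁) ⊎ (s ≡ z₂ × t ≡ y₂)

  pendant-swap : ∀ {S A B v w z₁ y₁ z₂ y₂} →
    Pendant S A B v w z₁ y₁ z₂ y₂ → Pendant S A B v w z₂ y₂ z₁ y₁
  pendant-swap P = record
    { covers = covers ; fA = fA ; fB = fB ; disj = disj ; v∉A = v∉A ; v∉B = v∉B ; onlyA = onlyA
    ; noneB = noneB ; z₁∈A = z₂∈A ; z₂∈A = z₁∈A ; y₁∈B = y₂∈B ; y₂∈B = y₁∈B ; z₁~y₁ = z₂~y₂
    ; z₂~y₂ = z₁~y₁ ; z₁≢z₂ = z₁≢z₂ ∘ ≡-sym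
    ; onlyAB = λ s∈A t∈B s~t → case onlyAB s∈A t∈B s~t of λ { (inj₁ x) → inj₂ x ; (inj₂ x) → inj₁ x } }
    where open Pendant P

  module _ {S A B v w z₁ y₁ z₂ y₂} (P : Pendant S A B v w z₁ y₁ z₂ y₂) where
    open Pendant P

    module _ {D} (c : HasCopy (S ∖ dom D)) where
      open Centred (centred c)

      pendant-not-centre : u ≢ v
      pendant-not-centre refl = free-path v w w sub (λ _ _ w~w → ~-≢ w~w refl) hasX
        where
        sub : ∀ {s} → s ∈ X → s ≡ v ⊎ (s ≡ w ⊎ s ≡ w)
        sub s∈X with around s∈X | covers (∖⁻ˡ (X⊆Y s∈X))
        ... | inj₁ s≡v | _ = inj₁ s≡v
        ... | inj₂ _   | inj₁ s≡v = inj₁ s≡v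
        ... | inj₂ v~s | inj₂ (inj₁ s∈A) = inj₂ (inj₁ (onlyA s∈A v~s))
        ... | inj₂ v~s | inj₂ (inj₂ s∈B) = contradiction v~s (noneB s∈B)

      pendant-centreA : u ∈ A → ∀ {s} → s ∈ X →
        s ∈ A ⊎ (s ≡ v × u ≡ w) ⊎ (s ≡ y₁ × u ≡ z₁) ⊎ (s ≡ y₂ × u ≡ z₂)
      pendant-centreA u∈A s∈X with around s∈X | covers (∖⁻ˡ (X⊆Y s∈X))
      ... | inj₁ refl | _ = inj₁ u∈A
      ... | inj₂ u~s | inj₁ refl = inj₂ (inj₁ (refl , onlyA u∈A (~-sym u~s)))
      ... | inj₂ u~s | inj₂ (inj₁ s∈A) = inj₁ s∈A
      ... | inj₂ u~s | inj₂ (inj₂ s∈B) with onlyAB u∈A s∈B u~s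
      ...   | inj₁ (u≡ , s≡) = inj₂ (inj₂ (inj₁ (s≡ , u≡)))
      ...   | inj₂ (u≡ , s≡) = inj₂ (inj₂ (inj₂ (s≡ , u≡)))

      pendant-centreB : u ∈ B → ∀ {s} → s ∈ X →
        s ∈ B ⊎ (s ≡ z₁ × u ≡ y₁) ⊎ (s ≡ z₂ × u ≡ y₂)
      pendant-centreB u∈B s∈X with around s∈X | covers (∖⁻ˡ (X⊆Y s∈X))
      ... | inj₁ refl | _ = inj₁ u∈B
      ... | inj₂ u~s | inj₁ refl = contradiction (~-sym u~s) (noneB u∈B)
      ... | inj₂ u~s | inj₂ (inj₂ s∈B) = inj₁ s∈B
      ... | inj₂ u~s | inj₂ (inj₁ s∈A) = inj₂ (onlyAB s∈A u∈B (~-sym u~s))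

      pendant-cases : {R : Set} → (u ∈ A → R) → (u ∈ B → R) → R
      pendant-cases onA onB with covers (∖⁻ˡ u∈Y)
      ... | inj₁ u≡v = contradiction u≡v pendant-not-centre
      ... | inj₂ (inj₁ u∈A) = onA u∈A
      ... | inj₂ (inj₂ u∈B) = onB u∈B

    -- The common end dominates `z₁` and `z₂`, so a copy centred in `A` loses both and gains at most
    -- `v`.
    pendant-merged : y₁ ≡ y₂ → Clear S (y₁ ∷ [])
    pendant-merged refl c = pendant-cases c onA onB
      where
      open Centred (centred c)
      dead : ∀ {z} → z ~ y₁ → z ∉ X
      dead z~y z∈X = not-dominated (here refl) (X⊆Y z∈X) (~-sym z~y)
      u-alive : ∀ {z} → z ~ y₁ → u ≢ z
      u-alive z~y refl = not-dominated (here refl) u∈Y (~-sym z~y)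
      onA : u ∈ A → ⊥
      onA u∈A = free-drop-two v (size≤p fA) z₁∈A z₂∈A z₁≢z₂ (dead z₁~y₁) (dead z₂~y₂) sub hasX
        where
        sub : ∀ {s} → s ∈ X → s ∈ A ⊎ s ≡ v
        sub s∈X with pendant-centreA c u∈A s∈X
        ... | inj₁ s∈A = inj₁ s∈A
        ... | inj₂ (inj₁ (s≡v , _)) = inj₂ s≡v
        ... | inj₂ (inj₂ (inj₁ (_ , u≡z₁))) = contradiction u≡z₁ (u-alive z₁~y₁)
        ... | inj₂ (inj₂ (inj₂ (_ , u≡z₂))) = contradiction u≡z₂ (u-alive z₂~y₂)
      onB : u ∈ B → ⊥
      onB u∈B = free-drop (size≤p fB) y₁∈B
        (λ y∈X → not-dominator (here refl) (X⊆Y y∈X) refl) sub hasX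
        where
        sub : X ⊆ B
        sub s∈X with pendant-centreB c u∈B s∈X
        ... | inj₁ s∈B = s∈B
        ... | inj₂ (inj₁ (refl , _)) = contradiction s∈X (dead z₁~y₁)
        ... | inj₂ (inj₂ (refl , _)) = contradiction s∈X (dead z₂~y₂)

    -- The hypothesis `w ≢ z₂` keeps `v` and `y₂` from having a common neighbour in `A`. A copy
    -- centred in `A` thus gains at most one vertex against the loss of `z₁` and a neighbour, and a
    -- copy centred in `B` needs the centre `y₂` to gain anything.
    pendant-at-z₁ : w ≢ z₂ → y₁ ≢ y₂ → HasCopy (S ∖ dom (z₁ ∷ [])) → Bad B y₁ y₂
    pendant-at-z₁ w≢z₂ y₁≢y₂ c = pendant-cases c onA onB
      where
      open Centred (centred c)
      z₁∉X : z₁ ∉ X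
      z₁∉X z∈X = not-dominator (here refl) (X⊆Y z∈X) refl
      y₁∉X : y₁ ∉ X
      y₁∉X y∈X = not-dominated (here refl) (X⊆Y y∈X) z₁~y₁
      u≢z₁ : u ≢ z₁
      u≢z₁ = not-dominator (here refl) u∈Y
      onA : u ∈ A → Bad B y₁ y₂
      onA u∈A with neighbour fA z₁∈A | u ≟ w
      ... | z′ , z′∈A , z₁~z′ | u≟w = contradiction hasX (drop u≟w)
        where
        two : ∀ t → (∀ {s} → s ∈ X → s ∈ A ⊎ s ≡ t) → Free X
        two t = free-drop-two t (size≤p fA) z₁∈A z′∈A (~-≢ z₁~z′) z₁∉X
          (λ z′∈X → not-dominated (here refl) (X⊆Y z′∈X) z₁~z′)
        drop : Dec (u ≡ w) → Free X
        drop (yes refl) = two v sub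
          where
          sub : ∀ {s} → s ∈ X → s ∈ A ⊎ s ≡ v
          sub s∈X with pendant-centreA c u∈A s∈X
          ... | inj₁ s∈A = inj₁ s∈A
          ... | inj₂ (inj₁ (s≡v , _)) = inj₂ s≡v
          ... | inj₂ (inj₂ (inj₁ (_ , u≡z₁))) = contradiction u≡z₁ u≢z₁
          ... | inj₂ (inj₂ (inj₂ (_ , u≡z₂))) = contradiction u≡z₂ w≢z₂
        drop (no u≢w) = two y₂ sub
          where
          sub : ∀ {s} → s ∈ X → s ∈ A ⊎ s ≡ y₂
          sub s∈X with pendant-centreA c u∈A s∈X
          ... | inj₁ s∈A = inj₁ s∈A
          ... | inj₂ (inj₁ (_ , u≡w)) = contradiction u≡w u≢w
          ... | inj₂ (inj₂ (inj₁ (_ , u≡z₁))) = contradiction u≡z₁ u≢z₁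
          ... | inj₂ (inj₂ (inj₂ (s≡y₂ , _))) = inj₂ s≡y₂
      onB : u ∈ B → Bad B y₁ y₂
      onB u∈B with u ≟ y₂
      ... | yes refl = survivor⇒bad z₂ fB y₁∈B (disj z₂∈A) y₁∉X hasX sub around only
        where
        sub : ∀ {s} → s ∈ X → s ∈ B ⊎ s ≡ z₂
        sub s∈X with pendant-centreB c u∈B s∈X
        ... | inj₁ s∈B = inj₁ s∈B
        ... | inj₂ (inj₁ (refl , _)) = contradiction s∈X z₁∉X
        ... | inj₂ (inj₂ (s≡z₂ , _)) = inj₂ s≡z₂
        only : ∀ {s} → s ∈ B → s ≢ y₁ → z₂ ~ s → s ≡ u
        only s∈B s≢y₁ z₂~s with onlyAB z₂∈A s∈B z₂~s
        ... | inj₁ (_ , s≡y₁) = contradiction s≡y₁ s≢y₁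
        ... | inj₂ (_ , s≡y₂) = s≡y₂
      ... | no u≢y₂ = contradiction hasX (free-drop (size≤p fB) y₁∈B y₁∉X sub)
        where
        sub : X ⊆ B
        sub s∈X with pendant-centreB c u∈B s∈X
        ... | inj₁ s∈B = s∈B
        ... | inj₂ (inj₁ (refl , _)) = contradiction s∈X z₁∉X
        ... | inj₂ (inj₂ (_ , u≡y₂)) = contradiction u≡y₂ u≢y₂

    -- Dominating `z₁`, which is also the attachment of `v`, cuts off `v`. What a copy centred in
    -- `A` can still gain is `y₂`, and only with centre `z₂`.
    pendant-at-y₁ : w ≡ z₁ → y₁ ≢ y₂ → HasCopy (S ∖ dom (y₁ ∷ [])) → Bad A z₁ z₂
    pendant-at-y₁ refl y₁≢y₂ c = pendant-cases c onA onB
      where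
      open Centred (centred c)
      z₁∉X : z₁ ∉ X
      z₁∉X z∈X = not-dominated (here refl) (X⊆Y z∈X) (~-sym z₁~y₁)
      y₁∉X : y₁ ∉ X
      y₁∉X y∈X = not-dominator (here refl) (X⊆Y y∈X) refl
      u≢z₁ : u ≢ z₁
      u≢z₁ refl = not-dominated (here refl) u∈Y (~-sym z₁~y₁)
      onB : u ∈ B → Bad A z₁ z₂
      onB u∈B with neighbour fB y₁∈B
      ... | y′ , y′∈B , y₁~y′ = contradiction hasX
        (free-drop-two z₂ (size≤p fB) y₁∈B y′∈B (~-≢ y₁~y′) y₁∉X
          (λ y′∈X → not-dominated (here refl) (X⊆Y y′∈X) y₁~y′) sub)
        where
        sub : ∀ {s} → s ∈ X → s ∈ B ⊎ s ≡ z₂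
        sub s∈X with pendant-centreB c u∈B s∈X
        ... | inj₁ s∈B = inj₁ s∈B
        ... | inj₂ (inj₁ (refl , _)) = contradiction s∈X z₁∉X
        ... | inj₂ (inj₂ (s≡z₂ , _)) = inj₂ s≡z₂
      onA : u ∈ A → Bad A z₁ z₂
      onA u∈A with u ≟ z₂
      ... | yes refl = survivor⇒bad y₂ fA z₁∈A (λ y∈A → disj y∈A y₂∈B) z₁∉X hasX sub around only
        where
        sub : ∀ {s} → s ∈ X → s ∈ A ⊎ s ≡ y₂
        sub s∈X with pendant-centreA c u∈A s∈X
        ... | inj₁ s∈A = inj₁ s∈A
        ... | inj₂ (inj₁ (_ , u≡z₁)) = contradiction u≡z₁ u≢z₁
        ... | inj₂ (inj₂ (inj₁ (_ , u≡z₁))) = contradiction u≡z₁ u≢z₁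
        ... | inj₂ (inj₂ (inj₂ (s≡y₂ , _))) = inj₂ s≡y₂
        only : ∀ {s} → s ∈ A → s ≢ z₁ → y₂ ~ s → s ≡ u
        only s∈A s≢z₁ y₂~s with onlyAB s∈A y₂∈B (~-sym y₂~s)
        ... | inj₁ (s≡z₁ , _) = contradiction s≡z₁ s≢z₁
        ... | inj₂ (s≡z₂ , _) = s≡z₂
      ... | no u≢z₂ = contradiction hasX (free-drop (size≤p fA) z₁∈A z₁∉X sub)
        where
        sub : X ⊆ A
        sub s∈X with pendant-centreA c u∈A s∈X
        ... | inj₁ s∈A = s∈A
        ... | inj₂ (inj₁ (_ , u≡z₁)) = contradiction u≡z₁ u≢z₁
        ... | inj₂ (inj₂ (inj₁ (_ , u≡z₁))) = contradiction u≡z₁ u≢z₁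
        ... | inj₂ (inj₂ (inj₂ (_ , u≡z₂))) = contradiction u≡z₂ u≢z₂

    -- Here z₁ = w has the two undominated outer neighbours v and y₁, so only the degree of z₂ helps.
    pendant-at-z₂ : w ≡ z₁ → y₁ ≢ y₂ → Bad A z₁ z₂ → HasCopy (S ∖ dom (z₂ ∷ [])) → Bad B y₂ y₁
    pendant-at-z₂ refl y₁≢y₂ (_ , high) c = pendant-cases c onA onB
      where
      open Centred (centred c)
      z₂∉X : z₂ ∉ X
      z₂∉X z∈X = not-dominator (here refl) (X⊆Y z∈X) refl
      y₂∉X : y₂ ∉ X
      y₂∉X y∈X = not-dominated (here refl) (X⊆Y y∈X) z₂~y₂
      u≢z₂ : u ≢ z₂
      u≢z₂ = not-dominator (here refl) u∈Y
      A′ = A ∖ ⁅ z₂ ⁆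
      A″ = A′ ∖ (A′ ∩ nbr z₂)
      degree : E ⁅ z₂ ⁆ A ≤ size (A′ ∩ nbr z₂)
      degree = ≤-trans (≤-reflexive (E-⁅⁆ z₂ A)) (size-mono {A = A ∩ nbr z₂} λ {s} s∈ →
        ∩⁺ (∖⁺ (∩⁻ˡ s∈) λ s∈z → ~-≢ (holds (∩⁻ʳ {A = A} s∈)) (∈⁅⁆⁻ s∈z)) (∩⁻ʳ {A = A} s∈))
      onA : u ∈ A → Bad B y₂ y₁
      -- The copy avoids `z₂` and all its neighbours in `A` and gains at most `v` and `y₁`. Hence
      -- `z₂` has degree at most one, which `high` does not allow.
      onA u∈A = contradiction high (low-high-degree fA z₂∈A (+-cancelʳ-≤ (suc (size A″)) _ _ (begin
        E ⁅ z₂ ⁆ A + suc (size A″)  ≡⟨ +-suc (E ⁅ z₂ ⁆ A) (size A″) ⟩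
        suc (E ⁅ z₂ ⁆ A + size A″)  ≤⟨ s≤s (+-monoˡ-≤ (size A″) degree) ⟩
        suc (size (A′ ∩ nbr z₂) + size A″)  ≡⟨ cong suc (size-part (part-∖ {S = A′} ∩⁻ˡ)) ⟨
        suc (size A′)  ≡⟨ size-remove z₂∈A ⟨
        size A  ≡⟨ sizeF fA ⟩
        p  ≤⟨ copy-size hasX ⟩
        size X  ≤⟨ size-mono sub ⟩
        size (A″ ∪ ⁅ v ⁆ ∪ ⁅ y₁ ⁆)  ≤⟨ size-∪⁅⁆ (A″ ∪ ⁅ v ⁆) y₁ ⟩
        suc (size (A″ ∪ ⁅ v ⁆))  ≤⟨ s≤s (size-∪⁅⁆ A″ v) ⟩
        1 + suc (size A″)  ∎)))
        where
        open ≤-Reasoning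
        sub : X ⊆ A″ ∪ ⁅ v ⁆ ∪ ⁅ y₁ ⁆
        sub s∈X with pendant-centreA c u∈A s∈X
        ... | inj₂ (inj₁ (refl , _)) = ∪⁺ˡ (∪⁺ʳ {A = A″} ∈⁅⁆)
        ... | inj₂ (inj₂ (inj₁ (refl , _))) = ∪⁺ʳ {A = A″ ∪ ⁅ v ⁆} ∈⁅⁆
        ... | inj₂ (inj₂ (inj₂ (_ , u≡z₂))) = contradiction u≡z₂ u≢z₂
        ... | inj₁ s∈A = ∪⁺ˡ (∪⁺ˡ (∖⁺ (∖⁺ s∈A λ s∈z → z₂∉X (⁅⁆-pull s∈z s∈X))
          λ s∈ → not-dominated (here refl) (X⊆Y s∈X) (holds (∩⁻ʳ {A = A′} s∈))))
      onB : u ∈ B → Bad B y₂ y₁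
      onB u∈B with u ≟ y₁
      ... | yes refl = survivor⇒bad z₁ fB y₂∈B (disj z₁∈A) y₂∉X hasX sub around only
        where
        sub : ∀ {s} → s ∈ X → s ∈ B ⊎ s ≡ z₁
        sub s∈X with pendant-centreB c u∈B s∈X
        ... | inj₁ s∈B = inj₁ s∈B
        ... | inj₂ (inj₁ (s≡z₁ , _)) = inj₂ s≡z₁
        ... | inj₂ (inj₂ (refl , _)) = contradiction s∈X z₂∉X
        only : ∀ {s} → s ∈ B → s ≢ y₂ → z₁ ~ s → s ≡ u
        only s∈B s≢y₂ z₁~s with onlyAB z₁∈A s∈B z₁~s
        ... | inj₁ (_ , s≡y₁) = s≡y₁
        ... | inj₂ (_ , s≡y₂) = contradiction s≡y₂ s≢y₂
      ... | no u≢y₁ = contradiction hasX (free-drop (size≤p fB) y₂∈B y₂∉X sub)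
        where
        sub : X ⊆ B
        sub s∈X with pendant-centreB c u∈B s∈X
        ... | inj₁ s∈B = s∈B
        ... | inj₂ (inj₁ (_ , u≡y₁)) = contradiction u≡y₁ u≢y₁
        ... | inj₂ (inj₂ (refl , _)) = contradiction s∈X z₂∉X

  -- Three choices are played against each other: failure of `y₁` gives `z₂` a high degree, with
  -- which failure of `z₂` yields the bad pair in `B` opposite to the one from `z₁`.
  pendant-at-root : ∀ {S A B v w z₁ y₁ z₂ y₂} → Pendant S A B v w z₁ y₁ z₂ y₂ →
    w ≡ z₁ → y₁ ≢ y₂ → SingleClears S
  pendant-at-root {S} {z₁ = z₁} {y₁} {z₂} {y₂} P w≡z₁ y₁≢y₂
    with single-or-copy S z₁ | single-or-copy S y₁ | single-or-copy S z₂
  ... | inj₁ done | _ | _ = done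
  ... | _ | inj₁ done | _ = done
  ... | _ | _ | inj₁ done = done
  ... | inj₂ c₁ | inj₂ c₂ | inj₂ c₃ = contradiction
    (pendant-at-z₂ P w≡z₁ y₁≢y₂ (pendant-at-y₁ P w≡z₁ y₁≢y₂ c₂) c₃)
    (bad-asym {u = y₂} (Pendant.fB P) (Pendant.y₁∈B P)
      (pendant-at-z₁ P (Pendant.z₁≢z₂ P ∘ trans (≡-sym w≡z₁)) y₁≢y₂ c₁))

  pendant-clears : ∀ {S A B v w z₁ y₁ z₂ y₂} → Pendant S A B v w z₁ y₁ z₂ y₂ → SingleClears S
  pendant-clears {S} {A} {B} {v} {w} {z₁} {y₁} {z₂} {y₂} P with y₁ ≟ y₂
  ... | yes y₁≡y₂ = y₁ , pendant-merged P y₁≡y₂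
  ... | no y₁≢y₂ with w ≟ z₁ | w ≟ z₂
  ...   | yes w≡z₁ | _ = pendant-at-root P w≡z₁ y₁≢y₂
  ...   | _ | yes w≡z₂ = pendant-at-root (pendant-swap P) w≡z₂ (y₁≢y₂ ∘ ≡-sym)
  ...   | no w≢z₁ | no w≢z₂ with single-or-copy S z₁ | single-or-copy S z₂
  ...     | inj₁ done | _ = done
  ...     | _ | inj₁ done = done
  ...     | inj₂ c₁ | inj₂ c₂ = contradiction
    (pendant-at-z₁ (pendant-swap P) w≢z₁ (y₁≢y₂ ∘ ≡-sym) c₂)
    (bad-asym {u = y₂} (Pendant.fB P) (Pendant.y₁∈B P) (pendant-at-z₁ P w≢z₂ y₁≢y₂ c₁))

  record Double (S A₁ A₂ B : Sub n) (v₁ w₁ z₁ y₁ v₂ w₂ z₂ y₂ : Fin n) : Set where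
    field
      covers : ∀ {s} → s ∈ S → s ≡ v₁ ⊎ s ∈ A₁ ⊎ s ≡ v₂ ⊎ s ∈ A₂ ⊎ s ∈ B
      fA₁    : FType A₁
      fA₂    : FType A₂
      fB     : FType B
      only₁  : ∀ {s} → s ∈ A₁ → v₁ ~ s → s ≡ w₁
      only₂  : ∀ {s} → s ∈ A₂ → v₂ ~ s → s ≡ w₂
      w₁∈A₁  : w₁ ∈ A₁
      w₂∈A₂  : w₂ ∈ A₂
      apart  : NoEdge A₁ A₂
      v₁A₂   : ∀ {s} → s ∈ A₂ → ¬ v₁ ~ s
      v₂A₁   : ∀ {s} → s ∈ A₁ → ¬ v₂ ~ s
      v₁B    : ∀ {s} → s ∈ B → ¬ v₁ ~ s
      v₂B    : ∀ {s} → s ∈ B → ¬ v₂ ~ s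
      z₁∈A₁  : z₁ ∈ A₁
      z₂∈A₂  : z₂ ∈ A₂
      y₁∈B   : y₁ ∈ B
      y₂∈B   : y₂ ∈ B
      z₁~y₁  : z₁ ~ y₁
      z₂~y₂  : z₂ ~ y₂
      onlyB₁ : ∀ {s t} → s ∈ A₁ → t ∈ B → s ~ t → s ≡ z₁ × t ≡ y₁
      onlyB₂ : ∀ {s t} → s ∈ A₂ → t ∈ B → s ~ t → s ≡ z₂ × t ≡ y₂

  double-swap : ∀ {S A₁ A₂ B v₁ w₁ z₁ y₁ v₂ w₂ z₂ y₂} →
    Double S A₁ A₂ B v₁ w₁ z₁ y₁ v₂ w₂ z₂ y₂ → Double S A₂ A₁ B v₂ w₂ z₂ y₂ v₁ w₁ z₁ y₁
  double-swap P = record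
    { covers = λ s∈S → case covers s∈S of λ
      { (inj₁ p) → inj₂ (inj₂ (inj₁ p)) ; (inj₂ (inj₁ p)) → inj₂ (inj₂ (inj₂ (inj₁ p)))
      ; (inj₂ (inj₂ (inj₁ p))) → inj₁ p ; (inj₂ (inj₂ (inj₂ (inj₁ p)))) → inj₂ (inj₁ p)
      ; (inj₂ (inj₂ (inj₂ (inj₂ p)))) → inj₂ (inj₂ (inj₂ (inj₂ p))) }
    ; fA₁ = fA₂ ; fA₂ = fA₁ ; fB = fB ; only₁ = only₂ ; only₂ = only₁ ; w₁∈A₁ = w₂∈A₂ ; w₂∈A₂ = w₁∈A₁
    ; apart = λ a b a~b → apart b a (~-sym a~b) ; v₁A₂ = v₂A₁ ; v₂A₁ = v₁A₂ ; v₁B = v₂B ; v₂B = v₁B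
    ; z₁∈A₁ = z₂∈A₂ ; z₂∈A₂ = z₁∈A₁ ; y₁∈B = y₂∈B ; y₂∈B = y₁∈B ; z₁~y₁ = z₂~y₂ ; z₂~y₂ = z₁~y₁
    ; onlyB₁ = onlyB₂ ; onlyB₂ = onlyB₁ }
    where open Double P

  -- A copy centred at `v₁` has only `w₁` and `v₂` to use, and these are not adjacent. One centred
  -- in `A₁` loses `z₁` and a neighbour and gains only `v₁`, since the way into `B` leads through
  -- `z₁`.
  double-half : ∀ {S A₁ A₂ B v₁ w₁ z₁ y₁ v₂ w₂ z₂ y₂ D} → Double S A₁ A₂ B v₁ w₁ z₁ y₁ v₂ w₂ z₂ y₂ →
    z₁ ∈ˡ D → (c : HasCopy (S ∖ dom D)) → ¬ (Centred.u (centred c) ≡ v₁ ⊎ Centred.u (centred c) ∈ A₁)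
  double-half {A₁ = A₁} {v₁ = v₁} {w₁} {z₁} {v₂ = v₂} P z₁∈D c = go
    where
    open Double P
    open Centred (centred c)
    go : ¬ (u ≡ v₁ ⊎ u ∈ A₁)
    go (inj₁ refl) = free-path v₁ w₁ v₂ sub (λ _ _ w₁~v₂ → v₂A₁ w₁∈A₁ (~-sym w₁~v₂)) hasX
      where
      sub : ∀ {s} → s ∈ X → s ≡ v₁ ⊎ (s ≡ w₁ ⊎ s ≡ v₂)
      sub s∈X with around s∈X | covers (∖⁻ˡ (X⊆Y s∈X))
      ... | inj₁ s≡v | _ = inj₁ s≡v
      ... | _ | inj₁ s≡v = inj₁ s≡v
      ... | inj₂ v~s | inj₂ (inj₁ s∈) = inj₂ (inj₁ (only₁ s∈ v~s))
      ... | _ | inj₂ (inj₂ (inj₁ s≡v₂)) = inj₂ (inj₂ s≡v₂)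
      ... | inj₂ v~s | inj₂ (inj₂ (inj₂ (inj₁ s∈))) = contradiction v~s (v₁A₂ s∈)
      ... | inj₂ v~s | inj₂ (inj₂ (inj₂ (inj₂ s∈))) = contradiction v~s (v₁B s∈)
    go (inj₂ u∈A₁) with neighbour fA₁ z₁∈A₁
    ... | z′ , z′∈ , z~z′ = free-drop-two v₁ (size≤p fA₁) z₁∈A₁ z′∈ (~-≢ z~z′)
      (λ z∈X → not-dominator z₁∈D (X⊆Y z∈X) refl) (λ z′∈X → not-dominated z₁∈D (X⊆Y z′∈X) z~z′) sub hasX
      where
      sub : ∀ {s} → s ∈ X → s ∈ A₁ ⊎ s ≡ v₁
      sub s∈X with around s∈X | covers (∖⁻ˡ (X⊆Y s∈X))
      ... | inj₁ refl | _ = inj₁ u∈A₁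
      ... | _ | inj₁ s≡v₁ = inj₂ s≡v₁
      ... | _ | inj₂ (inj₁ s∈) = inj₁ s∈
      ... | inj₂ u~s | inj₂ (inj₂ (inj₁ refl)) = contradiction (~-sym u~s) (v₂A₁ u∈A₁)
      ... | inj₂ u~s | inj₂ (inj₂ (inj₂ (inj₁ s∈))) = contradiction u~s (apart u∈A₁ s∈)
      ... | inj₂ u~s | inj₂ (inj₂ (inj₂ (inj₂ s∈))) =
        contradiction (proj₁ (onlyB₁ u∈A₁ s∈ u~s)) (not-dominator z₁∈D u∈Y)

  -- Every edge into `B` starts at a chosen vertex, so a copy centred in `B` gains nothing and loses
  -- `y₁`. The other centres fall to `double-half` by symmetry.
  double-clears : ∀ {S A₁ A₂ B v₁ w₁ z₁ y₁ v₂ w₂ z₂ y₂} →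
    Double S A₁ A₂ B v₁ w₁ z₁ y₁ v₂ w₂ z₂ y₂ → Clear S (z₁ ∷ z₂ ∷ [])
  double-clears {S} {A₁} {A₂} {B} {v₁} {w₁} {z₁} {y₁} {v₂} {w₂} {z₂} {y₂} P c = go (covers (∖⁻ˡ u∈Y))
    where
    open Double P
    open Centred (centred c)
    1st : z₁ ∈ˡ z₁ ∷ z₂ ∷ []
    1st = here refl
    2nd : z₂ ∈ˡ z₁ ∷ z₂ ∷ []
    2nd = there (here refl)
    go : u ≡ v₁ ⊎ u ∈ A₁ ⊎ u ≡ v₂ ⊎ u ∈ A₂ ⊎ u ∈ B → ⊥
    go (inj₁ u≡v₁) = double-half P 1st c (inj₁ u≡v₁)
    go (inj₂ (inj₁ u∈A₁)) = double-half P 1st c (inj₂ u∈A₁)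
    go (inj₂ (inj₂ (inj₁ u≡v₂))) = double-half (double-swap P) 2nd c (inj₁ u≡v₂)
    go (inj₂ (inj₂ (inj₂ (inj₁ u∈A₂)))) = double-half (double-swap P) 2nd c (inj₂ u∈A₂)
    go (inj₂ (inj₂ (inj₂ (inj₂ u∈B)))) = free-drop (size≤p fB) y₁∈B
      (λ y∈X → not-dominated 1st (X⊆Y y∈X) z₁~y₁) sub hasX
      where
      sub : X ⊆ B
      sub s∈X with around s∈X | covers (∖⁻ˡ (X⊆Y s∈X))
      ... | inj₁ refl | _ = u∈B
      ... | inj₂ u~s | inj₁ refl = contradiction (~-sym u~s) (v₁B u∈B)
      ... | inj₂ u~s | inj₂ (inj₁ s∈) =
        contradiction (proj₁ (onlyB₁ s∈ u∈B (~-sym u~s))) (not-dominator 1st (X⊆Y s∈X))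
      ... | inj₂ u~s | inj₂ (inj₂ (inj₁ refl)) = contradiction (~-sym u~s) (v₂B u∈B)
      ... | inj₂ u~s | inj₂ (inj₂ (inj₂ (inj₁ s∈))) =
        contradiction (proj₁ (onlyB₂ s∈ u∈B (~-sym u~s))) (not-dominator 2nd (X⊆Y s∈X))
      ... | _ | inj₂ (inj₂ (inj₂ (inj₂ s∈))) = s∈

  -- Tight graphs

  -- The number of edges that has to pay for the listed vertices; polymorphic because lists of
  -- constituents are priced too.
  cost : ∀ {A : Set} → List A → ℕ
  cost D = length D * (k + 2)

  k+2+0 : ∀ k → k + 2 + 0 ≡ 2 + k
  k+2+0 = solve-∀

  cost-++ : ∀ {A : Set} (D₁ D₂ : List A) → cost (D₁ ++ D₂) ≡ cost D₁ + cost D₂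
  cost-++ D₁ D₂ = trans (cong (_* (k + 2)) (length-++ D₁)) (*-distribʳ-+ (k + 2) (length D₁) (length D₂))

  centre : ∀ {S} → size S ≡ p → HasCopy S → ∃ λ c → c ∈ S × (∀ {s} → s ∈ S → s ≡ c ⊎ c ~ s)
  centre {S} |S| c = u , u∈Y , λ {s} s∈S → case s ∈? X of λ
    { (yes s∈X) → around s∈X
    ; (no s∉X) → contradiction hasX (free-drop (≤-reflexive |S|) s∈S s∉X X⊆Y) }
    where open Centred (centred c)

  ftype : ∀ {S} → size S ≡ p → e S ≡ k → HasCopy S → FType S
  ftype |S| eS c = record { sizeF = |S| ; edgeF = eS ; copyF = c
    ; connF = let (_ , u∈S , star) = centre |S| c in conn-star u∈S star }

  clear-union : ∀ {S C₁ C₂ D} → (∀ {s} → s ∈ S → s ∈ dom D ⊎ s ∈ C₁ ⊎ s ∈ C₂) → NoEdge C₁ C₂ →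
    Clear C₁ D → Clear C₂ D → Clear S D
  clear-union {S} {C₁} {C₂} {D} cover apart = free-union split λ a b → apart (∖⁻ˡ a) (∖⁻ˡ b)
    where
    split : ∀ {s} → s ∈ S ∖ dom D → s ∈ C₁ ∖ dom D ⊎ s ∈ C₂ ∖ dom D
    split s∈ with cover (∖⁻ˡ s∈)
    ... | inj₁ s∈D = contradiction s∈D (∖⁻ʳ {A = S} s∈)
    ... | inj₂ (inj₁ s∈C₁) = inj₁ (∖⁺ s∈C₁ (∖⁻ʳ {A = S} s∈))
    ... | inj₂ (inj₂ s∈C₂) = inj₂ (∖⁺ s∈C₂ (∖⁻ʳ {A = S} s∈))

  clear-++ˡ : ∀ {C x} D₁ D₂ → Clear C (x ∷ D₁) → Clear C (x ∷ D₁ ++ D₂)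
  clear-++ˡ _ _ = clear-mono λ { (here refl) → here refl ; (there d∈) → there (∈-++⁺ˡ d∈) }

  clear-++ʳ : ∀ {C x} D₁ D₂ → Clear C (x ∷ D₂) → Clear C (x ∷ D₁ ++ D₂)
  clear-++ʳ D₁ _ = clear-mono λ { (here refl) → here refl ; (there d∈) → there (∈-++⁺ʳ D₁ d∈) }

  -- An F-constituent: its F-connection v together with the vertex set A of its copy of F.
  Piece : Set
  Piece = Fin n × Sub n

  record Constituent (S : Sub n) (v : Fin n) (A : Sub n) : Set where
    field
      fA      : FType A
      v∈S     : v ∈ S
      A⊆S     : A ⊆ S
      v∉A     : v ∉ A
      oneEdge : E ⁅ v ⁆ A ≡ 1
      closed  : ∀ {a s} → a ∈ A → s ∈ S → a ~ s → s ≡ v ⊎ s ∈ A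

  Disjoint : Piece → Piece → Set
  Disjoint (v , A) (v′ , A′) = v ≢ v′ × v ∉ A′ × v′ ∉ A × (∀ {x} → x ∈ A → x ∉ A′)

  disjoint-sym : ∀ {c d} → Disjoint c d → Disjoint d c
  disjoint-sym (p , q , r , s) = p ∘ ≡-sym , r , q , λ x∈ x∈′ → s x∈′ x∈

  -- `S` is the graph in which the constituents are closed and `B` the part that they partition. The
  -- two differ while the components left by a deleted vertex are being collected.
  record Spec (S B : Sub n) (L : List Piece) : Set where
    field
      each  : ∀ {v A} → (v , A) ∈ˡ L → Constituent S v A × v ∈ B × A ⊆ B
      cover : ∀ {y} → y ∈ B → ∃ λ v → ∃ λ A → (v , A) ∈ˡ L × (y ≡ v ⊎ y ∈ A)
      apart : AllPairs Disjoint L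

  -- No tree is recorded in `special`. Each constituent owns `k + 1` edges, so the cost equation
  -- leaves one edge fewer than there are connections, and a connected quotient with so few edges is
  -- a tree.
  data Tight (S : Sub n) : Set where
    nearly  : size S ≡ p → e S ≡ suc k → HasCopy S → Tight S
    special : ∀ L → Spec S S L → cost L ≡ suc (e S) → Tight S

  Loose : Sub n → Set
  Loose S = ∃ λ D → Clear S D × cost D ≤ e S

  data Outcome (S : Sub n) : Set where
    isF   : FType S → Outcome S
    tight : Tight S → Outcome S
    loose : Loose S → Outcome S

  select : ∀ {L c} → AllPairs Disjoint L → c ∈ˡ L → ∃ λ L′ → length L ≡ suc (length L′)
    × (∀ {d} → d ∈ˡ L → d ≡ c ⊎ d ∈ˡ L′) × (∀ {d} → d ∈ˡ L′ → d ∈ˡ L × Disjoint c d)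
  select {c ∷ L} (c# ∷ _) (here refl) = L , refl
    , (λ { (here refl) → inj₁ refl ; (there d∈) → inj₂ d∈ })
    , λ d∈ → there d∈ , All.lookup c# d∈
  select {d ∷ L} (d# ∷ L#) (there c∈) with select L# c∈
  ... | L′ , len , cover , back = d ∷ L′ , cong suc len
    , (λ { (here refl) → inj₂ (here refl)
         ; (there x∈) → case cover x∈ of λ { (inj₁ x≡) → inj₁ x≡ ; (inj₂ x∈′) → inj₂ (there x∈′) } })
    , λ { (here refl) → here refl , disjoint-sym (All.lookup d# c∈)
        ; (there x∈) → there (proj₁ (back x∈)) , proj₂ (back x∈) }

  connections : List Piece → List (Fin n)
  connections = map proj₁

  cost-connections : ∀ L → cost (connections L) ≡ cost L
  cost-connections L = cong (_* (k + 2)) (length-map proj₁ L)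

  attachment : ∀ {S v A} → Constituent S v A → ∃ λ w → w ∈ A × v ~ w
  attachment {v = v} {A} con with find-edge {⁅ v ⁆} {A} (≤-reflexive (≡-sym (Constituent.oneEdge con)))
  ... | v′ , w , v∈ , w∈A , v~w with ∈⁅⁆⁻ v∈
  ...   | refl = w , w∈A , v~w

  -- Without the connections a copy is confined to a single constituent copy, where one missing
  -- vertex is fatal.
  spec-free : ∀ {S Y L} → Spec S S L → Y ⊆ S →
    (∀ {v A} → (v , A) ∈ˡ L → v ∉ Y × ∃ λ a → a ∈ A × a ∉ Y) → Free Y
  spec-free {S} {Y} {L} spec Y⊆S hit c = go (cover (Y⊆S u∈Y))
    where
    open Spec spec
    open Centred (centred c)
    go : (∃ λ v → ∃ λ A → (v , A) ∈ˡ L × (u ≡ v ⊎ u ∈ A)) → ⊥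
    go (v , A , vA∈L , inj₁ refl) = proj₁ (hit vA∈L) u∈Y
    go (v , A , vA∈L , inj₂ u∈A) with hit vA∈L
    ... | v∉Y , a , a∈A , a∉Y = free-drop (size≤p fA) a∈A (a∉Y ∘ X⊆Y) sub hasX
      where
      open Constituent (proj₁ (each vA∈L))
      sub : X ⊆ A
      sub s∈X with around s∈X
      ... | inj₁ refl = u∈A
      ... | inj₂ u~s with closed u∈A (Y⊆S (X⊆Y s∈X)) u~s
      ...   | inj₁ refl = contradiction (X⊆Y s∈X) v∉Y
      ...   | inj₂ s∈A = s∈A

  spec-clear : ∀ {S L} → Spec S S L → Clear S (connections L)
  spec-clear {S} {L} spec = spec-free spec ∖⁻ˡ λ vA∈L →
    let (w , w∈A , v~w) = attachment (proj₁ (Spec.each spec vA∈L)) in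
    (λ v∈ → not-dominator (∈-map⁺ proj₁ vA∈L) v∈ refl) ,
    w , w∈A , λ w∈ → not-dominated (∈-map⁺ proj₁ vA∈L) w∈ v~w

  tight-clear : ∀ {S} → Tight S → ∃ λ D → Clear S D × cost D ≡ suc (e S)
  tight-clear {S} (nearly |S| eS c) with copy-centre c
  ... | u , u∈S , _ = u ∷ [] , free-drop (≤-reflexive |S|) u∈S (λ u∈ → not-dominator (here refl) u∈ refl) ∖⁻ˡ ,
    trans (k+2+0 k) (cong suc (≡-sym eS))
  tight-clear (special L spec eq) = connections L , spec-clear spec , trans (cost-connections L) eq

  -- In the `reducible` case `C` has the price of `x` in its own budget, up to one edge, and any
  -- edge from `x` to `C` supplies that.
  data Normal (x : Fin n) (C : Sub n) : Set where
    reducible : ∀ D → Clear C (x ∷ D) → cost D + (k + 2) ≤ suc (e C) → Normal x C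
    hinged    : ∀ L → Spec C C L → cost L ≡ suc (e C) →
                (∀ {v A a} → (v , A) ∈ˡ L → a ∈ A → ¬ x ~ a) → Normal x C

  -- With a single constituent, if x leaves a copy of F alive, then its only neighbour a ∈ C is
  -- a pendant vertex of C, which may serve as the connection instead.
  normalise-one : ∀ {x C v A a} → Conn C → Spec C C ((v , A) ∷ []) → e C ≡ suc k → a ∈ C → x ~ a → Normal x C
  normalise-one {x} {C} {v} {A} {a} conn spec eC a∈C x~a with HasCopy? (C ∖ dom (x ∷ []))
  ... | no ¬c = reducible [] ¬c (≤-reflexive (trans (+-comm k 2) (cong suc (≡-sym eC))))
  ... | yes c = hinged ((a , X) ∷ []) spec′ (trans (k+2+0 k) (cong suc (≡-sym eC)))
        (λ { (here refl) s∈X x~s → free-drop (≤-reflexive |X|) s∈X (λ s∈ → not-dominated (here refl) s∈ x~s) alive⊆X c })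
    where
    open Spec spec
    X = C ∖ ⁅ a ⁆
    alive⊆X : C ∖ dom (x ∷ []) ⊆ X
    alive⊆X s∈ = ∖⁺ (∖⁻ˡ s∈) λ s∈a → not-dominated (here refl) s∈ (subst (x ~_) (∈⁅⁆⁻ s∈a) x~a)
    cX : HasCopy X
    cX = copy-mono alive⊆X c
    sub : C ⊆ A ∪ ⁅ v ⁆
    sub s∈C with cover s∈C
    ... | _ , _ , here refl , inj₁ refl = ∪⁺ʳ {A = A} ∈⁅⁆
    ... | _ , _ , here refl , inj₂ s∈A = ∪⁺ˡ s∈A
    |X| : size X ≡ p
    |X| = ≤-antisym (+-cancelˡ-≤ 1 _ _ (begin
      suc (size X)  ≡⟨ size-remove a∈C ⟨
      size C  ≤⟨ size-mono sub ⟩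
      size (A ∪ ⁅ v ⁆)  ≤⟨ size-∪⁅⁆ A v ⟩
      suc (size A)  ≡⟨ cong suc (sizeF (Constituent.fA (proj₁ (each (here refl))))) ⟩
      suc p  ∎)) (copy-size cX)
      where open ≤-Reasoning
    degree : 1 ≤ E ⁅ a ⁆ X
    degree with conn-nbr conn a∈C (≤-trans (s≤s (member⇒size (proj₁ (proj₂ (copy-centre cX)))))
                                           (≤-reflexive (≡-sym (size-remove a∈C))))
    ... | b , b∈C , a~b = E-positive ∈⁅⁆ (∖⁺ b∈C (~-≢ a~b ∘ ∈⁅⁆⁻)) a~b
    total : e X + E ⁅ a ⁆ X ≡ suc k
    total = trans (≡-sym (e-remove a∈C)) eC
    eX : e X ≡ k
    eX = ≤-antisym (+-cancelʳ-≤ 1 _ _ (≤-trans (+-monoʳ-≤ (e X) degree)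
      (≤-reflexive (trans total (+-comm 1 k))))) (copy-edges cX)
    spec′ : Spec C C ((a , X) ∷ [])
    spec′ = record
      { each = λ { (here refl) → record
          { fA = ftype |X| eX cX ; v∈S = a∈C ; A⊆S = ∖⁻ˡ ; v∉A = λ a∈ → ∖⁻ʳ a∈ ∈⁅⁆
          ; oneEdge = +-cancelˡ-≡ k _ _ (trans (cong (_+ E ⁅ a ⁆ X) (≡-sym eX)) (trans total (+-comm 1 k)))
          ; closed = λ _ s∈C _ → split s∈C } , a∈C , ∖⁻ˡ }
      ; cover = λ y∈C → a , X , here refl , split y∈C
      ; apart = All.[] ∷ [] }
      where
      split : ∀ {s} → s ∈ C → s ≡ a ⊎ s ∈ X
      split {s} s∈C with s ≟ a
      ... | yes s≡a = inj₁ s≡a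
      ... | no s≢a = inj₂ (∖⁺ s∈C (s≢a ∘ ≡-sym ∘ ∈⁅⁆⁻))

  -- An edge leaving `A` together with `v` must start at `v`, because `A` is closed, and must end at
  -- a connection, because the other copies are closed.
  spec-neighbour : ∀ {C L v A L′} → Conn C → Spec C C L → (v , A) ∈ˡ L → 1 ≤ length L′ →
    (∀ {d} → d ∈ˡ L → d ≡ (v , A) ⊎ d ∈ˡ L′) → (∀ {d} → d ∈ˡ L′ → d ∈ˡ L × Disjoint (v , A) d) →
    ∃ λ v′ → v′ ∈ˡ connections L′ × v ~ v′
  spec-neighbour {C} {L} {v} {A} {(v₀ , A₀) ∷ L₀} conn spec vA∈L _ split back
    with cut conn (A ∪ ⁅ v ⁆) {v} {v₀} (Constituent.v∈S con) (∪⁺ʳ {A = A} ∈⁅⁆)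
      (Constituent.v∈S (proj₁ (Spec.each spec (proj₁ (back (here refl))))))
      (λ v₀∈ → case ∪⁻ {A = A} v₀∈ of λ
        { (inj₁ v₀∈A) → proj₁ (proj₂ (proj₂ (proj₂ (back (here refl))))) v₀∈A
        ; (inj₂ v₀∈v) → proj₁ (proj₂ (back (here refl))) (∈⁅⁆⁻ v₀∈v) })
    where
    con = proj₁ (Spec.each spec vA∈L)
  ... | s , t , (s∈C , s∈) , (t∈C , t∉) , s~t with ∪⁻ {A = A} s∈
  ...   | inj₁ s∈A = case Constituent.closed (proj₁ (Spec.each spec vA∈L)) s∈A t∈C s~t of λ
    { (inj₁ refl) → contradiction (∪⁺ʳ {A = A} ∈⁅⁆) t∉ ; (inj₂ t∈A) → contradiction (∪⁺ˡ t∈A) t∉ }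
  ...   | inj₂ s∈v with ∈⁅⁆⁻ s∈v | Spec.cover spec t∈C
  ...     | refl | v′ , A′ , d∈L , t∈ with split d∈L
  ...       | inj₁ refl = contradiction
    ([ (λ { refl → ∪⁺ʳ {A = A} ∈⁅⁆ }) , ∪⁺ˡ ]′ t∈) t∉
  ...       | inj₂ d∈L′ with back d∈L′ | t∈
  ...         | _ | inj₁ refl = v′ , ∈-map⁺ proj₁ d∈L′ , s~t
  ...         | _ , v≢v′ , v∉A′ , _ | inj₂ t∈A′ =
    case Constituent.closed (proj₁ (Spec.each spec d∈L)) t∈A′ s∈C (~-sym s~t) of λ
      { (inj₁ v≡v′) → contradiction v≡v′ v≢v′ ; (inj₂ v∈A′) → contradiction v∈A′ v∉A′ }

  normalise : ∀ {x C y} → Conn C → Tight C → y ∈ C → x ~ y → Normal x C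
  normalise {x} {C} conn (nearly |C| eC c) y∈C x~y = reducible []
    (free-drop (≤-reflexive |C|) y∈C (λ y∈ → not-dominated (here refl) y∈ x~y) ∖⁻ˡ)
    (≤-reflexive (trans (+-comm k 2) (cong suc (≡-sym eC))))
  normalise {x} {C} conn (special L spec eq) y∈C x~y
    with Any.any? (λ (v , A) → any? λ a → (a ∈? A) ×-dec (x ~? a)) L
  ... | no none = hinged L spec eq λ vA∈L a∈A x~a → none (lose vA∈L (_ , a∈A , x~a))
  ... | yes some with find some
  ...   | (v , A) , vA∈L , a , a∈A , x~a with select (Spec.apart spec) vA∈L
  ...     | [] , len , split , back = one L len spec vA∈L eq
    where
    one : ∀ L → length L ≡ 1 → Spec C C L → (v , A) ∈ˡ L → cost L ≡ suc (e C) → Normal x C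
    one (_ ∷ []) refl spec (here refl) eq = normalise-one conn spec
      (+-cancelˡ-≡ 1 _ _ (trans (≡-sym eq) (k+2+0 k))) (Constituent.A⊆S (proj₁ (Spec.each spec (here refl))) a∈A) x~a
  ...     | L′@(_ ∷ _) , len , split , back = reducible (connections L′)
    (spec-free spec ∖⁻ˡ hit) (≤-reflexive (begin
      cost (connections L′) + (k + 2)  ≡⟨ cong (_+ (k + 2)) (cost-connections L′) ⟩
      cost L′ + (k + 2)  ≡⟨ +-comm (cost L′) (k + 2) ⟩
      suc (length L′) * (k + 2)  ≡⟨ cong (_* (k + 2)) len ⟨
      cost L  ≡⟨ eq ⟩
      suc (e C)  ∎))
    where
    open ≡-Reasoning
    hit : ∀ {v′ A′} → (v′ , A′) ∈ˡ L → v′ ∉ C ∖ dom (x ∷ connections L′)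
        × ∃ λ a → a ∈ A′ × a ∉ C ∖ dom (x ∷ connections L′)
    hit d∈L with split d∈L
    ... | inj₂ d∈L′ = let (w , w∈A , v~w) = attachment (proj₁ (Spec.each spec d∈L)) in
      (λ v∈ → not-dominator (there (∈-map⁺ proj₁ d∈L′)) v∈ refl) ,
      w , w∈A , λ w∈ → not-dominated (there (∈-map⁺ proj₁ d∈L′)) w∈ v~w
    ... | inj₁ refl = let (v′ , v′∈ , v~v′) = spec-neighbour conn spec vA∈L (s≤s z≤n) split back in
      (λ v∈ → not-dominated (there v′∈) v∈ (~-sym v~v′)) ,
      a , a∈A , λ a∈ → not-dominated (here refl) a∈ x~a

  -- Deleting a vertex

  -- `C` behaves as a union of components of `S` after the deletion of `K`.
  Off : Sub n → Sub n → Sub n → Set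
  Off S K C = ∀ {a s} → a ∈ C → s ∈ S → a ~ s → s ∈ K ⊎ s ∈ C

  attach : ∀ {S K C x} → Conn S → Conn C → C ⊆ S → x ∈ S → x ∉ C → Off S K C →
    ∃ λ y → ∃ λ z → y ∈ C × z ∈ K × z ~ y
  attach {C = C} conn connC C⊆S x∈S x∉C off with nonempty connC
  ... | c , c∈C with cut conn C (C⊆S c∈C) c∈C x∈S x∉C
  ...   | s , t , (_ , s∈C) , (t∈S , t∉C) , s~t with off s∈C t∈S s~t
  ...     | inj₁ t∈K = s , t , s∈C , t∈K , ~-sym s~t
  ...     | inj₂ t∈C = contradiction t∈C t∉C

  attach-⁅⁆ : ∀ {S C x} → Conn S → Conn C → C ⊆ S → x ∈ S → x ∉ C → Off S ⁅ x ⁆ C →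
    ∃ λ y → y ∈ C × x ~ y
  attach-⁅⁆ conn connC C⊆S x∈S x∉C off with attach conn connC C⊆S x∈S x∉C off
  ... | y , z , y∈C , z∈x , z~y with ∈⁅⁆⁻ z∈x
  ...   | refl = y , y∈C , z~y

  off-head : ∀ {S K B C} → Off S K B → C ⊆ B → NoEdge C (B ∖ C) → Off S K C
  off-head {C = C} off C⊆B apart {s = s} a∈C s∈S a~s with off (C⊆B a∈C) s∈S a~s | s ∈? C
  ... | inj₁ s∈K | _ = inj₁ s∈K
  ... | inj₂ s∈B | yes s∈C = inj₂ s∈C
  ... | inj₂ s∈B | no s∉C = contradiction a~s (apart a∈C (∖⁺ s∈B s∉C))

  off-tail : ∀ {S K B C} → Off S K B → NoEdge C (B ∖ C) → Off S K (B ∖ C)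
  off-tail {C = C} off apart {s = s} a∈ s∈S a~s with off (∖⁻ˡ a∈) s∈S a~s | s ∈? C
  ... | inj₁ s∈K | _ = inj₁ s∈K
  ... | inj₂ s∈B | yes s∈C = contradiction (~-sym a~s) (apart s∈C a∈)
  ... | inj₂ s∈B | no s∉C = inj₂ (∖⁺ s∈B s∉C)

  off-complement : ∀ {S K C} → Off S K C → Off S K (S ∖ K ∖ C)
  off-complement {S} {K} {C} off {s = s} a∈ s∈S a~s with s ∈? K | s ∈? C
  ... | yes s∈K | _ = inj₁ s∈K
  ... | no s∉K | no s∉C = inj₂ (∖⁺ (∖⁺ s∈S s∉K) s∉C)
  ... | no s∉K | yes s∈C with off s∈C (∖⁻ˡ (∖⁻ˡ a∈)) (~-sym a~s)
  ...   | inj₁ a∈K = contradiction a∈K (∖⁻ʳ {A = S} (∖⁻ˡ a∈))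
  ...   | inj₂ a∈C = contradiction a∈C (∖⁻ʳ a∈)

  IH : Sub n → Set
  IH S = ∀ C → size C < size S → Conn C → Outcome C

  clear-all : ∀ {C} → (∀ {s} → s ∉ C) → ∀ D → Clear C D
  clear-all empty D c = let (_ , u∈ , _) = copy-centre c in empty (∖⁻ˡ u∈)

  count-part : ∀ {S A B} K → Part S A B → NoEdge A B → e S + E K S ≡ (e A + E K A) + (e B + E K B)
  count-part {S} {A} {B} K π none = trans
    (cong₂ _+_ (trans (e-part π) (cong (e A + e B +_) (NoEdge⇒E none))) (E-splitʳ K π))
    (arrange (e A) (e B) (E K A) (E K B))
    where
    arrange : ∀ a b c d → a + b + 0 + (c + d) ≡ a + c + (b + d)
    arrange = solve-∀

  module AtVertex {S : Sub n} (connS : Conn S) (ih : IH S) {x : Fin n} (x∈S : x ∈ S) where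

    -- The vertex `x` is paid for elsewhere and the edges from `x` to `B` are credited to `B`. At
    -- least one edge is left over.
    Gain : Sub n → Set
    Gain B = ∃ λ D → Clear B (x ∷ D) × suc (cost D) ≤ e B + E ⁅ x ⁆ B

    -- Nothing needs to be left over, so the constituents are kept: they become part of a pure
    -- special structure on `S` if no gain turns up anywhere.
    Exact : Sub n → Set
    Exact B = ∃ λ L → Spec S B L × Clear B (x ∷ connections L) × cost L ≡ e B + E ⁅ x ⁆ B

    ftype-clear : ∀ {C y} → FType C → y ∈ C → x ~ y → ∀ D → Clear C (x ∷ D)
    ftype-clear fC y∈C x~y D = free-drop (size≤p fC) y∈C (λ y∈ → not-dominated (here refl) y∈ x~y) ∖⁻ˡ

    spec-lift : ∀ {C L} → C ⊆ S → Off S ⁅ x ⁆ C → Spec C C L →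
      (∀ {v A a} → (v , A) ∈ˡ L → a ∈ A → ¬ x ~ a) → Spec S C L
    spec-lift {C} {L} C⊆S off spec avoid = record
      { each = λ vA∈L → let (con , v∈C , A⊆C) = each vA∈L in lift vA∈L con , v∈C , A⊆C
      ; cover = cover ; apart = apart }
      where
      open Spec spec
      lift : ∀ {v A} → (v , A) ∈ˡ L → Constituent C v A → Constituent S v A
      lift {v} {A} vA∈L con = record
        { fA = fA ; v∈S = C⊆S v∈S ; A⊆S = C⊆S ∘ A⊆S ; v∉A = v∉A ; oneEdge = oneEdge ; closed = closed′ }
        where
        open Constituent con
        closed′ : ∀ {a s} → a ∈ A → s ∈ S → a ~ s → s ≡ v ⊎ s ∈ A
        closed′ a∈A s∈S a~s with off (A⊆S a∈A) s∈S a~s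
        ... | inj₂ s∈C = closed a∈A s∈C a~s
        ... | inj₁ s∈x with ∈⁅⁆⁻ s∈x
        ...   | refl = contradiction (~-sym a~s) (avoid vA∈L a∈A)

    -- Choosing `x` already clears a component of type F, and a loose one gains its edge to `x`. A
    -- tight one gains if it is reducible or has a second edge to `x`; otherwise its constituents
    -- avoid `x` except at connections and the account is exact.
    component : ∀ {C} → C ⊆ S → x ∉ C → Conn C → Off S ⁅ x ⁆ C → Gain C ⊎ Exact C
    component {C} C⊆S x∉C conn off with attach-⁅⁆ connS conn C⊆S x∈S x∉C off
    ... | y , y∈C , x~y with ih C (size-strict C⊆S x∈S x∉C) conn
    ...   | isF fC = inj₁ ([] , ftype-clear fC y∈C x~y [] ,
      ≤-trans (E-positive ∈⁅⁆ y∈C x~y) (m≤n+m _ _))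
    ...   | loose (D , clear , bound) = inj₁ (D , clear-mono there clear ,
      ≤-trans (≤-reflexive (+-comm 1 (cost D))) (+-mono-≤ bound (E-positive ∈⁅⁆ y∈C x~y)))
    ...   | tight t with normalise conn t y∈C x~y
    ...     | reducible D clear bound = inj₁ (D , clear ,
      ≤-trans (≤-trans (s≤s (m≤m+n (cost D) (suc k))) (≤-trans (≤-reflexive (arith (cost D) k)) bound))
              (≤-trans (≤-reflexive (+-comm 1 (e C))) (+-monoʳ-≤ (e C) (E-positive ∈⁅⁆ y∈C x~y))))
      where
      arith : ∀ c k → suc (c + suc k) ≡ c + (k + 2)
      arith = solve-∀
    ...     | hinged L spec eq avoid with E ⁅ x ⁆ C ≤? 1
    ...       | yes E≤1 = inj₂ (L , spec-lift C⊆S off spec avoid , clear-mono there (spec-clear spec) ,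
      trans eq (trans (+-comm 1 (e C)) (cong (e C +_) (≤-antisym (E-positive ∈⁅⁆ y∈C x~y) E≤1))))
    ...       | no E≰1 = inj₁ (connections L , clear-mono there (spec-clear spec) ,
      ≤-trans (≤-reflexive (trans (cong suc (trans (cost-connections L) eq)) (+-comm 2 (e C)))) (+-monoʳ-≤ (e C) (≰⇒> E≰1)))

    -- A gain in one component is a gain for the union; if every component is exact, the lists of
    -- constituents are concatenated.
    rest : ∀ {B} → Components B → B ⊆ S → x ∉ B → Off S ⁅ x ⁆ B → Gain B ⊎ Exact B
    rest {B} (no-component empty) B⊆S x∉B off = inj₂ ([]
      , record { each = λ () ; cover = λ y∈B → contradiction y∈B empty ; apart = [] }
      , clear-all empty _
      , ≡-sym (cong₂ _+_ (NoEdge⇒e {B} λ a _ _ → empty a) (NoEdge⇒E {⁅ x ⁆} {B} λ _ b _ → empty b)))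
    rest {B} (more C conn C⊆B sep cs) B⊆S x∉B off =
      combine (component (B⊆S ∘ C⊆B) (x∉B ∘ C⊆B) conn (off-head off C⊆B sep))
              (rest cs (B⊆S ∘ ∖⁻ˡ) (x∉B ∘ ∖⁻ˡ) (off-tail off sep))
      where
      B′ = B ∖ C
      split : ∀ {s} → s ∈ B → s ∈ C ⊎ s ∈ B′
      split = split-∖ C
      counted : e B + E ⁅ x ⁆ B ≡ (e C + E ⁅ x ⁆ C) + (e B′ + E ⁅ x ⁆ B′)
      counted = count-part ⁅ x ⁆ (part-∖ C⊆B) sep
      merge : ∀ D₁ D₂ → Clear C (x ∷ D₁) → Clear B′ (x ∷ D₂) → Clear B (x ∷ D₁ ++ D₂)
      merge D₁ D₂ clear₁ clear₂ = clear-union (inj₂ ∘ split) sep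
        (clear-++ˡ D₁ D₂ clear₁) (clear-++ʳ D₁ D₂ clear₂)
      gain : ∀ D₁ D₂ → Clear C (x ∷ D₁) → Clear B′ (x ∷ D₂) →
        suc (cost D₁ + cost D₂) ≤ (e C + E ⁅ x ⁆ C) + (e B′ + E ⁅ x ⁆ B′) → Gain B
      gain D₁ D₂ clear₁ clear₂ bound = D₁ ++ D₂ , merge D₁ D₂ clear₁ clear₂ ,
        ≤-trans (≤-reflexive (cong suc (cost-++ D₁ D₂))) (≤-trans bound (≤-reflexive (≡-sym counted)))
      combine : Gain C ⊎ Exact C → Gain B′ ⊎ Exact B′ → Gain B ⊎ Exact B
      combine (inj₁ (D₁ , clear₁ , bound₁)) (inj₁ (D₂ , clear₂ , bound₂)) = inj₁ (gain D₁ D₂ clear₁ clear₂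
        (+-mono-≤ bound₁ (≤-trans (n≤1+n _) bound₂)))
      combine (inj₁ (D₁ , clear₁ , bound₁)) (inj₂ (L , spec , clear₂ , eq)) = inj₁ (gain D₁ (connections L) clear₁ clear₂
        (+-mono-≤ bound₁ (≤-reflexive (trans (cost-connections L) eq))))
      combine (inj₂ (L , spec , clear₁ , eq)) (inj₁ (D₂ , clear₂ , bound₂)) = inj₁ (gain (connections L) D₂ clear₁ clear₂
        (≤-trans (≤-reflexive (≡-sym (+-suc _ _))) (+-mono-≤ (≤-reflexive (trans (cost-connections L) eq)) bound₂)))
      combine (inj₂ (L₁ , spec₁ , clear₁ , eq₁)) (inj₂ (L₂ , spec₂ , clear₂ , eq₂)) = inj₂ (L₁ ++ L₂ , record
        { each = each′
        ; cover = λ y∈B → case split y∈B of λ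
            { (inj₁ y∈C) → let (v , A , d∈ , y∈) = Spec.cover spec₁ y∈C in v , A , ∈-++⁺ˡ d∈ , y∈
            ; (inj₂ y∈B′) → let (v , A , d∈ , y∈) = Spec.cover spec₂ y∈B′ in v , A , ∈-++⁺ʳ L₁ d∈ , y∈ }
        ; apart = AllPairs.++⁺ (Spec.apart spec₁) (Spec.apart spec₂)
            (All.tabulate λ d∈₁ → All.tabulate λ d∈₂ → separate d∈₁ d∈₂) }
        , subst (Clear B ∘ (x ∷_)) (≡-sym (map-++ proj₁ L₁ L₂)) (merge (connections L₁) (connections L₂) clear₁ clear₂)
        , trans (cost-++ L₁ L₂) (trans (cong₂ _+_ eq₁ eq₂) (≡-sym counted)))
        where
        each′ : ∀ {v A} → (v , A) ∈ˡ L₁ ++ L₂ → Constituent S v A × v ∈ B × A ⊆ B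
        each′ d∈ with ∈-++⁻ L₁ d∈
        ... | inj₁ d∈₁ = let (con , v∈ , A⊆) = Spec.each spec₁ d∈₁ in con , C⊆B v∈ , C⊆B ∘ A⊆
        ... | inj₂ d∈₂ = let (con , v∈ , A⊆) = Spec.each spec₂ d∈₂ in con , ∖⁻ˡ v∈ , ∖⁻ˡ ∘ A⊆
        separate : ∀ {c d} → c ∈ˡ L₁ → d ∈ˡ L₂ → Disjoint c d
        separate c∈ d∈ with Spec.each spec₁ c∈ | Spec.each spec₂ d∈
        ... | _ , v∈C , A⊆C | _ , v′∈B′ , A′⊆B′ =
          (λ { refl → ∖⁻ʳ v′∈B′ v∈C }) , (λ v∈A′ → ∖⁻ʳ (A′⊆B′ v∈A′) v∈C) ,
          (λ v′∈A → ∖⁻ʳ v′∈B′ (A⊆C v′∈A)) , λ z∈A z∈A′ → ∖⁻ʳ (A′⊆B′ z∈A′) (A⊆C z∈A)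

    module Beside {A : Sub n} (A⊆S : A ⊆ S) (x∉A : x ∉ A) (off : Off S ⁅ x ⁆ A) where

      B : Sub n
      B = S ∖ ⁅ x ⁆ ∖ A

      A⊆S-x : A ⊆ S ∖ ⁅ x ⁆
      A⊆S-x a∈A = ∖⁺ (A⊆S a∈A) λ a∈x → x∉A (⁅⁆-pull a∈x a∈A)

      apartAB : NoEdge A B
      apartAB a∈A b∈B a~b with off a∈A (∖⁻ˡ (∖⁻ˡ b∈B)) a~b
      ... | inj₁ b∈x = ∖⁻ʳ {A = S} (∖⁻ˡ b∈B) b∈x
      ... | inj₂ b∈A = ∖⁻ʳ b∈B b∈A

      counted : e S ≡ (e A + E ⁅ x ⁆ A) + (e B + E ⁅ x ⁆ B)
      counted = trans (e-remove x∈S) (count-part ⁅ x ⁆ (part-∖ A⊆S-x) apartAB)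

      x∉B : x ∉ B
      x∉B x∈B = ∖⁻ʳ {A = S} (∖⁻ˡ x∈B) ∈⁅⁆

      others : Gain B ⊎ Exact B
      others = rest (components B) (λ y∈B → ∖⁻ˡ (∖⁻ˡ {A = S ∖ ⁅ x ⁆} y∈B)) x∉B (off-complement off)

      split : ∀ {s} → s ∈ S → s ≡ x ⊎ s ∈ A ⊎ s ∈ B
      split {s} s∈S with s ≟ x | s ∈? A
      ... | yes s≡x | _ = inj₁ s≡x
      ... | no _ | yes s∈A = inj₂ (inj₁ s∈A)
      ... | no s≢x | no s∉A = inj₂ (inj₂ (∖⁺ (∖⁺ s∈S (s≢x ∘ ≡-sym ∘ ∈⁅⁆⁻)) s∉A))

      clear-both : ∀ D → Clear A (x ∷ D) → Clear B (x ∷ D) → Clear S (x ∷ D)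
      clear-both D = clear-union (λ s∈S → case split s∈S of λ
        { (inj₁ refl) → inj₁ (∈dom (here refl) (inj₁ refl)) ; (inj₂ s∈) → inj₂ s∈ }) apartAB

    -- The price of `x` is `k + 2`, and `A` with one edge to `x` pays `k + 1`. A gain among the
    -- other components or a second edge to `A` supplies the missing unit. Failing both, `x` and `A`
    -- form one more constituent.
    cut-ftype : ∀ {A} → A ⊆ S → x ∉ A → FType A → Off S ⁅ x ⁆ A → Outcome S
    cut-ftype {A} A⊆S x∉A fA off with attach-⁅⁆ connS (connF fA) A⊆S x∈S x∉A off
    ... | y , y∈A , x~y = conclude others
      where
      open Beside A⊆S x∉A off
      one : 1 ≤ E ⁅ x ⁆ A
      one = E-positive ∈⁅⁆ y∈A x~y
      conclude : Gain B ⊎ Exact B → Outcome S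
      conclude (inj₁ (D , clear , bound)) = loose (x ∷ D , clear-both D (ftype-clear fA y∈A x~y D) clear , (begin
        k + 2 + cost D  ≡⟨ arith k (cost D) ⟩
        k + 1 + suc (cost D)  ≤⟨ +-mono-≤ (+-mono-≤ (≤-reflexive (≡-sym (edgeF fA))) one) bound ⟩
        e A + E ⁅ x ⁆ A + (e B + E ⁅ x ⁆ B)  ≡⟨ counted ⟨
        e S  ∎))
        where
        open ≤-Reasoning
        arith : ∀ k c → k + 2 + c ≡ k + 1 + suc c
        arith = solve-∀
      conclude (inj₂ (L , spec , clear , eq)) with E ⁅ x ⁆ A ≤? 1
      ... | no E≰1 = loose (x ∷ connections L , clear-both _ (ftype-clear fA y∈A x~y _) clear , (begin
        k + 2 + cost (connections L)  ≡⟨ cong (k + 2 +_) (trans (cost-connections L) eq) ⟩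
        k + 2 + (e B + E ⁅ x ⁆ B)  ≤⟨ +-monoˡ-≤ (e B + E ⁅ x ⁆ B) (+-mono-≤ (≤-reflexive (≡-sym (edgeF fA))) (≰⇒> E≰1)) ⟩
        e A + E ⁅ x ⁆ A + (e B + E ⁅ x ⁆ B)  ≡⟨ counted ⟨
        e S  ∎))
        where open ≤-Reasoning
      ... | yes E≤1 = tight (special ((x , A) ∷ L) record
        { each = each′
        ; cover = λ y∈S → case split y∈S of λ
            { (inj₁ y≡x) → x , A , here refl , inj₁ y≡x
            ; (inj₂ (inj₁ y∈A)) → x , A , here refl , inj₂ y∈A
            ; (inj₂ (inj₂ y∈B)) → let (v , A′ , d∈ , y∈) = Spec.cover spec y∈B in v , A′ , there d∈ , y∈ }
        ; apart = All.tabulate (λ d∈ → let (con , v∈B , A′⊆B) = Spec.each spec d∈ in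
            (λ { refl → x∉B v∈B }) , (λ x∈A′ → x∉B (A′⊆B x∈A′)) , (λ v∈A → ∖⁻ʳ v∈B v∈A) ,
            λ z∈A z∈A′ → ∖⁻ʳ (A′⊆B z∈A′) z∈A) ∷ Spec.apart spec } total)
        where
        each′ : ∀ {v A′} → (v , A′) ∈ˡ (x , A) ∷ L → Constituent S v A′ × v ∈ S × A′ ⊆ S
        each′ (there d∈) = let (con , v∈B , A′⊆B) = Spec.each spec d∈ in
          con , ∖⁻ˡ (∖⁻ˡ v∈B) , λ z∈ → ∖⁻ˡ (∖⁻ˡ (A′⊆B z∈))
        each′ (here refl) = record
          { fA = fA ; v∈S = x∈S ; A⊆S = A⊆S ; v∉A = x∉A
          ; oneEdge = ≤-antisym E≤1 one
          ; closed = λ a∈A s∈S a~s → case off a∈A s∈S a~s of λ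
              { (inj₁ s∈x) → inj₁ (≡-sym (∈⁅⁆⁻ s∈x)) ; (inj₂ s∈A) → inj₂ s∈A } } , x∈S , A⊆S
        E≡1 : E ⁅ x ⁆ A ≡ 1
        E≡1 = ≤-antisym E≤1 one
        arith : ∀ k c → k + 2 + c ≡ suc (k + 1 + c)
        arith = solve-∀
        total : cost ((x , A) ∷ L) ≡ suc (e S)
        total = trans (cong (k + 2 +_) eq) (trans (arith k (e B + E ⁅ x ⁆ B))
          (cong suc (trans (cong (λ z → z + (e B + E ⁅ x ⁆ B)) (≡-sym (cong₂ _+_ (edgeF fA) E≡1))) (≡-sym counted))))

  -- In the hinged case the neighbour of `x` in `C` is a connection, and deleting that connection
  -- instead leaves its copy of F as a component. In the reducible case `C` with its edge to `x`
  -- pays for `x`, so the other components only have to break even.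
  cut-tight : ∀ {S x C} → Conn S → IH S → x ∈ S → C ⊆ S → x ∉ C → Conn C → Tight C → Off S ⁅ x ⁆ C → Outcome S
  cut-tight {S} {x} {C} connS ih x∈S C⊆S x∉C connC tC off with attach-⁅⁆ connS connC C⊆S x∈S x∉C off
  ... | y , y∈C , x~y with normalise connC tC y∈C x~y
  ...   | hinged L spec eq avoid with Spec.cover spec y∈C
  ...     | v , A , vA∈L , inj₂ y∈A = contradiction x~y (avoid vA∈L y∈A)
  ...     | v , A , vA∈L , inj₁ refl =
    AtVertex.cut-ftype connS ih (C⊆S v∈S) (C⊆S ∘ A⊆S) v∉A fA off′
    where
    open Constituent (proj₁ (Spec.each spec vA∈L))
    off′ : Off S ⁅ v ⁆ A
    off′ a∈A s∈S a~s with off (A⊆S a∈A) s∈S a~s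
    ... | inj₁ s∈x = contradiction (~-sym (subst (_ ~_) (≡-sym (∈⁅⁆⁻ s∈x)) a~s)) (avoid vA∈L a∈A)
    ... | inj₂ s∈C with closed a∈A s∈C a~s
    ...   | inj₁ refl = inj₁ ∈⁅⁆
    ...   | inj₂ s∈A = inj₂ s∈A
  cut-tight {S} {x} {C} connS ih x∈S C⊆S x∉C connC tC off
    | y , y∈C , x~y | reducible D clear bound = conclude others
    where
    open AtVertex connS ih x∈S
    open Beside C⊆S x∉C off
    finish : ∀ D′ → Clear B (x ∷ D′) → cost D′ ≤ e B + E ⁅ x ⁆ B → Outcome S
    finish D′ clear′ bound′ = loose (x ∷ D ++ D′ , clear-both (D ++ D′)
      (clear-++ˡ D D′ clear) (clear-++ʳ D D′ clear′) , (begin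
        k + 2 + cost (D ++ D′)  ≡⟨ cong (k + 2 +_) (cost-++ D D′) ⟩
        k + 2 + (cost D + cost D′)  ≡⟨ arith (k + 2) (cost D) (cost D′) ⟩
        cost D + (k + 2) + cost D′  ≤⟨ +-mono-≤ (≤-trans bound (≤-trans (≤-reflexive (+-comm 1 (e C)))
                                                     (+-monoʳ-≤ (e C) (E-positive ∈⁅⁆ y∈C x~y)))) bound′ ⟩
        e C + E ⁅ x ⁆ C + (e B + E ⁅ x ⁆ B)  ≡⟨ counted ⟨
        e S  ∎))
      where
      open ≤-Reasoning
      arith : ∀ a b c → a + (b + c) ≡ b + a + c
      arith = solve-∀
    conclude : Gain B ⊎ Exact B → Outcome S
    conclude (inj₁ (D′ , clear′ , bound′)) = finish D′ clear′ (≤-trans (n≤1+n _) bound′)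
    conclude (inj₂ (L , _ , clear′ , eq)) = finish (connections L) clear′ (≤-reflexive (trans (cost-connections L) eq))

  -- Splitting off a copy of F

  clear-⊆ : ∀ {S T D D′} → (∀ {s} → s ∈ S → s ∈ dom D ⊎ s ∈ T) → (∀ {d} → d ∈ˡ D′ → d ∈ˡ D) →
    Clear T D′ → Clear S D
  clear-⊆ {S} split D′⊆D clear c = clear (copy-mono (λ s∈ → case split (∖⁻ˡ s∈) of λ
    { (inj₁ s∈D) → contradiction s∈D (∖⁻ʳ {A = S} s∈)
    ; (inj₂ s∈T) → ∖⁺ s∈T (∖⁻ʳ {A = S} s∈ ∘ dom-mono D′⊆D) }) c)

  single-loose : ∀ {S} → SingleClears S → k + 2 ≤ e S → Outcome S
  single-loose (x , clear) bound = loose (x ∷ [] , clear , ≤-trans (≤-reflexive (+-identityʳ (k + 2))) bound)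

  module Join {S H : Sub n} (connS : Conn S) (ih : IH S) (H⊆S : H ⊆ S) (fH : FType H) (connR : Conn (S ∖ H)) where

    R : Sub n
    R = S ∖ H

    b : ℕ
    b = E R H

    split : ∀ {s} → s ∈ S → s ∈ R ⊎ s ∈ H
    split {s} s∈S with s ∈? H
    ... | yes s∈H = inj₂ s∈H
    ... | no s∉H = inj₁ (∖⁺ s∈S s∉H)

    eS : e S ≡ k + e R + b
    eS = trans (e-part (part-∖ H⊆S)) (cong₂ _+_ (cong (_+ e R) (edgeF fH)) (E-sym H R))

    1≤b : 1 ≤ b
    1≤b with nonempty connR | nonempty (connF fH)
    ... | r , r∈R | h , h∈H with cut connS H (H⊆S h∈H) h∈H (∖⁻ˡ r∈R) (∖⁻ʳ r∈R)
    ...   | s , t , (_ , s∈H) , (t∈S , t∉H) , s~t = E-positive (∖⁺ t∈S t∉H) s∈H (~-sym s~t)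

    cut-at : ∀ {z} → z ∈ R → (∀ {s t} → s ∈ R → t ∈ H → s ~ t → s ≡ z) → Outcome S
    cut-at {z} z∈R only = AtVertex.cut-ftype connS ih (∖⁻ˡ z∈R) H⊆S (∖⁻ʳ z∈R) fH off
      where
      off : Off S ⁅ z ⁆ H
      off a∈H s∈S a~s with split s∈S
      ... | inj₂ s∈H = inj₂ s∈H
      ... | inj₁ s∈R with only s∈R a∈H (~-sym a~s)
      ...   | refl = inj₁ ∈⁅⁆

    cut-constituent : ∀ {v A} → Constituent R v A → E A H ≡ 0 → Outcome S
    cut-constituent {v} {A} con E≡0 = AtVertex.cut-ftype connS ih (∖⁻ˡ v∈S) (λ a∈ → ∖⁻ˡ (A⊆S a∈)) v∉A fA off
      where
      open Constituent con
      off : Off S ⁅ v ⁆ A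
      off a∈A s∈S a~s with split s∈S
      ... | inj₂ s∈H = contradiction a~s (E⇒NoEdge E≡0 a∈A s∈H)
      ... | inj₁ s∈R with closed a∈A s∈R a~s
      ...   | inj₁ refl = inj₁ ∈⁅⁆
      ...   | inj₂ s∈A = inj₂ s∈A

    h₀ : Fin n
    h₀ = proj₁ (centre (sizeF fH) (copyF fH))

    with-centre : ∀ {D} → Clear R D → Clear S (h₀ ∷ D)
    with-centre = clear-⊆ (λ s∈S → case split s∈S of λ
      { (inj₁ s∈R) → inj₂ s∈R
      ; (inj₂ s∈H) → inj₁ (∈dom (here refl) (proj₂ (proj₂ (centre (sizeF fH) (copyF fH))) s∈H)) }) there

    -- The `2` is the part of the price of the centre of `H` that the `k` edges of `H` do not cover.
    loose-by : ∀ {D c} → Clear R D → cost D ≤ c → c + 2 ≤ e R + b → Outcome S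
    loose-by {D} {c} clear bound bound′ = loose (h₀ ∷ D , with-centre clear , (begin
      k + 2 + cost D  ≡⟨ arith k (cost D) ⟩
      k + (cost D + 2)  ≤⟨ +-monoʳ-≤ k (≤-trans (+-monoˡ-≤ 2 bound) bound′) ⟩
      k + (e R + b)  ≡⟨ +-assoc k (e R) b ⟨
      k + e R + b  ≡⟨ eS ⟨
      e S  ∎))
      where
      open ≤-Reasoning
      arith : ∀ k c → k + 2 + c ≡ k + (c + 2)
      arith = solve-∀

    joined : size R ≡ p → b ≤ 3 → Joined S R H
    joined |R| b≤3 = record { covers = split ; disj = ∖⁻ʳ ; sizeA = |R| ; sizeB = sizeF fH
                            ; connA = connR ; connB = connF fH ; few = b≤3 }

    single : k ≤ e R → SingleClears S → Outcome S
    single k≤eR s = single-loose s (≤-trans (+-monoʳ-≤ k (≤-trans (≤-trans (s≤s (s≤s z≤n)) 3≤k) k≤eR))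
      (≤-trans (m≤m+n (k + e R) b) (≤-reflexive (≡-sym eS))))

    -- The number of joining edges that start in `A` decides. With none, `v` cuts off `A`; with one,
    -- there is a ring; with two, there is a pendant connection, or a single vertex of `A` that cuts
    -- off `H`. The edges of `S` easily pay for one vertex.
    one-constituent : ∀ {v A} → Spec R R ((v , A) ∷ []) → b ≡ 2 → suc k ≤ e R → Outcome S
    one-constituent {v} {A} spec b≡2 k<eR = go (E A H) refl
      where
      open Spec spec
      con = proj₁ (each (here refl))
      open Constituent con
      v∈R = v∈S
      A⊆R = A⊆S
      k≤eR : k ≤ e R
      k≤eR = ≤-trans (n≤1+n k) k<eR
      part-R : Part R A ⁅ v ⁆
      part-R = part-intro
        (λ y∈R → case cover y∈R of λ
          { (_ , _ , here refl , inj₁ refl) → inj₂ ∈⁅⁆ ; (_ , _ , here refl , inj₂ y∈A) → inj₁ y∈A })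
        A⊆R (⁅⁆⊆ v∈R)
        λ y∈A y∈v → v∉A (⁅⁆-pull y∈v y∈A)
      total : E A H + E ⁅ v ⁆ H ≡ 2
      total = trans (≡-sym (E-splitˡ H part-R)) b≡2
      covers : ∀ {s} → s ∈ S → s ≡ v ⊎ s ∈ A ⊎ s ∈ H
      covers s∈S with split s∈S
      ... | inj₂ s∈H = inj₂ (inj₂ s∈H)
      ... | inj₁ s∈R with cover s∈R
      ...   | _ , _ , here refl , inj₁ s≡v = inj₁ s≡v
      ...   | _ , _ , here refl , inj₂ s∈A = inj₂ (inj₁ s∈A)
      disjoint : ∀ {s} → s ∈ A → s ∉ H
      disjoint s∈A = ∖⁻ʳ (A⊆R s∈A)
      go : ∀ m → E A H ≡ m → Outcome S
      go 0 E≡0 = cut-constituent con E≡0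
      go 1 E≡1 with unique-edge {⁅ v ⁆} {A} oneEdge | unique-edge {A} {H} E≡1
        | unique-edge {⁅ v ⁆} {H} (+-cancelˡ-≡ 1 _ _ (trans (cong (_+ E ⁅ v ⁆ H) (≡-sym E≡1)) total))
      ... | v₁ , w , v₁∈ , w∈A , v~w , onlyw | a , b , a∈A , b∈H , a~b , onlyab
          | v₂ , y , v₂∈ , y∈H , v~y , onlyy with ∈⁅⁆⁻ v₁∈ | ∈⁅⁆⁻ v₂∈
      ...   | refl | refl = single k≤eR (ring-clears {v = v} {w} {y} {a} {b} record
        { covers = covers ; fA = fA ; fB = fH ; disj = disjoint ; v∉A = v∉A ; v∉B = ∖⁻ʳ v∈R
        ; w∈A = w∈A ; y∈B = y∈H ; a∈A = a∈A ; b∈B = b∈H ; v~w = v~w ; v~y = v~y ; a~b = a~b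
        ; onlyA = λ s∈A v~s → proj₂ (onlyw ∈⁅⁆ s∈A v~s) ; onlyB = λ s∈H v~s → proj₂ (onlyy ∈⁅⁆ s∈H v~s)
        ; onlyAB = onlyab })
      go 2 E≡2 with unique-edge {⁅ v ⁆} {A} oneEdge | two-edges {A} {H} E≡2
      ... | v₁ , w , v₁∈ , w∈A , v~w , onlyw
          | z₁ , y₁ , z₂ , y₂ , (z₁∈A , y₁∈H , z₁~y₁) , (z₂∈A , y₂∈H , z₂~y₂) , only with z₁ ≟ z₂ | ∈⁅⁆⁻ v₁∈
      ...   | no z₁≢z₂ | refl = single k≤eR (pendant-clears {v = v} {w} {z₁} {y₁} {z₂} {y₂} record
        { covers = covers ; fA = fA ; fB = fH ; disj = disjoint ; v∉A = v∉A ; v∉B = ∖⁻ʳ v∈R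
        ; onlyA = λ s∈A v~s → proj₂ (onlyw ∈⁅⁆ s∈A v~s) ; noneB = E⇒NoEdge none ∈⁅⁆
        ; z₁∈A = z₁∈A ; z₂∈A = z₂∈A ; y₁∈B = y₁∈H ; y₂∈B = y₂∈H ; z₁~y₁ = z₁~y₁ ; z₂~y₂ = z₂~y₂
        ; z₁≢z₂ = z₁≢z₂ ; onlyAB = only })
        where
        none : E ⁅ v ⁆ H ≡ 0
        none = +-cancelˡ-≡ 2 _ _ (trans (cong (_+ E ⁅ v ⁆ H) (≡-sym E≡2)) total)
      ...   | yes refl | refl = cut-at (A⊆R z₁∈A) λ {s} s∈R t∈H s~t → case covers (∖⁻ˡ s∈R) of λ
        { (inj₁ refl) → contradiction s~t (E⇒NoEdge none ∈⁅⁆ t∈H)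
        ; (inj₂ (inj₁ s∈A)) → [ proj₁ , proj₁ ]′ (only s∈A t∈H s~t)
        ; (inj₂ (inj₂ s∈H)) → contradiction s∈H (∖⁻ʳ s∈R) }
        where
        none : E ⁅ v ⁆ H ≡ 0
        none = +-cancelˡ-≡ 2 _ _ (trans (cong (_+ E ⁅ v ⁆ H) (≡-sym E≡2)) total)
      go (suc (suc (suc m))) E≡ = case trans (cong (_+ E ⁅ v ⁆ H) (≡-sym E≡)) total of λ ()

    -- A copy without an edge to `H` is cut off by its connection. Otherwise the two joining edges
    -- start one in each copy and none at a connection, and a single edge beyond those of `R` makes
    -- two isolating vertices affordable.
    two-constituents : ∀ {v₁ A₁ v₂ A₂} → Spec R R ((v₁ , A₁) ∷ (v₂ , A₂) ∷ []) → b ≡ 2 →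
      cost (v₁ ∷ v₂ ∷ []) ≡ suc (e R) → Outcome S
    two-constituents {v₁} {A₁} {v₂} {A₂} spec b≡2 eq with E A₁ H in eq₁ | E A₂ H in eq₂
    ... | zero | _ = cut-constituent (proj₁ (Spec.each spec (here refl))) eq₁
    ... | suc _ | zero = cut-constituent (proj₁ (Spec.each spec (there (here refl)))) eq₂
    ... | suc m₁ | suc m₂ = finish
      where
      open Spec spec
      open Constituent (proj₁ (each (here refl))) renaming
        (fA to fA₁; v∈S to v₁∈R; A⊆S to A₁⊆R; v∉A to v₁∉A₁; oneEdge to oneEdge₁; closed to closed₁)
      open Constituent (proj₁ (each (there (here refl)))) renaming
        (fA to fA₂; v∈S to v₂∈R; A⊆S to A₂⊆R; v∉A to v₂∉A₂; oneEdge to oneEdge₂; closed to closed₂)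
      separate : Disjoint (v₁ , A₁) (v₂ , A₂)
      separate = case apart of λ { ((d All.∷ _) ∷ _) → d }
      part₁ : Part (A₁ ∪ ⁅ v₁ ⁆) A₁ ⁅ v₁ ⁆
      part₁ = part-∪ λ y∈A y∈v → v₁∉A₁ (⁅⁆-pull y∈v y∈A)
      part₂ : Part (A₂ ∪ ⁅ v₂ ⁆) A₂ ⁅ v₂ ⁆
      part₂ = part-∪ λ y∈A y∈v → v₂∉A₂ (⁅⁆-pull y∈v y∈A)
      part-R : Part R (A₁ ∪ ⁅ v₁ ⁆) (A₂ ∪ ⁅ v₂ ⁆)
      part-R = part-intro
        (λ y∈R → case cover y∈R of λ
          { (_ , _ , here refl , inj₁ refl) → inj₁ (∪⁺ʳ {A = A₁} ∈⁅⁆)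
          ; (_ , _ , here refl , inj₂ y∈A) → inj₁ (∪⁺ˡ y∈A)
          ; (_ , _ , there (here refl) , inj₁ refl) → inj₂ (∪⁺ʳ {A = A₂} ∈⁅⁆)
          ; (_ , _ , there (here refl) , inj₂ y∈A) → inj₂ (∪⁺ˡ y∈A) })
        ([ A₁⊆R , (⁅⁆⊆ v₁∈R) ]′ ∘ ∪⁻)
        ([ A₂⊆R , (⁅⁆⊆ v₂∈R) ]′ ∘ ∪⁻)
        λ y∈₁ y∈₂ → let (v≢ , v₁∉ , v₂∉ , A#) = separate in case ∪⁻ {A = A₁} y∈₁ , ∪⁻ {A = A₂} y∈₂ of λ
          { (inj₁ p , inj₁ q) → A# p q
          ; (inj₁ p , inj₂ q) → v₂∉ (⁅⁆-pull q p)
          ; (inj₂ p , inj₁ q) → v₁∉ (⁅⁆-pull p q)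
          ; (inj₂ p , inj₂ q) → v≢ (trans (∈⁅⁆⁻ p) (≡-sym (∈⁅⁆⁻ q))) }
      total : (suc m₁ + E ⁅ v₁ ⁆ H) + (suc m₂ + E ⁅ v₂ ⁆ H) ≡ 2
      total = trans (≡-sym (cong₂ (λ x y → (x + E ⁅ v₁ ⁆ H) + (y + E ⁅ v₂ ⁆ H)) eq₁ eq₂))
        (trans (≡-sym (cong₂ _+_ (E-splitˡ H part₁) (E-splitˡ H part₂)))
          (trans (≡-sym (E-splitˡ H part-R)) b≡2))
      all-zero : ∀ m₁ x m₂ y → (suc m₁ + x) + (suc m₂ + y) ≡ 2 → m₁ ≡ 0 × x ≡ 0 × m₂ ≡ 0 × y ≡ 0
      all-zero zero zero zero zero refl = refl , refl , refl , refl
      all-zero zero zero (suc m₂) y ()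
      all-zero zero (suc zero) m₂ y ()
      all-zero (suc zero) zero m₂ y ()
      finish : Outcome S
      finish with all-zero m₁ (E ⁅ v₁ ⁆ H) m₂ (E ⁅ v₂ ⁆ H) total
      ... | refl , none₁ , refl , none₂
        with unique-edge {⁅ v₁ ⁆} {A₁} oneEdge₁ | unique-edge {⁅ v₂ ⁆} {A₂} oneEdge₂
           | unique-edge {A₁} {H} eq₁ | unique-edge {A₂} {H} eq₂
      ... | u₁ , w₁ , u₁∈ , w₁∈ , _ , only₁ | u₂ , w₂ , u₂∈ , w₂∈ , _ , only₂
          | z₁ , y₁ , z₁∈ , y₁∈ , z₁~y₁ , onlyB₁ | z₂ , y₂ , z₂∈ , y₂∈ , z₂~y₂ , onlyB₂
        with ∈⁅⁆⁻ u₁∈ | ∈⁅⁆⁻ u₂∈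
      ... | refl | refl = loose (z₁ ∷ z₂ ∷ [] , double-clears {v₁ = v₁} {w₁} {z₁} {y₁} {v₂} {w₂} {z₂} {y₂} record
        { covers = covers ; fA₁ = fA₁ ; fA₂ = fA₂ ; fB = fH
        ; only₁ = λ s∈ v~s → proj₂ (only₁ ∈⁅⁆ s∈ v~s) ; only₂ = λ s∈ v~s → proj₂ (only₂ ∈⁅⁆ s∈ v~s)
        ; w₁∈A₁ = w₁∈ ; w₂∈A₂ = w₂∈
        ; apart = λ a∈ b∈ a~b → let (_ , _ , v₂∉ , A#) = separate ; (_ , v₁∉ , _) = separate in
            case closed₁ a∈ (A₂⊆R b∈) a~b of λ { (inj₁ refl) → v₁∉ b∈ ; (inj₂ b∈₁) → A# b∈₁ b∈ }
        ; v₁A₂ = λ s∈ v~s → let (v≢ , v₁∉ , _) = separate in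
            case closed₂ s∈ v₁∈R (~-sym v~s) of λ { (inj₁ v₁≡v₂) → v≢ v₁≡v₂ ; (inj₂ v₁∈) → v₁∉ v₁∈ }
        ; v₂A₁ = λ s∈ v~s → let (v≢ , _ , v₂∉ , _) = separate in
            case closed₁ s∈ v₂∈R (~-sym v~s) of λ { (inj₁ v₂≡v₁) → v≢ (≡-sym v₂≡v₁) ; (inj₂ v₂∈) → v₂∉ v₂∈ }
        ; v₁B = E⇒NoEdge none₁ ∈⁅⁆ ; v₂B = E⇒NoEdge none₂ ∈⁅⁆
        ; z₁∈A₁ = z₁∈ ; z₂∈A₂ = z₂∈ ; y₁∈B = y₁∈ ; y₂∈B = y₂∈ ; z₁~y₁ = z₁~y₁ ; z₂~y₂ = z₂~y₂
        ; onlyB₁ = onlyB₁ ; onlyB₂ = onlyB₂ } , (begin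
          cost (v₁ ∷ v₂ ∷ [])  ≡⟨ eq ⟩
          suc (e R)  ≤⟨ s≤s (m≤n+m (e R) k) ⟩
          suc (k + e R)  ≡⟨ +-comm 1 (k + e R) ⟩
          k + e R + 1  ≤⟨ +-monoʳ-≤ (k + e R) 1≤b ⟩
          k + e R + b  ≡⟨ eS ⟨
          e S  ∎))
        where
        open ≤-Reasoning
        covers : ∀ {s} → s ∈ S → s ≡ v₁ ⊎ s ∈ A₁ ⊎ s ≡ v₂ ⊎ s ∈ A₂ ⊎ s ∈ H
        covers s∈S with split s∈S
        ... | inj₂ s∈H = inj₂ (inj₂ (inj₂ (inj₂ s∈H)))
        ... | inj₁ s∈R with cover s∈R
        ...   | _ , _ , here refl , inj₁ s≡v = inj₁ s≡v
        ...   | _ , _ , here refl , inj₂ s∈A = inj₂ (inj₁ s∈A)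
        ...   | _ , _ , there (here refl) , inj₁ s≡v = inj₂ (inj₂ (inj₁ s≡v))
        ...   | _ , _ , there (here refl) , inj₂ s∈A = inj₂ (inj₂ (inj₂ (inj₁ s∈A)))

    -- Two joining edges reach at most two of three disjoint copies, and the one not reached is cut
    -- off by its connection.
    three-constituents : ∀ {v₁ A₁ v₂ A₂ v₃ A₃ L} →
      Spec R R ((v₁ , A₁) ∷ (v₂ , A₂) ∷ (v₃ , A₃) ∷ L) → b ≡ 2 → Outcome S
    three-constituents {v₁} {A₁} {v₂} {A₂} {v₃} {A₃} spec b≡2 with E A₁ H in eq₁ | E A₂ H in eq₂ | E A₃ H in eq₃
    ... | zero | _ | _ = cut-constituent (proj₁ (Spec.each spec (here refl))) eq₁
    ... | suc _ | zero | _ = cut-constituent (proj₁ (Spec.each spec (there (here refl)))) eq₂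
    ... | suc _ | suc _ | zero = cut-constituent (proj₁ (Spec.each spec (there (there (here refl))))) eq₃
    ... | suc _ | suc _ | suc _ = contradiction (begin
      1 + (1 + 1)  ≤⟨ +-mono-≤ (positive eq₁) (+-mono-≤ (positive eq₂) (positive eq₃)) ⟩
      E A₁ H + (E A₂ H + E A₃ H)  ≤⟨ +-monoʳ-≤ (E A₁ H) (+-monoʳ-≤ (E A₂ H) (E-mono {A₃} {R₁ ∖ A₂} {H} A₃⊆ (λ z → z))) ⟩
      E A₁ H + (E A₂ H + E (R₁ ∖ A₂) H)  ≡⟨ cong (E A₁ H +_) (E-splitˡ H (part-∖ A₂⊆)) ⟨
      E A₁ H + E R₁ H  ≡⟨ E-splitˡ H (part-∖ (A⊆R (here refl))) ⟨
      b  ≡⟨ b≡2 ⟩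
      2  ∎) λ { (s≤s (s≤s ())) }
      where
      open ≤-Reasoning
      R₁ = R ∖ A₁
      positive : ∀ {x m} → x ≡ suc m → 1 ≤ x
      positive refl = s≤s z≤n
      A⊆R : ∀ {v A} → (v , A) ∈ˡ _ → A ⊆ R
      A⊆R d∈ = proj₂ (proj₂ (Spec.each spec d∈))
      A₂⊆ : A₂ ⊆ R₁
      A₂⊆ z∈ = case Spec.apart spec of λ
        { (((_ , _ , _ , d₁₂) All.∷ _) ∷ _) → ∖⁺ (A⊆R (there (here refl)) z∈) λ z∈₁ → d₁₂ z∈₁ z∈ }
      A₃⊆ : A₃ ⊆ R₁ ∖ A₂
      A₃⊆ z∈ = case Spec.apart spec of λ
        { ((_ All.∷ (_ , _ , _ , d₁₃) All.∷ _) ∷ ((_ , _ , _ , d₂₃) All.∷ _) ∷ _) →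
          ∖⁺ (∖⁺ (A⊆R (there (there (here refl))) z∈) λ z∈₁ → d₁₃ z∈₁ z∈) λ z∈₂ → d₂₃ z∈₂ z∈ }

    join-tight : Tight R → b ≡ 2 → Outcome S
    join-tight (nearly |R| eR c) b≡2 = single (≤-trans (n≤1+n k) (≤-reflexive (≡-sym eR)))
      (joined-clears fH (joined |R| (≤-trans (≤-reflexive b≡2) (n≤1+n 2))) 1≤b)
    join-tight (special [] spec ()) b≡2
    join-tight (special (_ ∷ []) spec eq) b≡2 = one-constituent spec b≡2
      (≤-reflexive (+-cancelˡ-≡ 1 _ _ (trans (≡-sym (k+2+0 k)) eq)))
    join-tight (special (_ ∷ _ ∷ []) spec eq) b≡2 = two-constituents spec b≡2 eq
    join-tight (special (_ ∷ _ ∷ _ ∷ _) spec eq) b≡2 = three-constituents spec b≡2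

    join : Outcome S
    join with b ≤? 1
    ... | yes b≤1 with unique-edge {R} {H} (≤-antisym b≤1 1≤b)
    ...   | z , y , z∈R , _ , _ , only = cut-at z∈R λ s∈R t∈H s~t → proj₁ (only s∈R t∈H s~t)
    join | no b≰1 with ih R (size-strict ∖⁻ˡ (H⊆S (proj₂ (nonempty (connF fH))))
                                (λ h∈R → ∖⁻ʳ h∈R (proj₂ (nonempty (connF fH))))) connR
    ... | loose (D , clear , bound) = loose-by clear bound (+-monoʳ-≤ (e R) (≰⇒> b≰1))
    ... | tight t with b ≤? 2
    ...   | yes b≤2 = join-tight t (≤-antisym b≤2 (≰⇒> b≰1))
    ...   | no b≰2 = let (D , clear , eq) = tight-clear t in loose-by clear (≤-reflexive eq)
      (≤-trans (≤-reflexive (arith (e R))) (+-monoʳ-≤ (e R) (≰⇒> b≰2)))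
      where
      arith : ∀ x → suc x + 2 ≡ x + 3
      arith = solve-∀
    join | no b≰1 | isF fR with b ≤? 3
    ...   | yes b≤3 = single (≤-reflexive (≡-sym (edgeF fR))) (joined-clears fH (joined (sizeF fR) b≤3) 1≤b)
    ...   | no b≰3 = let (r , r∈R , star) = centre (sizeF fR) (copyF fR) in
      loose-by {r ∷ []} (free-drop (size≤p fR) r∈R (λ r∈ → not-dominator (here refl) r∈ refl) ∖⁻ˡ)
        ≤-refl (≤-trans (≤-reflexive (arith k)) (+-mono-≤ (≤-reflexive (≡-sym (edgeF fR))) (≰⇒> b≰3)))
      where
      arith : ∀ k → k + 2 + 0 + 2 ≡ k + 4
      arith = solve-∀

  -- The trichotomy

  conn-resp : ∀ {S T} → S ⊆ T → T ⊆ S → Conn S → Conn T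
  conn-resp S⊆T T⊆S conn = record
    { nonempty = let (s , s∈S) = nonempty conn in s , S⊆T s∈S
    ; cut = λ X a∈T a∈X b∈T b∉X →
        let (s , t , (s∈S , s∈X) , (t∈S , t∉X) , s~t) = cut conn X (T⊆S a∈T) a∈X (T⊆S b∈T) b∉X
        in s , t , (S⊆T s∈S , s∈X) , (S⊆T t∈S , t∉X) , s~t }

  module AtCentre {S : Sub n} (connS : Conn S) (ih : IH S) (c : HasCopy S) where

    v : Fin n
    v = emb c (proj₁ centre-F)

    v∈S : v ∈ S
    v∈S = inside c (proj₁ centre-F)

    A : Sub n
    A = S ∩ N[ v ]

    I J B : Sub n
    I = image (emb c)
    J = A ∖ I
    B = S ∖ A

    v∈A : v ∈ A
    v∈A = ∩⁺ v∈S u∈N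

    v∈I : v ∈ I
    v∈I = ∈-image (emb c) (proj₁ centre-F)

    star : ∀ {s} → s ∈ A → s ≡ v ⊎ v ~ s
    star s∈A = ∈N⁻ (∩⁻ʳ {A = S} s∈A)

    I⊆A : I ⊆ A
    I⊆A x∈I with ∈-image⁻ (emb c) x∈I
    ... | a , refl = ∩⁺ (inside c a) (near (a ≟ proj₁ centre-F))
      where
      near : Dec (a ≡ proj₁ centre-F) → emb c a ∈ N[ v ]
      near (yes refl) = u∈N
      near (no a≢) = ~⇒∈N (edges c _ a (proj₂ centre-F a a≢))

    copyI : HasCopy I
    copyI = copy (emb c) (inj c) (edges c) (∈-image (emb c))

    |I| : size I ≡ p
    |I| = ≤-antisym (size-image (emb c)) (copy-size copyI)

    |A| : size A ≡ p + size J
    |A| = trans (size-part (part-∖ I⊆A)) (cong (_+ size J) |I|)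

    -- Each vertex of the closed neighbourhood beyond the copy brings its own edge to `v`. So a
    -- neighbourhood with only `k` edges is the copy itself.
    spokes : size J ≤ E I J
    spokes = begin
      size J  ≤⟨ size-mono {A = J} {J ∩ nbr v} (λ s∈J → ∩⁺ s∈J (case star (∖⁻ˡ s∈J) of λ
                               { (inj₁ refl) → contradiction v∈I (∖⁻ʳ s∈J) ; (inj₂ v~s) → mem v~s })) ⟩
      size (J ∩ nbr v)  ≡⟨ E-⁅⁆ v J ⟨
      E ⁅ v ⁆ J  ≤⟨ E-mono {⁅ v ⁆} {I} {J} {J} (⁅⁆⊆ v∈I) (λ x → x) ⟩
      E I J  ∎
      where open ≤-Reasoning

    eA : e I + size J ≤ e A
    eA = begin
      e I + size J  ≤⟨ +-mono-≤ (m≤m+n (e I) (e J)) spokes ⟩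
      e I + e J + E I J  ≡⟨ e-part (part-∖ I⊆A) ⟨
      e A  ∎
      where open ≤-Reasoning

    k+|J|≤eA : k + size J ≤ e A
    k+|J|≤eA = ≤-trans (+-monoˡ-≤ (size J) (copy-edges copyI)) eA

    copyA : HasCopy A
    copyA = copy-mono I⊆A copyI

    ftypeA : e A ≤ k → FType A
    ftypeA eA≤k = ftype (trans |A| (trans (cong (p +_) |J|) (+-identityʳ p)))
      (≤-antisym eA≤k (copy-edges copyA)) copyA
      where
      |J| : size J ≡ 0
      |J| = n≤0⇒n≡0 (+-cancelˡ-≤ k _ _ (≤-trans k+|J|≤eA (≤-trans eA≤k (≤-reflexive (≡-sym (+-identityʳ k))))))

    eS : e S ≡ e A + e B + E A B
    eS = e-part (part-∖ {S = S} {A} ∩⁻ˡ)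

    -- Here `v` alone isolates `S`, which is loose as soon as it has `k + 2` edges. With fewer, at
    -- most one vertex lies outside the copy, and deleting that vertex leaves the copy as a
    -- component.
    whole : S ⊆ A → Outcome S
    whole S⊆A with k + 2 ≤? e S
    ... | yes big = single-loose (v , clear) big
      where
      clear : Clear S (v ∷ [])
      clear d with copy-centre d
      ... | u , u∈ , _ with star (S⊆A (∖⁻ˡ u∈))
      ...   | inj₁ u≡v = not-dominator (here refl) u∈ u≡v
      ...   | inj₂ v~u = not-dominated (here refl) u∈ v~u
    ... | no ¬big with size J in |J|
    ...   | suc j with size-positive {S = J} (≤-trans (s≤s z≤n) (≤-reflexive (≡-sym |J|)))
    ...     | y , y∈J = AtVertex.cut-ftype connS ih (∩⁻ˡ (∖⁻ˡ y∈J)) (λ x∈ → ∩⁻ˡ (I⊆A x∈)) (∖⁻ʳ y∈J)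
              (ftype |I| (≤-antisym eI≤k (copy-edges copyI)) copyI) off
      where
      eA≤ : e A ≤ suc k
      eA≤ = ≤-trans (e-mono {A} {S} ∩⁻ˡ) (+-cancelˡ-≤ 1 _ _ (≤-trans (≰⇒> ¬big) (≤-reflexive (+-comm k 2))))
      eI≤k : e I ≤ k
      eI≤k = +-cancelʳ-≤ 1 _ _ (≤-trans (+-monoʳ-≤ (e I) (≤-trans (s≤s z≤n) (≤-reflexive (≡-sym |J|))))
        (≤-trans eA (≤-trans eA≤ (≤-reflexive (+-comm 1 k)))))
      |J|≤1 : size J ≤ 1
      |J|≤1 = +-cancelˡ-≤ k _ _ (≤-trans k+|J|≤eA (≤-trans eA≤ (≤-reflexive (+-comm 1 k))))
      off : Off S ⁅ y ⁆ I
      off {s = s} _ s∈S _ with s ∈? I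
      ... | yes s∈I = inj₂ s∈I
      ... | no s∉I with y ≟ s
      ...   | yes refl = inj₁ ∈⁅⁆
      ...   | no y≢s = contradiction (≤-trans (s≤s (member⇒size (∖⁺ (∖⁺ (S⊆A s∈S) s∉I) (y≢s ∘ ∈⁅⁆⁻))))
                         (≤-reflexive (≡-sym (size-remove y∈J)))) (<⇒≱ (s≤s |J|≤1))
    whole S⊆A | no ¬big | zero with e S ≤? k
    ... | yes eS≤k = isF (ftype |S| (≤-antisym eS≤k (copy-edges c)) c)
      where
      |S| : size S ≡ p
      |S| = trans (≤-antisym (size-mono S⊆A) (size-mono {A = A} ∩⁻ˡ)) (trans |A| (trans (cong (p +_) |J|) (+-identityʳ p)))
    ... | no eS≰k = tight (nearly (trans (≤-antisym (size-mono S⊆A) (size-mono {A = A} ∩⁻ˡ))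
                                           (trans |A| (trans (cong (p +_) |J|) (+-identityʳ p))))
      (≤-antisym (+-cancelˡ-≤ 1 _ _ (≤-trans (≰⇒> ¬big) (≤-reflexive (+-comm k 2)))) (≰⇒> eS≰k)) c)

    number : ∀ {B} → Components B → ℕ
    number (no-component _) = 0
    number (more _ _ _ _ cs) = suc (number cs)

    -- `m` counts edges left over. Each component supplies one towards the price of `v`.
    Cheap : Sub n → ℕ → Set
    Cheap B m = ∃ λ D → Clear B (v ∷ D) × cost D + m ≤ e B + E A B

    -- A loose component keeps its joining edge as surplus, and a tight one keeps a surplus when it
    -- has two. A tight one with a single joining edge is cut off by the end of that edge in `A`. A
    -- component of type F is split off, since the rest stays connected through `v`.
    component : ∀ {C} → C ⊆ S → v ∉ C → Conn C → Off S A C → Outcome S ⊎ Cheap C 1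
    component {C} C⊆S v∉C connC off with attach connS connC C⊆S v∈S v∉C off
    ... | y , z , y∈C , z∈A , z~y with ih C (size-strict C⊆S v∈S v∉C) connC
    ...   | isF fC = inj₁ (Join.join connS ih C⊆S fC (conn-remove connS C⊆S v∈S v∉C
      λ h∈C t∈S t∉C h~t → case off h∈C t∈S h~t of λ
        { (inj₁ t∈A) → star t∈A ; (inj₂ t∈C) → contradiction t∈C t∉C }))
    ...   | loose (D , clear , bound) = inj₂ (D , clear-mono there clear ,
      +-mono-≤ bound (E-positive z∈A y∈C z~y))
    ...   | tight t with E A C ≤? 1
    ...     | no E≰1 = let (D , clear , eq) = tight-clear t in inj₂ (D , clear-mono there clear ,
      ≤-trans (≤-reflexive (trans (cong (_+ 1) eq) (arith (e C)))) (+-monoʳ-≤ (e C) (≰⇒> E≰1)))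
      where
      arith : ∀ x → suc x + 1 ≡ x + 2
      arith = solve-∀
    ...     | yes E≤1 with unique-edge {A} {C} (≤-antisym E≤1 (E-positive z∈A y∈C z~y))
    ...       | z′ , _ , z′∈A , _ , z′~y′ , only =
      inj₁ (cut-tight connS ih (∩⁻ˡ z′∈A) C⊆S z′∉C connC t off′)
      where
      off′ : Off S ⁅ z′ ⁆ C
      off′ a∈C s∈S a~s with off a∈C s∈S a~s
      ... | inj₂ s∈C = inj₂ s∈C
      ... | inj₁ s∈A with only s∈A a∈C (~-sym a~s)
      ...   | refl , _ = inj₁ ∈⁅⁆
      z′∉C : z′ ∉ C
      z′∉C z′∈C with star z′∈A
      ... | inj₁ refl = v∉C z′∈C
      ... | inj₂ v~z′ = ~-≢ v~z′ (proj₁ (only v∈A z′∈C v~z′))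

    rest : ∀ {B} (cs : Components B) → B ⊆ S → v ∉ B → Off S A B → Outcome S ⊎ Cheap B (number cs)
    rest (no-component empty) _ _ _ = inj₂ ([] , clear-all empty _ , z≤n)
    rest {B} (more C connC C⊆B sep cs) B⊆S v∉B off
      with component (B⊆S ∘ C⊆B) (v∉B ∘ C⊆B) connC (off-head off C⊆B sep)
         | rest cs (B⊆S ∘ ∖⁻ˡ) (v∉B ∘ ∖⁻ˡ) (off-tail off sep)
    ... | inj₁ done | _ = inj₁ done
    ... | _ | inj₁ done = inj₁ done
    ... | inj₂ (D₁ , clear₁ , bound₁) | inj₂ (D₂ , clear₂ , bound₂) = inj₂ (D₁ ++ D₂
      , clear-union (inj₂ ∘ split-∖ C) sep
          (clear-++ˡ D₁ D₂ clear₁) (clear-++ʳ D₁ D₂ clear₂)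
      , (begin
        cost (D₁ ++ D₂) + suc (number cs)  ≡⟨ cong (_+ suc (number cs)) (cost-++ D₁ D₂) ⟩
        cost D₁ + cost D₂ + suc (number cs)  ≡⟨ arith (cost D₁) (cost D₂) (number cs) ⟩
        cost D₁ + 1 + (cost D₂ + number cs)  ≤⟨ +-mono-≤ bound₁ bound₂ ⟩
        e C + E A C + (e (B ∖ C) + E A (B ∖ C))  ≡⟨ count-part A (part-∖ C⊆B) sep ⟨
        e B + E A B  ∎))
      where
      open ≤-Reasoning
      arith : ∀ a b c → a + b + suc c ≡ a + 1 + (b + c)
      arith = solve-∀

    split-A : ∀ {s} → s ∈ S → s ∈ A ⊎ s ∈ B
    split-A = split-∖ A

    offB : Off S A B
    offB _ s∈S _ = split-A s∈S

    v∉B : v ∉ B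
    v∉B v∈B = ∖⁻ʳ v∈B v∈A

    finish : ∀ {m} → Cheap B m → k + 2 ≤ e A + m → Outcome S
    finish {m} (D , clear , bound) enough = loose (v ∷ D
      , clear-⊆ (λ s∈S → case split-A s∈S of λ
          { (inj₁ s∈A) → inj₁ (∈dom (here refl) (star s∈A)) ; (inj₂ s∈B) → inj₂ s∈B }) (λ d → d) clear
      , +-cancelʳ-≤ m _ _ (begin
        k + 2 + cost D + m  ≡⟨ +-assoc (k + 2) (cost D) m ⟩
        k + 2 + (cost D + m)  ≤⟨ +-mono-≤ enough bound ⟩
        e A + m + (e B + E A B)  ≡⟨ arith (e A) m (e B) (E A B) ⟩
        e A + e B + E A B + m  ≡⟨ cong (_+ m) eS ⟨
        e S + m  ∎))
      where
      open ≤-Reasoning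
      arith : ∀ a m b c → a + m + (b + c) ≡ a + b + c + m
      arith = solve-∀

    -- The neighbourhood pays at least `k` of the price `k + 2`, so two components suffice, or one
    -- together with an extra edge in `A`. What is left is one component and `A` of type F, so that
    -- now `A` is the copy to be split off.
    by-components : Components B → Outcome S
    by-components (no-component empty) = whole λ s∈S → case split-A s∈S of λ
      { (inj₁ s∈A) → s∈A ; (inj₂ s∈B) → contradiction s∈B empty }
    by-components cs@(more C connC C⊆B sep (no-component empty)) with rest cs ∖⁻ˡ v∉B offB
    ... | inj₁ done = done
    ... | inj₂ cheap with e A ≤? k
    ...   | yes eA≤k = Join.join connS ih ∩⁻ˡ (ftypeA eA≤k) (conn-resp C⊆B
      (λ {x} x∈B → case x ∈? C of λ { (yes x∈C) → x∈C ; (no x∉C) → contradiction (∖⁺ x∈B x∉C) empty }) connC)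
    ...   | no eA≰k = finish cheap (≤-trans (≤-reflexive (+-suc k 1)) (+-monoˡ-≤ 1 (≰⇒> eA≰k)))
    by-components cs@(more _ _ _ _ (more _ _ _ _ cs′)) with rest cs ∖⁻ˡ v∉B offB
    ... | inj₁ done = done
    ... | inj₂ cheap = finish cheap (+-mono-≤ (copy-edges copyA) (s≤s (s≤s z≤n)))

    conclusion : Outcome S
    conclusion = by-components (components B)

  outcome : ∀ S → Conn S → Outcome S
  outcome S = go (suc (size S)) S ≤-refl
    where
    go : ∀ bound S → size S < bound → Conn S → Outcome S
    go (suc bound) S (s≤s |S|≤) conn with HasCopy? S
    ... | no ¬c = loose ([] , (λ c → ¬c (copy-mono ∖⁻ˡ c)) , z≤n)
    ... | yes c = AtCentre.conclusion conn (λ C |C| → go bound C (≤-trans |C| |S|≤)) c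

  -- From the trichotomy to the isolation number

  isolating : ∀ {D} → Clear full D → Isolating G F (Vec.tabulate (elements D))
  isolating {D} clear (φ , φ-inj , φ-edges) with any? (λ a → φ a ∈? dom D)
  ... | no ∄ = contradiction (copy φ φ-inj φ-edges λ a → ∖⁺ (mem refl) λ a∈D → ∄ (a , a∈D)) clear
  ... | yes (a , a∈D) with ∈dom⁻ D a∈D
  ...   | u , u∈D , near = a , u
    , lookup⇒[]= u _ (trans (lookup∘tabulate (elements D) u) (holds (∈-elements u∈D)))
    , (case near of λ { (inj₁ eq) → inj₁ (≡-sym eq) ; (inj₂ u~) → inj₂ u~ })

  iota≤ : ∀ {d D} → IotaIs G F d → Clear full D → d ≤ length D
  iota≤ {d} {D} (_ , minimal) clear = begin
    d  ≤⟨ minimal _ (isolating clear) ⟩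
    Subset.∣ Vec.tabulate (elements D) ∣  ≡⟨ card (Vec.tabulate (elements D)) ⟩
    size (Vec.lookup (Vec.tabulate (elements D)))
                                            ≡⟨ sum-cong (λ x → cong ⟦_⟧ (lookup∘tabulate (elements D) x)) ⟩
    size (elements D)  ≤⟨ size-elements D ⟩
    length D  ∎
    where open ≤-Reasoning

  -- A set with exactly `k` edges has none to spare beyond those of the copy, so the copy is
  -- induced.
  exact-copy : ∀ {S} (fS : FType S) → ∀ a b → adj G (emb (copyF fS) a) (emb (copyF fS) b) ≡ adj F a b
  exact-copy {S} fS a b = ≡-sym (matrix-≡ (adj F) _ (edges (copyF fS)) (begin
    sum (λ a → sum λ b → ⟦ adj G (φ a) (φ b) ⟧)  ≤⟨ pullback≤E φ (inj (copyF fS)) (inside (copyF fS)) ⟩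
    E S S  ≡⟨ e-double S ⟨
    e S + e S  ≡⟨ cong₂ _+_ (edgeF fS) (edgeF fS) ⟩
    k + k  ≡⟨ double-edges-F ⟨
    sum (λ a → sum λ b → ⟦ adj F a b ⟧)  ∎) a b)
    where
    open ≤-Reasoning
    φ = emb (copyF fS)

  copy-onto : ∀ {S} → size S ≤ p → (c : HasCopy S) → ∀ {x} → x ∈ S → ∃ λ a → emb c a ≡ x
  copy-onto {S} |S| c {x} x∈S with x ∈? image (emb c)
  ... | yes x∈ = ∈-image⁻ (emb c) x∈
  ... | no x∉ = contradiction (copy-size {image (emb c)} (copy (emb c) (inj c) (edges c) (∈-image (emb c))))
    (<⇒≱ (≤-trans (size-strict (λ y∈ → let (a , eq) = ∈-image⁻ (emb c) y∈ in subst (_∈ S) eq (inside c a)) x∈S x∉) |S|))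

  module Spanning (|G| : size (full {n}) ≡ p) (c : HasCopy full) where

    φ : Fin p → Fin n
    φ = emb c

    ψ : Fin n → Fin p
    ψ x = proj₁ (copy-onto (≤-reflexive |G|) c {x} (mem refl))

    φψ : ∀ x → φ (ψ x) ≡ x
    φψ x = proj₂ (copy-onto (≤-reflexive |G|) c {x} (mem refl))

    ψ-inj : Injective _≡_ _≡_ ψ
    ψ-inj {x} {y} eq = trans (≡-sym (φψ x)) (trans (cong φ eq) (φψ y))

  -- Were every edge of the graph an image of an edge of `F`, pulling back would fit `k + 1` edges
  -- into `F`. So some edge comes from a non-edge of `F`, and once that one is added both sides have
  -- equally many edges.
  near⇒F+e : size (full {n}) ≡ p → numEdges G ≡ suc k → HasCopy full →
    ∃[ a ] ∃[ b ] ∃[ a≢b ] (adj F a b ≡ false × G ≅ addEdge F a b a≢b)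
  near⇒F+e |G| eG c with any? (λ a → any? λ b → (adj G (emb c a) (emb c b) Bool.≟ true) ×-dec (adj F a b Bool.≟ false))
  ... | no none = contradiction (begin
    suc k + suc k  ≡⟨ cong₂ _+_ eG eG ⟨
    numEdges G + numEdges G  ≡⟨ numEdges-double G ⟨
    sum (λ i → sum λ j → ⟦ adj G i j ⟧)  ≡⟨ sum-cong (λ i → sum-cong λ j → cong ⟦_⟧ (cong₂ (adj G) (φψ i) (φψ j))) ⟨
    sum (λ i → sum λ j → ⟦ adj G (φ (ψ i)) (φ (ψ j)) ⟧)
                                                  ≤⟨ sum-mono (λ i → sum-mono λ j → ⟦⟧-mono (absorb (ψ i) (ψ j))) ⟩
    sum (λ i → sum λ j → ⟦ adj F (ψ i) (ψ j) ⟧)  ≤⟨ Edges.pullback≤E F {Y = full} ψ ψ-inj (λ _ → mem refl) ⟩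
    Edges.E F full full  ≡⟨ double-edges-F ⟩
    k + k  ∎) (<⇒≱ (+-mono-< ≤-refl ≤-refl))
    where
    open ≤-Reasoning
    open Spanning |G| c
    absorb : ∀ a b → adj G (φ a) (φ b) ≡ true → adj F a b ≡ true
    absorb a b ab∈G with adj F a b in ab
    ... | true = refl
    ... | false = contradiction (a , b , ab∈G , ab) none
  ... | yes (a , b , ab∈G , ab∉F) = a , b , a≢b , ab∉F , ψ , (ψ-inj , ψ-surj) , λ i j →
    trans (matrix-≡ (adj F′) (λ a b → adj G (φ a) (φ b)) F′≤G G≤F′ (ψ i) (ψ j)) (cong₂ (adj G) (φψ i) (φψ j))
    where
    open Spanning |G| c
    ψ-surj : ∀ y → ∃ λ x → ∀ {z} → z ≡ x → ψ z ≡ y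
    ψ-surj y = φ y , λ { refl → inj c (φψ (φ y)) }
    a≢b : a ≢ b
    a≢b refl = ~-≢ ab∈G refl
    F′ = addEdge F a b a≢b
    F′≤G : ∀ i j → adj F′ i j ≡ true → φ i ~ φ j
    F′≤G i j ij with adj F i j in ij∈F
    ... | true = edges c i j ij∈F
    ... | false with i ≟ a | j ≟ b | i ≟ b | j ≟ a
    ...   | yes refl | yes refl | _ | _ = ab∈G
    ...   | _ | _ | yes refl | yes refl = ~-sym ab∈G
    ...   | yes _ | no _ | yes _ | no _ = case ij of λ ()
    ...   | yes _ | no _ | no _ | _ = case ij of λ ()
    ...   | no _ | _ | yes _ | no _ = case ij of λ ()
    ...   | no _ | _ | no _ | _ = case ij of λ ()
    G≤F′ : sum (λ i → sum λ j → ⟦ adj G (φ i) (φ j) ⟧) ≤ sum (λ i → sum λ j → ⟦ adj F′ i j ⟧)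
    G≤F′ = begin
      sum (λ i → sum λ j → ⟦ adj G (φ i) (φ j) ⟧)  ≤⟨ pullback≤E {Y = full} φ (inj c) (λ _ → mem refl) ⟩
      E full full  ≡⟨ numEdges-double G ⟩
      numEdges G + numEdges G  ≡⟨ cong₂ _+_ eG′ eG′ ⟩
      numEdges F′ + numEdges F′  ≡⟨ numEdges-double F′ ⟨
      sum (λ i → sum λ j → ⟦ adj F′ i j ⟧)  ∎
      where
      open ≤-Reasoning
      eG′ : numEdges G ≡ numEdges F′
      eG′ = trans eG (trans (cong suc (≡-sym edges-F)) (≡-sym (numEdges-addEdge F a b a≢b ab∉F)))

  -- The quotient tree of a pure special graph.

  lookup-apart : ∀ {L} → AllPairs Disjoint L → ∀ i j → i ≢ j → Disjoint (lookup L i) (lookup L j)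
  lookup-apart (_ ∷ _)   zero    zero    i≢j = contradiction refl i≢j
  lookup-apart {_ ∷ L} (d ∷ _)  zero    (suc j) _   = All.lookup d (∈-lookup {xs = L} j)
  lookup-apart {c ∷ L} (d ∷ _)  (suc i) zero    _   = disjoint-sym {c} {lookup L i} (All.lookup d (∈-lookup {xs = L} i))
  lookup-apart (_ ∷ ds)  (suc i) (suc j) i≢j = lookup-apart ds i j (i≢j ∘ cong suc)

  -- Deleting the copies one after another removes at least `k + 1` edges each time, the copy and
  -- its edge to the connection, and never deletes a connection.
  prune : ∀ {S} L {Y} → Y ⊆ S → (∀ {v A} → (v , A) ∈ˡ L → Constituent S v A × v ∈ Y × A ⊆ Y) → AllPairs Disjoint L →
    ∃ λ Z → (∀ {u} → u ∈ Y → (∀ {v A} → (v , A) ∈ˡ L → u ∉ A) → u ∈ Z) × e Z + length L * (k + 1) ≤ e Y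
  prune [] {Y} Y⊆S each _ = Y , (λ u∈Y _ → u∈Y) , ≤-reflexive (+-identityʳ (e Y))
  prune ((v , A) ∷ L) {Y} Y⊆S each (d ∷ ds) with each (here refl)
  ... | con , v∈Y , A⊆Y with attachment con
  ...   | w , w∈A , v~w with prune L {Y ∖ A} (λ y∈ → Y⊆S (∖⁻ˡ y∈))
      (λ d∈ → let (con′ , v′∈Y , A′⊆Y) = each (there d∈) ; (_ , _ , v′∉A , A#) = All.lookup d d∈ in
        con′ , ∖⁺ v′∈Y v′∉A , λ x∈ → ∖⁺ (A′⊆Y x∈) λ x∈A → A# x∈A x∈) ds
  ...     | Z , keep , bound = Z , (λ u∈Y u∉ → keep (∖⁺ u∈Y (u∉ (here refl))) (u∉ ∘ there)) , (begin
      e Z + (k + 1 + length L * (k + 1))  ≡⟨ arith (e Z) k (length L * (k + 1)) ⟩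
      k + (e Z + length L * (k + 1)) + 1  ≤⟨ +-mono-≤ (+-mono-≤ (≤-reflexive (≡-sym (edgeF (Constituent.fA con)))) bound)
                                                  (E-positive w∈A (∖⁺ v∈Y (Constituent.v∉A con)) (~-sym v~w)) ⟩
      e A + e (Y ∖ A) + E A (Y ∖ A)  ≡⟨ e-part (part-∖ A⊆Y) ⟨
      e Y  ∎)
      where
      open ≤-Reasoning
      arith : ∀ a k b → a + (k + 1 + b) ≡ k + (a + b) + 1
      arith = solve-∀

  module Quotient {L} (spec : Spec full full L) (total : cost L ≡ suc (numEdges G)) (connG : Connected G) where

    open Spec spec

    q : ℕ
    q = length L

    v : Fin q → Fin n
    v i = proj₁ (lookup L i)

    A : Fin q → Sub n
    A i = proj₂ (lookup L i)

    con : ∀ i → Constituent full (v i) (A i)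
    con i = proj₁ (each (∈-lookup {xs = L} i))

    φ : Fin q → Fin p → Fin n
    φ i = emb (copyF (Constituent.fA (con i)))

    φ∈A : ∀ i a → φ i a ∈ A i
    φ∈A i = inside (copyF (Constituent.fA (con i)))

    φ-onto : ∀ i {x} → x ∈ A i → ∃ λ a → φ i a ≡ x
    φ-onto i = copy-onto (size≤p (Constituent.fA (con i))) (copyF (Constituent.fA (con i)))

    different : ∀ {i j} → i ≢ j → Disjoint (lookup L i) (lookup L j)
    different = lookup-apart apart _ _

    Owns : Fin q → Fin n → Set
    Owns i x = x ≡ v i ⊎ x ∈ A i

    owner : ∀ x → ∃ λ i → Owns i x
    owner x with cover {x} (mem refl)
    ... | v₀ , A₀ , d∈ , x∈ = Any.index d∈ , subst (λ d → x ≡ proj₁ d ⊎ x ∈ proj₂ d) (lookup-index d∈) x∈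

    owner-unique : ∀ {i j x} → Owns i x → Owns j x → i ≡ j
    owner-unique {i} {j} own-i own-j with i ≟ j
    ... | yes i≡j = i≡j
    ... | no i≢j with different i≢j | own-i | own-j
    ...   | v≢ , _ , _ , _    | inj₁ refl | inj₁ v≡ = contradiction v≡ v≢
    ...   | _ , v∉ , _ , _    | inj₁ refl | inj₂ v∈ = contradiction v∈ v∉
    ...   | _ , _ , v∉ , _    | inj₂ v∈ | inj₁ refl = contradiction v∈ v∉
    ...   | _ , _ , _ , A#    | inj₂ x∈ | inj₂ x∈′ = contradiction x∈′ (A# x∈)

    v-injective : Injective _≡_ _≡_ v
    v-injective eq = owner-unique (inj₁ refl) (inj₁ eq)

    abstract
      hinge : ∀ i → ∃ λ a → v i ~ φ i a × (∀ {b} → v i ~ φ i b → b ≡ a)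
      hinge i with unique-edge {⁅ v i ⁆} {A i} (Constituent.oneEdge (con i))
      ... | v′ , x , v′∈ , x∈A , v′~x , only with ∈⁅⁆⁻ v′∈ | φ-onto i x∈A
      ...   | refl | a , refl = a , v′~x , λ {b} v~b →
        inj (copyF (Constituent.fA (con i))) (proj₂ (only ∈⁅⁆ (φ∈A i b) v~b))

    w : Fin q → Fin p
    w i = proj₁ (hinge i)

    v~w : ∀ i → v i ~ φ i (w i)
    v~w i = proj₁ (proj₂ (hinge i))

    w-unique : ∀ {i a} → v i ~ φ i a → a ≡ w i
    w-unique {i} = proj₂ (proj₂ (hinge i))

    T : Graph q
    T = record { adj = λ i j → adj G (v i) (v j) ; sym = λ i j → sym G (v i) (v j) ; irrefl = λ i → irrefl G (v i) }

    step-T : ∀ {i j x y} → Owns i x → Owns j y → x ~ y → i ≡ j ⊎ adj T i j ≡ true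
    step-T {i} {j} (inj₂ x∈A) own-j x~y with Constituent.closed (con i) x∈A (mem refl) x~y
    ... | y-in = inj₁ (owner-unique y-in own-j)
    step-T {i} {j} own-i (inj₂ y∈A) x~y with Constituent.closed (con j) y∈A (mem refl) (~-sym x~y)
    ... | x-in = inj₁ (owner-unique own-i x-in)
    step-T (inj₁ refl) (inj₁ refl) x~y = inj₂ x~y

    -- Constituents are contracted along the walk: an edge that changes constituent can only join
    -- two connections.
    reach-T : ∀ {x y i j} → Reach G x y → Owns i x → Owns j y → Reach T i j
    reach-T here own-i own-j with owner-unique own-i own-j
    ... | refl = here
    reach-T (step {j = z} x~z r) own-i own-j with owner z
    ... | l , own-l with step-T own-i own-l x~z
    ...   | inj₁ refl = reach-T r own-l own-j
    ...   | inj₂ i~l = step i~l (reach-T r own-l own-j)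

    connected-T : Connected T
    connected-T i j = reach-T (connG (v i) (v j)) (inj₁ refl) (inj₁ refl)

    -- After all copies are pruned, the edges among connections are what remains of a total one
    -- below `q * (k + 2)`, with `k + 1` taken off for each constituent.
    few-edges-T : Edges.e T full < q
    few-edges-T with prune L {full} (λ x → x) each apart
    ... | Z , keep , bound = +-cancelʳ-≤ (q * (k + 1)) _ _ (begin
      suc (Edges.e T full) + q * (k + 1)  ≤⟨ s≤s (+-monoˡ-≤ (q * (k + 1)) T≤Z) ⟩
      suc (e Z + q * (k + 1))  ≤⟨ s≤s bound ⟩
      suc (e full)  ≡⟨ cong suc e-full ⟩
      suc (numEdges G)  ≡⟨ total ⟨
      q * (k + 2)  ≡⟨ arith q k ⟩
      q + q * (k + 1)  ∎)
      where
      open ≤-Reasoning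
      arith : ∀ q k → q * (k + 2) ≡ q + q * (k + 1)
      arith = solve-∀
      v∈Z : ∀ i → v i ∈ Z
      v∈Z i = keep (mem refl) λ {v₀} {A₀} d∈ v∈A₀ →
        case owner-unique {i} {Any.index d∈} (inj₁ refl) (inj₂ (subst (λ d → v i ∈ proj₂ d) (lookup-index d∈) v∈A₀)) of λ
          { refl → Constituent.v∉A (con i) (subst (λ d → v i ∈ proj₂ d) (lookup-index d∈) v∈A₀) }
      T≤Z : Edges.e T full ≤ e Z
      T≤Z = halve-≤ (begin
        Edges.e T full + Edges.e T full  ≡⟨ Edges.e-double T full ⟩
        sum (λ i → sum λ j → ⟦ adj G (v i) (v j) ⟧)  ≤⟨ pullback≤E {Y = Z} v v-injective v∈Z ⟩
        E Z Z  ≡⟨ e-double Z ⟨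
        e Z + e Z  ∎)

    1≤q : 1 ≤ q
    1≤q = ≤-trans (s≤s z≤n) few-edges-T

    tree-T : IsTree T
    tree-T = connected-T , Cycles.acyclic T (connected⇒Conn T connected-T (fromℕ< 1≤q)) few-edges-T

    place : Fin q ⊎ (Fin q × Fin p) → Fin n
    place (inj₁ i)       = v i
    place (inj₂ (i , a)) = φ i a

    place-injective : Injective _≡_ _≡_ place
    place-injective {inj₁ i} {inj₁ j} eq = cong inj₁ (v-injective eq)
    place-injective {inj₁ i} {inj₂ (j , b)} eq
      with owner-unique {i} {j} (inj₁ refl) (inj₂ (subst (_∈ A j) (≡-sym eq) (φ∈A j b)))
    ... | refl = contradiction (subst (_∈ A i) (≡-sym eq) (φ∈A i b)) (Constituent.v∉A (con i))
    place-injective {inj₂ (i , a)} {inj₁ j} eq with owner-unique {i} {j} (inj₂ (φ∈A i a)) (inj₁ eq)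
    ... | refl = contradiction (subst (_∈ A i) eq (φ∈A i a)) (Constituent.v∉A (con i))
    place-injective {inj₂ (i , a)} {inj₂ (j , b)} eq
      with owner-unique {i} {j} (inj₂ (φ∈A i a)) (inj₂ (subst (_∈ A j) (≡-sym eq) (φ∈A j b)))
    ... | refl = cong (λ a → inj₂ (i , a)) (inj (copyF (Constituent.fA (con i))) eq)

    place-surjective : ∀ x → ∃ λ y → ∀ {z} → z ≡ y → place z ≡ x
    place-surjective x with owner x
    ... | i , inj₁ x≡v = inj₁ i , λ { refl → ≡-sym x≡v }
    ... | i , inj₂ x∈A = let (a , eq) = φ-onto i x∈A in inj₂ (i , a) , λ { refl → eq }

    connection-adj : ∀ i j b → adj G (v i) (φ j b) ≡ ⌊ i ≟ j ⌋ ∧ ⌊ b ≟ w i ⌋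
    connection-adj i j b with i ≟ j
    ... | yes refl = bool-≡ (λ v~b → if-yes (b ≟ w i) (w-unique v~b))
                            (λ eq → subst (λ b → v i ~ φ i b) (≡-sym (yes⇒ (b ≟ w i) eq)) (v~w i))
    ... | no i≢j = bool-≡ (λ v~b → contradiction
      (owner-unique {i} {j} (inj₁ refl) (Constituent.closed (con j) (φ∈A j b) (mem refl) (~-sym v~b))) i≢j) λ ()

    place-adj : ∀ x y → adj G (place x) (place y) ≡ specialAdj T F w x y
    place-adj (inj₁ i) (inj₁ j) = refl
    place-adj (inj₁ i) (inj₂ (j , b)) = connection-adj i j b
    place-adj (inj₂ (i , a)) (inj₁ j) = trans (sym G (φ i a) (v j))
      (trans (connection-adj j i a) (cong (_∧ ⌊ a ≟ w j ⌋) (⌊≟⌋-sym j i)))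
    place-adj (inj₂ (i , a)) (inj₂ (j , b)) with i ≟ j
    ... | yes refl = exact-copy (Constituent.fA (con i)) a b
    ... | no i≢j = bool-≡ (λ a~b → contradiction
      (owner-unique {i} {j} (Constituent.closed (con i) (φ∈A i a) (mem refl) a~b) (inj₂ (φ∈A j b))) i≢j) λ ()

    pureSpecial : ∀ {m} → numEdges G ≡ m → PureSpecial m F G
    pureSpecial {m} eG = q , 1≤q
      , trans (+-comm m 1) (trans (cong suc (≡-sym eG)) (trans (≡-sym total) (cong (λ k → q * (k + 2)) (≡-sym edges-F))))
      , T , tree-T , w , place , (place-injective , place-surjective) , place-adj

  -- The two directions of the equivalence.

  isolating-meets : ∀ D → Isolating G F D → (c : HasCopy full) →
    ∃ λ u → u ∈ Vec.lookup D × ∃ λ a → u ≡ emb c a ⊎ u ~ emb c a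
  isolating-meets D iso c with iso (emb c , inj c , edges c)
  ... | a , u , u∈D , near = u , mem ([]=⇒lookup u∈D) , a , near

  -- Looseness would give `d * (k + 2) ≤ m`, a graph without a copy would give `d` equal to zero,
  -- and for `F` itself the number `k + 1` is not a multiple of `k + 2`.
  forward : ∀ {m d} → Connected G → numEdges G ≡ m → IotaIs G F d → d * (k + 2) ≡ m + 1 →
    PureSpecial m F G ⊎ (∃[ a ] ∃[ b ] ∃[ a≢b ] (adj F a b ≡ false × G ≅ addEdge F a b a≢b))
  forward {m} {d} connG eG iota eq with HasCopy? full
  ... | no ¬c with iota≤ {D = []} iota (λ c → ¬c (copy-mono ∖⁻ˡ c))
  ...   | z≤n = contradiction (trans eq (+-comm m 1)) λ ()
  forward {m} {d} connG eG iota eq | yes c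
    with outcome full (connected⇒Conn G connG (emb c (proj₁ centre-F)))
  ... | tight (special L spec total) = inj₁ (Quotient.pureSpecial spec (trans total (cong suc e-full)) connG eG)
  ... | tight (nearly |G| eF c′) = inj₂ (near⇒F+e |G| (trans (≡-sym e-full) eF) c′)
  ... | loose (D , clear , bound) = contradiction (begin
    suc m  ≡⟨ +-comm 1 m ⟩
    m + 1  ≡⟨ eq ⟨
    d * (k + 2)  ≤⟨ *-monoˡ-≤ (k + 2) (iota≤ iota clear) ⟩
    cost D  ≤⟨ bound ⟩
    e full  ≡⟨ trans e-full eG ⟩
    m  ∎) (<⇒≱ ≤-refl)
    where open ≤-Reasoning
  ... | isF fF = contradiction (trans eq (cong (_+ 1) (trans (≡-sym eG) (trans (≡-sym e-full) (edgeF fF))))) (never d)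
    where
    never : ∀ d → d * (k + 2) ≢ k + 1
    never zero    eq = case trans eq (+-comm k 1) of λ ()
    never (suc d) eq = <⇒≱ (+-monoʳ-< k (≤-refl {2})) (≤-trans (m≤m+n (k + 2) (d * (k + 2))) (≤-reflexive eq))

  -- The connections isolate, so `d ≤ q`. Conversely, a vertex that dominates some vertex of a
  -- constituent copy belongs to that constituent, so an isolating set has a member in each of the
  -- `q` constituents.
  special⇒ : ∀ {m d} → IotaIs G F d → PureSpecial m F G → d * (k + 2) ≡ m + 1
  special⇒ {m} {d} iota@((D₀ , iso₀ , |D₀|) , _) (q , 1≤q , total , T , _ , w , place , (place-inj , place-surj) , place-adj) =
    trans (cong (_* (k + 2)) (≤-antisym d≤q q≤d)) (trans (cong (λ k → q * (k + 2)) (≡-sym edges-F)) (≡-sym total))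
    where
    v : Fin q → Fin n
    v i = place (inj₁ i)
    φ : Fin q → Fin p → Fin n
    φ i a = place (inj₂ (i , a))
    place⁻¹ : ∀ x → ∃ λ y → place y ≡ x
    place⁻¹ x = let (y , eq) = place-surj x in y , eq refl
    φ-inj : ∀ i → Injective _≡_ _≡_ (φ i)
    φ-inj i eq with place-inj eq
    ... | refl = refl
    D : List (Fin n)
    D = tabulate v
    v∈D : ∀ i → v i ∈ˡ D
    v∈D i = ∈-tabulate⁺ i
    clear : Clear full D
    clear c = go (place⁻¹ u)
      where
      open Centred (centred c)
      go : (∃ λ y → place y ≡ u) → ⊥
      go (inj₁ i , eq) = not-dominator (v∈D i) u∈Y (≡-sym eq)
      go (inj₂ (i , a) , eq) = free-drop (size-image (φ i)) (∈-image (φ i) (w i))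
        (λ w∈X → not-dominated (v∈D i) (X⊆Y w∈X) (trans (place-adj (inj₁ i) (inj₂ (i , w i)))
          (cong₂ _∧_ (if-yes (i ≟ i) refl) (if-yes (w i ≟ w i) refl)))) sub hasX
        where
        sub : X ⊆ image (φ i)
        sub {s} s∈X with around s∈X | place⁻¹ s
        ... | inj₁ refl | _ = subst (_∈ image (φ i)) eq (∈-image (φ i) a)
        ... | inj₂ _ | inj₁ j , eq′ = contradiction (≡-sym eq′) (not-dominator (v∈D j) (X⊆Y s∈X))
        ... | inj₂ u~s | inj₂ (j , b) , refl
          with i ≟ j | trans (≡-sym (place-adj (inj₂ (i , a)) (inj₂ (j , b)))) (subst (_~ φ j b) (≡-sym eq) u~s)
        ...   | yes refl | _ = ∈-image (φ i) b
        ...   | no _ | ()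
    d≤q : d ≤ q
    d≤q = ≤-trans (iota≤ iota clear) (≤-reflexive (length-tabulate v))
    constituent-of : Fin q ⊎ (Fin q × Fin p) → Fin q
    constituent-of (inj₁ i) = i
    constituent-of (inj₂ (i , _)) = i
    copyAt : Fin q → HasCopy full
    copyAt i = copy (φ i) (φ-inj i) (λ a b ab → trans (place-adj (inj₂ (i , a)) (inj₂ (i , b)))
      (cong₂ _∧_ (if-yes (i ≟ i) refl) ab)) λ _ → mem refl
    own : ∀ i y a → place y ≡ φ i a ⊎ place y ~ φ i a → constituent-of y ≡ i
    own i y a (inj₁ eq) with place-inj eq
    ... | refl = refl
    own i (inj₁ j) a (inj₂ adjacent) with j ≟ i | trans (≡-sym (place-adj (inj₁ j) (inj₂ (i , a)))) adjacent
    ... | yes j≡i | _ = j≡i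
    ... | no _ | ()
    own i (inj₂ (j , b)) a (inj₂ adjacent) with j ≟ i | trans (≡-sym (place-adj (inj₂ (j , b)) (inj₂ (i , a)))) adjacent
    ... | yes j≡i | _ = j≡i
    ... | no _ | ()
    hit : Fin q → Fin n
    hit i = proj₁ (isolating-meets D₀ iso₀ (copyAt i))
    hit∈D₀ : ∀ i → hit i ∈ Vec.lookup D₀
    hit∈D₀ i = proj₁ (proj₂ (isolating-meets D₀ iso₀ (copyAt i)))
    hit-owner : ∀ i → constituent-of (proj₁ (place⁻¹ (hit i))) ≡ i
    hit-owner i = let (_ , _ , a , near) = isolating-meets D₀ iso₀ (copyAt i) ; (y , eq) = place⁻¹ (hit i) in
      own i y a (subst (λ u → u ≡ φ i a ⊎ u ~ φ i a) (≡-sym eq) near)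
    hit-inj : Injective _≡_ _≡_ hit
    hit-inj {i} {j} eq = trans (≡-sym (hit-owner i))
      (trans (cong (λ x → constituent-of (proj₁ (place⁻¹ x))) eq) (hit-owner j))
    q≤d : q ≤ d
    q≤d = begin
      q  ≡⟨ size-full ⟨
      size full  ≡⟨ sum-cong (λ i → cong ⟦_⟧ (holds (hit∈D₀ i))) ⟨
      sum (λ i → ⟦ Vec.lookup D₀ (hit i) ⟧)  ≤⟨ sum-injective hit hit-inj (λ x → ⟦ Vec.lookup D₀ x ⟧) ⟩
      size (Vec.lookup D₀)  ≡⟨ card D₀ ⟨
      Subset.∣ D₀ ∣  ≡⟨ |D₀| ⟩
      d  ∎
      where open ≤-Reasoning

  F+e⇒ : ∀ {m d} → numEdges G ≡ m → IotaIs G F d →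
    ∃[ a ] ∃[ b ] ∃[ a≢b ] (adj F a b ≡ false × G ≅ addEdge F a b a≢b) → d * (k + 2) ≡ m + 1
  F+e⇒ {m} {d} eG iota@((D₀ , iso₀ , |D₀|) , _) (a , b , a≢b , ab∉F , G≅F′@(f , (f-inj , f-surj) , f-adj)) = begin
    d * (k + 2)  ≡⟨ cong (_* (k + 2)) (≤-antisym d≤1 1≤d) ⟩
    k + 2 + 0  ≡⟨ arith k ⟩
    suc k + 1  ≡⟨ cong (λ x → suc x + 1) edges-F ⟨
    suc (numEdges F) + 1  ≡⟨ cong (_+ 1) (numEdges-addEdge F a b a≢b ab∉F) ⟨
    numEdges (addEdge F a b a≢b) + 1  ≡⟨ cong (_+ 1) (≅-numEdges {G = G} {addEdge F a b a≢b} G≅F′) ⟨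
    numEdges G + 1  ≡⟨ cong (_+ 1) eG ⟩
    m + 1  ∎
    where
    open ≡-Reasoning
    arith : ∀ k → k + 2 + 0 ≡ suc k + 1
    arith = solve-∀
    g : Fin p → Fin n
    g y = proj₁ (f-surj y)
    fg : ∀ y → f (g y) ≡ y
    fg y = proj₂ (f-surj y) refl
    F-copy : HasCopy full
    F-copy = copy g (λ {x} {y} eq → trans (≡-sym (fg x)) (trans (cong f eq) (fg y)))
      (λ x y xy → trans (≡-sym (f-adj (g x) (g y))) (trans (cong₂ (adj (addEdge F a b a≢b)) (fg x) (fg y))
        (cong (_∨ _) xy))) λ _ → mem refl
    d≤1 : d ≤ 1
    -- Any vertex would serve: the graph has no more than `p` vertices, so a copy of `F` needs all
    -- of them.
    d≤1 = iota≤ {D = g a ∷ []} iota (free-drop {full} {a = g a} (≤-trans (≤-reflexive size-full) (injective⇒≤ f-inj)) (mem refl)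
      (λ x∈ → not-dominator (here refl) x∈ refl) λ _ → mem refl)
    1≤d : 1 ≤ d
    1≤d = subst (1 ≤_) (trans (≡-sym (card D₀)) |D₀|)
      (member⇒size (proj₁ (proj₂ (isolating-meets D₀ iso₀ F-copy))))

theorem1p3 : (k : ℕ) → 3 ≤ k → (p : ℕ) (F : Graph p) → numEdges F ≡ k → DominationOne F →
    (n : ℕ) (G : Graph n) → Connected G → (m : ℕ) → numEdges G ≡ m →
    (d : ℕ) → IotaIs G F d →
    ((d * (k + 2) ≡ m + 1) ⇔
    (PureSpecial m F G ⊎
    (∃[ a ] ∃[ b ] ∃[ a≢b ] (adj F a b ≡ false × G ≅ addEdge F a b a≢b))))
theorem1p3 k 3≤k p F edges-F centre-F n G connected m edges-G d iota =
  mk⇔ (forward connected edges-G iota) [ special⇒ iota , F+e⇒ edges-G iota ]′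
  where open Isolation F centre-F k edges-F 3≤k G
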